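{- Let $F_R(n)$ be the $n\times n$ Fibonacci--Redheffer matrix. Then, as $n\to\infty$, \[ \det(F_R(n))\sim C_0\,\phi^{\frac{n(n+1)}{2}}\,5^{ -\frac{n}{2}}, \] where $C_0=C\cdot C_\phi\approx -0.7921376$, with $C=\lim_{n\to\infty}\sum_{k=1}^n\frac{\mu(k)}{F_k}$ and \[ C_\phi=\prod_{k=1}^{\infty}\left(1-b^k\right)\approx 1.226742,\qquad b=-\phi^{ -2}. \]
   Context: The Fibonacci numbers are $F_1=F_2=1$, $F_n=F_{n-1}+F_{n-2}$ for $n\ge 3$, and $\phi=\frac{1+\sqrt5}{2}$ is the golden ratio. The Fibonacci--Redheffer matrix $F_R(n)=[F_R(i,j)]_{i,j=1}^n$ is defined by $F_R(i,j)=1$ if $j=1$; $F_R(i,j)=F_i$ if $i\mid j$; and $F_R(i,j)=0$ otherwise. $\mu$ denotes the Möbius function. For sequences, $a_n\sim b_n$ means $\lim_{n\to\infty} b_n/a_n=1$. -}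

module Defs where

open import Algebra.Properties.CommutativeMonoid.Sum using (sum)
open import Data.Fin.Base using (Fin; zero; suc; toℕ; punchIn)
open import Data.Integer.Base as ℤ using (ℤ; +_; 0ℤ; 1ℤ; -1ℤ)
import Data.Integer.Properties as ℤ
open import Data.List.Base using (length)
open import Data.List.Relation.Unary.Unique.DecPropositional using (unique?)
open import Data.Nat.Base as ℕ using (ℕ; zero; suc; NonZero)
open import Data.Nat.Divisibility using (_∣?_)
open import Data.Nat.Primality.Factorisation using (factorise; factors)
import Data.Nat.Properties as ℕ
open import Data.Nat.Tactic.RingSolver using (solve-∀)
open import Data.Product.Base using (Σ-syntax; ∃-syntax; _×_; _,_; proj₁; proj₂)
open import Data.Rational.Base as ℚ using (ℚ; 0ℚ; 1ℚ; ½)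
import Data.Rational.Properties as ℚ
open import Data.Rational.Unnormalised.Base as ℚᵘ using (mkℚᵘ; *≤*)
import Data.Rational.Unnormalised.Properties as ℚᵘ
open import Data.Sum.Base using (inj₁; inj₂)
open import Relation.Binary.PropositionalEquality using (_≡_; _≢_; refl; sym; trans; cong; cong₂; subst; subst₂)
open import Relation.Nullary using (Dec; yes; no; contradiction)
open import Relation.Nullary.Decidable.Core using (dec⇒maybe)
import Tactic.RingSolver as RingSolver
open import Tactic.RingSolver.Core.AlmostCommutativeRing using (AlmostCommutativeRing; fromCommutativeRing)

IsCauchy : (ℕ → ℚ) → Set
IsCauchy s = ∀ ε → 0ℚ ℚ.< ε → ∃[ N ] (∀ m n → N ℕ.≤ m → N ℕ.≤ n → ℚ.∣ s m ℚ.- s n ∣ ℚ.< ε)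

record ℝ : Set where
  constructor mkℝ
  field
    seq    : ℕ → ℚ
    cauchy : IsCauchy seq

open ℝ public

infix 4 _<_

_<_ : ℝ → ℝ → Set
x < y = ∃[ δ ] (0ℚ ℚ.< δ × ∃[ N ] (∀ n → N ℕ.≤ n → seq x n ℚ.+ δ ℚ.≤ seq y n))

private
  open ℚ.≤-Reasoning

  ℚ-ring : AlmostCommutativeRing _ _
  ℚ-ring = fromCommutativeRing ℚ.+-*-commutativeRing λ x → dec⇒maybe (0ℚ ℚ.≟ x)

  *-mono-≤ : ∀ a b c d → 0ℚ ℚ.≤ a → 0ℚ ℚ.≤ d → a ℚ.≤ b → c ℚ.≤ d → a ℚ.* c ℚ.≤ b ℚ.* d
  *-mono-≤ a b c d 0≤a 0≤d a≤b c≤d = ℚ.≤-trans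
    (ℚ.*-monoˡ-≤-nonNeg a {{ℚ.nonNegative 0≤a}} c≤d)
    (ℚ.*-monoʳ-≤-nonNeg d {{ℚ.nonNegative 0≤d}} a≤b)

  ½ε<ε : ∀ {ε} → 0ℚ ℚ.< ε → ½ ℚ.* ε ℚ.< ε
  ½ε<ε {ε} 0<ε = subst (½ ℚ.* ε ℚ.<_) (ℚ.*-identityˡ ε)
    (ℚ.*-monoˡ-<-pos ε {{ℚ.positive 0<ε}} {½} {1ℚ} (ℚ.*<* (ℤ.+<+ (ℕ.s≤s (ℕ.s≤s ℕ.z≤n)))))

  cauchy-by : ∀ s K → 0ℚ ℚ.< K →
    (∀ η → 0ℚ ℚ.< η → ∃[ N ] (∀ m n → N ℕ.≤ m → N ℕ.≤ n → ℚ.∣ s m ℚ.- s n ∣ ℚ.≤ K ℚ.* η)) →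
    IsCauchy s
  cauchy-by s K 0<K h ε 0<ε = proj₁ r , λ m n p q → begin-strict
      ℚ.∣ s m ℚ.- s n ∣         ≤⟨ proj₂ r m n p q ⟩
      K ℚ.* (K⁻¹ ℚ.* (½ ℚ.* ε)) ≡⟨ ℚ.*-assoc K K⁻¹ (½ ℚ.* ε) ⟨
      K ℚ.* K⁻¹ ℚ.* (½ ℚ.* ε)   ≡⟨ cong (ℚ._* (½ ℚ.* ε)) (ℚ.*-inverseʳ K) ⟩
      1ℚ ℚ.* (½ ℚ.* ε)          ≡⟨ ℚ.*-identityˡ (½ ℚ.* ε) ⟩
      ½ ℚ.* ε                   <⟨ ½ε<ε 0<ε ⟩
      ε                         ∎
    where
    instance
      K-pos : ℚ.Positive K
      K-pos = ℚ.positive 0<K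
      ε-pos : ℚ.Positive ε
      ε-pos = ℚ.positive 0<ε
      K-nz : ℚ.NonZero K
      K-nz = ℚ.pos⇒nonZero K
    K⁻¹ = ℚ.1/ K
    instance
      K⁻¹-pos : ℚ.Positive K⁻¹
      K⁻¹-pos = ℚ.1/pos⇒pos K
      ½ε-pos : ℚ.Positive (½ ℚ.* ε)
      ½ε-pos = ℚ.pos*pos⇒pos ½ ε
      η-pos : ℚ.Positive (K⁻¹ ℚ.* (½ ℚ.* ε))
      η-pos = ℚ.pos*pos⇒pos K⁻¹ (½ ℚ.* ε)
    r = h (K⁻¹ ℚ.* (½ ℚ.* ε)) (ℚ.positive⁻¹ (K⁻¹ ℚ.* (½ ℚ.* ε)))

  ≤⊔ˡ : ∀ {a b k} → a ℕ.⊔ b ℕ.≤ k → a ℕ.≤ k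
  ≤⊔ˡ {a} {b} = ℕ.m⊔n≤o⇒m≤o a b

  ≤⊔ʳ : ∀ {a b k} → a ℕ.⊔ b ℕ.≤ k → b ℕ.≤ k
  ≤⊔ʳ {a} {b} = ℕ.m⊔n≤o⇒n≤o a b

  +-cauchy : ∀ s t → IsCauchy s → IsCauchy t → IsCauchy (λ n → s n ℚ.+ t n)
  +-cauchy s t cs ct = cauchy-by (λ n → s n ℚ.+ t n) (1ℚ ℚ.+ 1ℚ) (ℚ.positive⁻¹ (1ℚ ℚ.+ 1ℚ)) λ η 0<η →
    let (N , f) = cs η 0<η ; (M , g) = ct η 0<η in
    N ℕ.⊔ M , λ m n p q → begin
      ℚ.∣ (s m ℚ.+ t m) ℚ.- (s n ℚ.+ t n) ∣           ≡⟨ cong ℚ.∣_∣ (lem (s m) (t m) (s n) (t n)) ⟩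
      ℚ.∣ (s m ℚ.- s n) ℚ.+ (t m ℚ.- t n) ∣           ≤⟨ ℚ.∣p+q∣≤∣p∣+∣q∣ (s m ℚ.- s n) (t m ℚ.- t n) ⟩
      ℚ.∣ s m ℚ.- s n ∣ ℚ.+ ℚ.∣ t m ℚ.- t n ∣         ≤⟨ ℚ.+-mono-≤ (ℚ.<⇒≤ (f m n (≤⊔ˡ p) (≤⊔ˡ q)))
                                                                    (ℚ.<⇒≤ (g m n (≤⊔ʳ {N} p) (≤⊔ʳ {N} q))) ⟩
      η ℚ.+ η                                         ≡⟨ two η ⟩
      (1ℚ ℚ.+ 1ℚ) ℚ.* η                               ∎
    where
    lem : ∀ a b c d → (a ℚ.+ b) ℚ.- (c ℚ.+ d) ≡ (a ℚ.- c) ℚ.+ (b ℚ.- d)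
    lem = RingSolver.solve-∀ ℚ-ring
    two : ∀ a → a ℚ.+ a ≡ (1ℚ ℚ.+ 1ℚ) ℚ.* a
    two = RingSolver.solve-∀ ℚ-ring

  neg-cauchy : ∀ s → IsCauchy s → IsCauchy (λ n → ℚ.- s n)
  neg-cauchy s cs ε 0<ε = let (N , f) = cs ε 0<ε in
    N , λ m n p q → subst (ℚ._< ε)
      (trans (sym (ℚ.∣-p∣≡∣p∣ (s m ℚ.- s n))) (cong ℚ.∣_∣ (ℚ.neg-distrib-+ (s m) (ℚ.- s n)))) (f m n p q)

  p≤∣p∣ : ∀ p → p ℚ.≤ ℚ.∣ p ∣
  p≤∣p∣ p with ℚ.≤-total 0ℚ p
  ... | inj₁ 0≤p = ℚ.≤-reflexive (sym (ℚ.0≤p⇒∣p∣≡p 0≤p))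
  ... | inj₂ p≤0 = ℚ.≤-trans p≤0 (ℚ.0≤∣p∣ p)

  ∣∣≤ : ∀ p q → p ℚ.≤ q → ℚ.- p ℚ.≤ q → ℚ.∣ p ∣ ℚ.≤ q
  ∣∣≤ p q h k with ℚ.∣p∣≡p∨∣p∣≡-p p
  ... | inj₁ e = ℚ.≤-trans (ℚ.≤-reflexive e) h
  ... | inj₂ e = ℚ.≤-trans (ℚ.≤-reflexive e) k

  ∣∣-sym : ∀ a b → ℚ.∣ a ℚ.- b ∣ ≡ ℚ.∣ b ℚ.- a ∣
  ∣∣-sym a b = trans (sym (ℚ.∣-p∣≡∣p∣ (a ℚ.- b))) (cong ℚ.∣_∣ (lem a b))
    where
    lem : ∀ a b → ℚ.- (a ℚ.- b) ≡ b ℚ.- a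
    lem = RingSolver.solve-∀ ℚ-ring

  ∣a∣≤∣b∣+∣a-b∣ : ∀ a b → ℚ.∣ a ∣ ℚ.≤ ℚ.∣ b ∣ ℚ.+ ℚ.∣ a ℚ.- b ∣
  ∣a∣≤∣b∣+∣a-b∣ a b = subst (λ z → ℚ.∣ z ∣ ℚ.≤ ℚ.∣ b ∣ ℚ.+ ℚ.∣ a ℚ.- b ∣) (lem a b) (ℚ.∣p+q∣≤∣p∣+∣q∣ b (a ℚ.- b))
    where
    lem : ∀ a b → b ℚ.+ (a ℚ.- b) ≡ a
    lem = RingSolver.solve-∀ ℚ-ring

  a≤b+c⇒a-b≤c : ∀ a b c → a ℚ.≤ b ℚ.+ c → a ℚ.- b ℚ.≤ c
  a≤b+c⇒a-b≤c a b c h = subst (a ℚ.- b ℚ.≤_) (lem b c) (ℚ.+-monoˡ-≤ (ℚ.- b) h)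
    where
    lem : ∀ b c → b ℚ.+ c ℚ.- b ≡ c
    lem = RingSolver.solve-∀ ℚ-ring

  ∣-∣-lip : ∀ a b → ℚ.∣ ℚ.∣ a ∣ ℚ.- ℚ.∣ b ∣ ∣ ℚ.≤ ℚ.∣ a ℚ.- b ∣
  ∣-∣-lip a b = ∣∣≤ (ℚ.∣ a ∣ ℚ.- ℚ.∣ b ∣) ℚ.∣ a ℚ.- b ∣
    (a≤b+c⇒a-b≤c ℚ.∣ a ∣ ℚ.∣ b ∣ ℚ.∣ a ℚ.- b ∣ (∣a∣≤∣b∣+∣a-b∣ a b))
    (subst₂ ℚ._≤_ (lem ℚ.∣ b ∣ ℚ.∣ a ∣) (∣∣-sym b a)
      (a≤b+c⇒a-b≤c ℚ.∣ b ∣ ℚ.∣ a ∣ ℚ.∣ b ℚ.- a ∣ (∣a∣≤∣b∣+∣a-b∣ b a)))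
    where
    lem : ∀ a b → a ℚ.- b ≡ ℚ.- (b ℚ.- a)
    lem = RingSolver.solve-∀ ℚ-ring

  ∣∣-cauchy : ∀ s → IsCauchy s → IsCauchy (λ n → ℚ.∣ s n ∣)
  ∣∣-cauchy s cs ε 0<ε = let (N , f) = cs ε 0<ε in
    N , λ m n p q → ℚ.≤-<-trans (∣-∣-lip (s m) (s n)) (f m n p q)

  eventually-bounded : ∀ s → IsCauchy s →
    ∃[ B ] (0ℚ ℚ.< B × ∃[ N ] (∀ n → N ℕ.≤ n → ℚ.∣ s n ∣ ℚ.≤ B))
  eventually-bounded s cs = let (N , f) = cs 1ℚ (ℚ.positive⁻¹ 1ℚ) in
    ℚ.∣ s N ∣ ℚ.+ 1ℚ , ℚ.+-mono-≤-< (ℚ.0≤∣p∣ (s N)) (ℚ.positive⁻¹ 1ℚ) ,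
    N , λ n N≤n → ℚ.≤-trans (∣a∣≤∣b∣+∣a-b∣ (s n) (s N))
      (ℚ.+-monoʳ-≤ ℚ.∣ s N ∣ (ℚ.<⇒≤ (f n N N≤n ℕ.≤-refl)))

  *-cauchy : ∀ s t → IsCauchy s → IsCauchy t → IsCauchy (λ n → s n ℚ.* t n)
  *-cauchy s t cs ct =
    let (A , 0<A , L , a) = eventually-bounded s cs ; (B , 0<B , M , b) = eventually-bounded t ct in
    cauchy-by (λ n → s n ℚ.* t n) (A ℚ.+ B) (ℚ.+-mono-< 0<A 0<B) λ η 0<η →
    let (N , f) = cs η 0<η ; (O , g) = ct η 0<η in
    (L ℕ.⊔ M) ℕ.⊔ (N ℕ.⊔ O) , λ m n p q → begin
      ℚ.∣ s m ℚ.* t m ℚ.- s n ℚ.* t n ∣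
        ≡⟨ cong ℚ.∣_∣ (lem (s m) (t m) (s n) (t n)) ⟩
      ℚ.∣ s m ℚ.* (t m ℚ.- t n) ℚ.+ (s m ℚ.- s n) ℚ.* t n ∣
        ≤⟨ ℚ.∣p+q∣≤∣p∣+∣q∣ (s m ℚ.* (t m ℚ.- t n)) ((s m ℚ.- s n) ℚ.* t n) ⟩
      ℚ.∣ s m ℚ.* (t m ℚ.- t n) ∣ ℚ.+ ℚ.∣ (s m ℚ.- s n) ℚ.* t n ∣
        ≡⟨ cong₂ ℚ._+_ (ℚ.∣p*q∣≡∣p∣*∣q∣ (s m) (t m ℚ.- t n)) (ℚ.∣p*q∣≡∣p∣*∣q∣ (s m ℚ.- s n) (t n)) ⟩
      ℚ.∣ s m ∣ ℚ.* ℚ.∣ t m ℚ.- t n ∣ ℚ.+ ℚ.∣ s m ℚ.- s n ∣ ℚ.* ℚ.∣ t n ∣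
        ≤⟨ ℚ.+-mono-≤
             (*-mono-≤ ℚ.∣ s m ∣ A ℚ.∣ t m ℚ.- t n ∣ η (ℚ.0≤∣p∣ (s m)) (ℚ.<⇒≤ 0<η) (a m (≤⊔ˡ (≤⊔ˡ p)))
               (ℚ.<⇒≤ (g m n (≤⊔ʳ {N} (≤⊔ʳ {L ℕ.⊔ M} p)) (≤⊔ʳ {N} (≤⊔ʳ {L ℕ.⊔ M} q)))))
             (*-mono-≤ ℚ.∣ s m ℚ.- s n ∣ η ℚ.∣ t n ∣ B (ℚ.0≤∣p∣ (s m ℚ.- s n)) (ℚ.<⇒≤ 0<B)
               (ℚ.<⇒≤ (f m n (≤⊔ˡ (≤⊔ʳ {L ℕ.⊔ M} p)) (≤⊔ˡ (≤⊔ʳ {L ℕ.⊔ M} q))))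
               (b n (≤⊔ʳ {L} (≤⊔ˡ q)))) ⟩
      A ℚ.* η ℚ.+ η ℚ.* B
        ≡⟨ lem′ A B η ⟩
      (A ℚ.+ B) ℚ.* η ∎
    where
    lem : ∀ a b c d → a ℚ.* b ℚ.- c ℚ.* d ≡ a ℚ.* (b ℚ.- d) ℚ.+ (a ℚ.- c) ℚ.* d
    lem = RingSolver.solve-∀ ℚ-ring
    lem′ : ∀ a b e → a ℚ.* e ℚ.+ e ℚ.* b ≡ (a ℚ.+ b) ℚ.* e
    lem′ = RingSolver.solve-∀ ℚ-ring

infixl 6 _+_ _-_
infixl 7 _*_
infix  8 -_
infixr 9 _^_

fromℚ : ℚ → ℝ
fromℚ q = mkℝ (λ _ → q) λ ε 0<ε → 0 , λ _ _ _ _ →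
  subst (ℚ._< ε) (sym (cong ℚ.∣_∣ (ℚ.+-inverseʳ q))) 0<ε

fromℤ : ℤ → ℝ
fromℤ i = fromℚ (i ℚ./ 1)

0ℝ 1ℝ : ℝ
0ℝ = fromℚ 0ℚ
1ℝ = fromℚ 1ℚ

_+_ : ℝ → ℝ → ℝ
x + y = mkℝ (λ n → seq x n ℚ.+ seq y n) (+-cauchy (seq x) (seq y) (cauchy x) (cauchy y))

-_ : ℝ → ℝ
- x = mkℝ (λ n → ℚ.- seq x n) (neg-cauchy (seq x) (cauchy x))

_-_ : ℝ → ℝ → ℝ
x - y = x + (- y)

_*_ : ℝ → ℝ → ℝ
x * y = mkℝ (λ n → seq x n ℚ.* seq y n) (*-cauchy (seq x) (seq y) (cauchy x) (cauchy y))

∣_∣ : ℝ → ℝ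
∣ x ∣ = mkℝ (λ n → ℚ.∣ seq x n ∣) (∣∣-cauchy (seq x) (cauchy x))

_^_ : ℝ → ℕ → ℝ
x ^ zero  = 1ℝ
x ^ suc n = x ^ n * x

infix 4 _#0

_#0 : ℝ → Set
x #0 = 0ℝ < ∣ x ∣

-- The value 0 at 0 is a dummy: for x #0 only finitely many terms of seq x vanish.
inverseℚ : (q : ℚ) → Dec (q ≡ 0ℚ) → ℚ
inverseℚ q (yes _)  = 0ℚ
inverseℚ q (no q≢0) = ℚ.1/_ q {{ℚ.≢-nonZero q≢0}}

private
  invℚ : ℚ → ℚ
  invℚ q = inverseℚ q (q ℚ.≟ 0ℚ)

  invℚ-inverseʳ : ∀ q → q ≢ 0ℚ → q ℚ.* invℚ q ≡ 1ℚ
  invℚ-inverseʳ q q≢0 with q ℚ.≟ 0ℚ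
  ... | yes q≡0 = contradiction q≡0 q≢0
  ... | no  q≢0 = ℚ.*-inverseʳ q {{ℚ.≢-nonZero q≢0}}

  δ≤∣q∣⇒q≢0 : ∀ δ q → 0ℚ ℚ.< δ → δ ℚ.≤ ℚ.∣ q ∣ → q ≢ 0ℚ
  δ≤∣q∣⇒q≢0 δ q 0<δ δ≤ refl = ℚ.<-irrefl refl (ℚ.<-≤-trans 0<δ δ≤)

  ∣invℚ∣≤ : ∀ δ q (0<δ : 0ℚ ℚ.< δ) → δ ℚ.≤ ℚ.∣ q ∣ →
    ℚ.∣ invℚ q ∣ ℚ.≤ ℚ.1/_ δ {{ℚ.pos⇒nonZero δ {{ℚ.positive 0<δ}}}}
  ∣invℚ∣≤ δ q 0<δ δ≤ = ℚ.*-cancelˡ-≤-pos δ (begin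
      δ ℚ.* ℚ.∣ invℚ q ∣          ≤⟨ ℚ.*-monoʳ-≤-nonNeg ℚ.∣ invℚ q ∣ {{ℚ.∣-∣-nonNeg (invℚ q)}} δ≤ ⟩
      ℚ.∣ q ∣ ℚ.* ℚ.∣ invℚ q ∣    ≡⟨ ℚ.∣p*q∣≡∣p∣*∣q∣ q (invℚ q) ⟨
      ℚ.∣ q ℚ.* invℚ q ∣          ≡⟨ cong ℚ.∣_∣ (invℚ-inverseʳ q (δ≤∣q∣⇒q≢0 δ q 0<δ δ≤)) ⟩
      1ℚ                          ≡⟨ ℚ.*-inverseʳ δ ⟨
      δ ℚ.* ℚ.1/ δ                ∎)
    where
    instance
      δ-pos : ℚ.Positive δ
      δ-pos = ℚ.positive 0<δ
      δ-nz : ℚ.NonZero δ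
      δ-nz = ℚ.pos⇒nonZero δ

  inv-cauchy : ∀ x → x #0 → IsCauchy (λ n → invℚ (seq x n))
  inv-cauchy x (δ , 0<δ , M , h) = cauchy-by (λ n → invℚ (seq x n)) (D ℚ.* D) (ℚ.positive⁻¹ (D ℚ.* D)) λ η 0<η →
    let (N , f) = cauchy x η 0<η in
    M ℕ.⊔ N , λ m n p q →
    let a = seq x m ; b = seq x n
        ha = δ≤ m (≤⊔ˡ p) ; hb = δ≤ n (≤⊔ˡ q) in begin
      ℚ.∣ invℚ a ℚ.- invℚ b ∣
        ≡⟨ cong ℚ.∣_∣ (lem a b (δ≤∣q∣⇒q≢0 δ a 0<δ ha) (δ≤∣q∣⇒q≢0 δ b 0<δ hb)) ⟩
      ℚ.∣ invℚ a ℚ.* invℚ b ℚ.* (b ℚ.- a) ∣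
        ≡⟨ ℚ.∣p*q∣≡∣p∣*∣q∣ (invℚ a ℚ.* invℚ b) (b ℚ.- a) ⟩
      ℚ.∣ invℚ a ℚ.* invℚ b ∣ ℚ.* ℚ.∣ b ℚ.- a ∣
        ≡⟨ cong (ℚ._* ℚ.∣ b ℚ.- a ∣) (ℚ.∣p*q∣≡∣p∣*∣q∣ (invℚ a) (invℚ b)) ⟩
      ℚ.∣ invℚ a ∣ ℚ.* ℚ.∣ invℚ b ∣ ℚ.* ℚ.∣ b ℚ.- a ∣
        ≤⟨ *-mono-≤ (ℚ.∣ invℚ a ∣ ℚ.* ℚ.∣ invℚ b ∣) (D ℚ.* D) ℚ.∣ b ℚ.- a ∣ η
             (ℚ.nonNegative⁻¹ (ℚ.∣ invℚ a ∣ ℚ.* ℚ.∣ invℚ b ∣) {{ℚ.nonNeg*nonNeg⇒nonNeg ℚ.∣ invℚ a ∣ {{ℚ.∣-∣-nonNeg (invℚ a)}} ℚ.∣ invℚ b ∣ {{ℚ.∣-∣-nonNeg (invℚ b)}}}})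
             (ℚ.<⇒≤ 0<η)
             (*-mono-≤ ℚ.∣ invℚ a ∣ D ℚ.∣ invℚ b ∣ D (ℚ.0≤∣p∣ (invℚ a)) (ℚ.<⇒≤ (ℚ.positive⁻¹ D)) (∣invℚ∣≤ δ a 0<δ ha) (∣invℚ∣≤ δ b 0<δ hb))
             (ℚ.<⇒≤ (f n m (≤⊔ʳ {M} q) (≤⊔ʳ {M} p))) ⟩
      D ℚ.* D ℚ.* η ∎
    where
    instance
      δ-pos : ℚ.Positive δ
      δ-pos = ℚ.positive 0<δ
      δ-nz : ℚ.NonZero δ
      δ-nz = ℚ.pos⇒nonZero δ
    D = ℚ.1/ δ
    instance
      D-pos : ℚ.Positive D
      D-pos = ℚ.1/pos⇒pos δ
      D²-pos : ℚ.Positive (D ℚ.* D)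
      D²-pos = ℚ.pos*pos⇒pos D D
    δ≤ : ∀ n → M ℕ.≤ n → δ ℚ.≤ ℚ.∣ seq x n ∣
    δ≤ n M≤n = subst (ℚ._≤ ℚ.∣ seq x n ∣) (ℚ.+-identityˡ δ) (h n M≤n)
    distr : ∀ a b c d → c ℚ.* d ℚ.* (b ℚ.- a) ≡ c ℚ.* (b ℚ.* d) ℚ.- a ℚ.* c ℚ.* d
    distr = RingSolver.solve-∀ ℚ-ring
    lem : ∀ a b → a ≢ 0ℚ → b ≢ 0ℚ → invℚ a ℚ.- invℚ b ≡ invℚ a ℚ.* invℚ b ℚ.* (b ℚ.- a)
    lem a b a≢0 b≢0 = sym (begin-equality
      invℚ a ℚ.* invℚ b ℚ.* (b ℚ.- a)                             ≡⟨ distr a b (invℚ a) (invℚ b) ⟩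
      invℚ a ℚ.* (b ℚ.* invℚ b) ℚ.- a ℚ.* invℚ a ℚ.* invℚ b       ≡⟨ cong₂ (λ u v → invℚ a ℚ.* u ℚ.- v ℚ.* invℚ b)
                                                                       (invℚ-inverseʳ b b≢0) (invℚ-inverseʳ a a≢0) ⟩
      invℚ a ℚ.* 1ℚ ℚ.- 1ℚ ℚ.* invℚ b                             ≡⟨ cong₂ ℚ._-_ (ℚ.*-identityʳ (invℚ a)) (ℚ.*-identityˡ (invℚ b)) ⟩
      invℚ a ℚ.- invℚ b                                           ∎)

infix 8 _⁻¹⟨_⟩

_⁻¹⟨_⟩ : (x : ℝ) → x #0 → ℝ
x ⁻¹⟨ x#0 ⟩ = mkℝ (λ n → inverseℚ (seq x n) (seq x n ℚ.≟ 0ℚ)) (inv-cauchy x x#0)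

-- ∑ n f = f 0 + ⋯ + f (n - 1), and likewise for ∏.
∑ : ℕ → (ℕ → ℝ) → ℝ
∑ zero    f = 0ℝ
∑ (suc n) f = ∑ n f + f n

∏ : ℕ → (ℕ → ℝ) → ℝ
∏ zero    f = 1ℝ
∏ (suc n) f = ∏ n f * f n

infix 4 _⟶_ _∼_ _≈_±_

_⟶_ : (ℕ → ℝ) → ℝ → Set
a ⟶ l = ∀ ε → 0ℚ ℚ.< ε → ∃[ N ] (∀ n → N ℕ.≤ n → ∣ a n - l ∣ < fromℚ ε)

-- b n / a n ⟶ 1; the quotient need only make sense for all large n.
_∼_ : (ℕ → ℝ) → (ℕ → ℝ) → Set
a ∼ b = ∃[ N ] Σ[ a#0 ∈ (∀ k → a (N ℕ.+ k) #0) ]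
  ((λ k → b (N ℕ.+ k) * a (N ℕ.+ k) ⁻¹⟨ a#0 k ⟩) ⟶ 1ℝ)

_≈_±_ : ℝ → ℚ → ℚ → Set
x ≈ q ± ε = ∣ x - fromℚ q ∣ < fromℚ ε

-- The argument r is the integer square root of n - 1.
⌊√⌋-next : ℕ → ℕ → ℕ
⌊√⌋-next n r with suc r ℕ.* suc r ℕ.≤? n
... | yes _ = suc r
... | no  _ = r

⌊√_⌋ : ℕ → ℕ
⌊√ zero ⌋  = 0
⌊√ suc n ⌋ = ⌊√⌋-next (suc n) ⌊√ n ⌋

⌊√⌋-lower : ∀ n → ⌊√ n ⌋ ℕ.* ⌊√ n ⌋ ℕ.≤ n
⌊√⌋-lower zero    = ℕ.z≤n
⌊√⌋-lower (suc n) with suc ⌊√ n ⌋ ℕ.* suc ⌊√ n ⌋ ℕ.≤? suc n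
... | yes p = p
... | no  _ = ℕ.m≤n⇒m≤1+n (⌊√⌋-lower n)

⌊√⌋-upper : ∀ n → n ℕ.< suc ⌊√ n ⌋ ℕ.* suc ⌊√ n ⌋
⌊√⌋-upper zero    = ℕ.s≤s ℕ.z≤n
⌊√⌋-upper (suc n) with suc ⌊√ n ⌋ ℕ.* suc ⌊√ n ⌋ ℕ.≤? suc n
... | yes _ = ℕ.≤-<-trans (⌊√⌋-upper n)
  (ℕ.*-mono-< {suc ⌊√ n ⌋} {suc (suc ⌊√ n ⌋)} {suc ⌊√ n ⌋} (ℕ.n<1+n _) (ℕ.n<1+n _))
... | no ¬p = ℕ.≰⇒> ¬p

-- √ m is the limit of ⌊p √m⌋ / p over p = 1, 2, 3, …
√-num : ℕ → ℕ → ℕ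
√-num m n = ⌊√ m ℕ.* (suc n ℕ.* suc n) ⌋

√-seq : ℕ → ℕ → ℚ
√-seq m n = + √-num m n ℚ./ suc n

private
  /-mono : ∀ a p b q → a ℕ.* suc q ℕ.≤ b ℕ.* suc p → + a ℚ./ suc p ℚ.≤ + b ℚ./ suc q
  /-mono a p b q h = ℚ.toℚᵘ-cancel-≤
    (ℚᵘ.≤-respˡ-≃ (ℚᵘ.≃-sym (ℚ.toℚᵘ-fromℚᵘ (mkℚᵘ (+ a) p)))
    (ℚᵘ.≤-respʳ-≃ (ℚᵘ.≃-sym (ℚ.toℚᵘ-fromℚᵘ (mkℚᵘ (+ b) q)))
    (*≤* (subst₂ ℤ._≤_ (ℤ.pos-* a (suc q)) (ℤ.pos-* b (suc p)) (ℤ.+≤+ h)))))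

  suc-/ : ∀ b q → + suc b ℚ./ suc q ≡ + b ℚ./ suc q ℚ.+ + 1 ℚ./ suc q
  suc-/ b q = ℚ.toℚᵘ-injective (ℚᵘ.≃-trans (ℚ.toℚᵘ-fromℚᵘ (mkℚᵘ (+ suc b) q))
    (ℚᵘ.≃-trans (ℚᵘ.*≡* lem) (ℚᵘ.≃-sym
    (ℚᵘ.≃-trans (ℚ.toℚᵘ-homo-+ (+ b ℚ./ suc q) (+ 1 ℚ./ suc q))
      (ℚᵘ.+-cong (ℚ.toℚᵘ-fromℚᵘ (mkℚᵘ (+ b) q)) (ℚ.toℚᵘ-fromℚᵘ (mkℚᵘ (+ 1) q)))))))
    where
    ℕ-lem : ∀ b q → suc b ℕ.* (suc q ℕ.* suc q) ≡ (b ℕ.* suc q ℕ.+ 1 ℕ.* suc q) ℕ.* suc q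
    ℕ-lem = solve-∀
    lem : + suc b ℤ.* (+ (suc q ℕ.* suc q)) ≡ (+ b ℤ.* + suc q ℤ.+ + 1 ℤ.* + suc q) ℤ.* + suc q
    lem = trans (sym (ℤ.pos-* (suc b) (suc q ℕ.* suc q)))
      (trans (cong +_ (ℕ-lem b q))
      (trans (ℤ.pos-* (b ℕ.* suc q ℕ.+ 1 ℕ.* suc q) (suc q))
      (cong (ℤ._* + suc q) (trans (ℤ.pos-+ (b ℕ.* suc q) (1 ℕ.* suc q))
        (cong₂ ℤ._+_ (ℤ.pos-* b (suc q)) (ℤ.pos-* 1 (suc q)))))))

  sq-cancel-< : ∀ a b → a ℕ.* a ℕ.< b ℕ.* b → a ℕ.< b
  sq-cancel-< a b h = ℕ.≰⇒> λ b≤a → ℕ.<⇒≱ h (ℕ.*-mono-≤ b≤a b≤a)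

  √-cross : ∀ m i j → √-num m i ℕ.* suc j ℕ.< suc (√-num m j) ℕ.* suc i
  √-cross m i j = sq-cancel-< _ _ (ℕ.≤-<-trans
    (subst₂ ℕ._≤_ (e₁ a (suc j)) (e₂ m (suc i) (suc j))
      (ℕ.*-monoˡ-≤ (suc j ℕ.* suc j) (⌊√⌋-lower (m ℕ.* (suc i ℕ.* suc i)))))
    (subst (m ℕ.* (suc j ℕ.* suc j) ℕ.* (suc i ℕ.* suc i) ℕ.<_) (e₁ (suc b) (suc i))
      (ℕ.*-monoˡ-< (suc i ℕ.* suc i) (⌊√⌋-upper (m ℕ.* (suc j ℕ.* suc j))))))
    where
    a = √-num m i
    b = √-num m j
    e₁ : ∀ x y → (x ℕ.* x) ℕ.* (y ℕ.* y) ≡ (x ℕ.* y) ℕ.* (x ℕ.* y)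
    e₁ = solve-∀
    e₂ : ∀ x y z → x ℕ.* (y ℕ.* y) ℕ.* (z ℕ.* z) ≡ x ℕ.* (z ℕ.* z) ℕ.* (y ℕ.* y)
    e₂ = solve-∀

  √-step : ∀ m i j → √-seq m i ℚ.- √-seq m j ℚ.≤ + 1 ℚ./ suc j
  √-step m i j = a≤b+c⇒a-b≤c (√-seq m i) (√-seq m j) (+ 1 ℚ./ suc j)
    (subst (√-seq m i ℚ.≤_) (suc-/ (√-num m j) j)
      (/-mono (√-num m i) i (suc (√-num m j)) j (ℕ.<⇒≤ (√-cross m i j))))

  1/-anti : ∀ {N n} → N ℕ.≤ n → + 1 ℚ./ suc n ℚ.≤ + 1 ℚ./ suc N
  1/-anti {N} {n} N≤n = /-mono 1 n 1 N (ℕ.*-monoʳ-≤ 1 (ℕ.s≤s N≤n))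

  archimedean : ∀ ε → 0ℚ ℚ.< ε → ∃[ N ] (+ 1 ℚ./ suc N ℚ.< ε)
  archimedean ε@(ℚ.mkℚ (ℤ.+[1+ k ]) d c) 0<ε = suc d , ℚ.<-≤-trans
    (ℚ.toℚᵘ-cancel-< (ℚᵘ.<-respˡ-≃ (ℚᵘ.≃-sym (ℚ.toℚᵘ-fromℚᵘ (mkℚᵘ (+ 1) (suc d))))
      (ℚᵘ.<-respʳ-≃ (ℚᵘ.≃-sym (ℚ.toℚᵘ-fromℚᵘ (mkℚᵘ (+ 1) d)))
      (ℚᵘ.*<* (ℤ.+<+ (ℕ.*-monoʳ-< 1 (ℕ.n<1+n (suc d))))))))
    (subst (+ 1 ℚ./ suc d ℚ.≤_) (ℚ.↥p/↧p≡p ε) (/-mono 1 d (suc k) d (ℕ.*-monoˡ-≤ (suc d) {1} {suc k} (ℕ.s≤s ℕ.z≤n))))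
  archimedean (ℚ.mkℚ (ℤ.+ 0) d c) (ℚ.*<* (ℤ.+<+ ()))
  archimedean (ℚ.mkℚ (ℤ.-[1+ k ]) d c) (ℚ.*<* ())

  √-cauchy : ∀ m → IsCauchy (√-seq m)
  √-cauchy m ε 0<ε = let (N , h) = archimedean ε 0<ε in
    N , λ i j p q → ℚ.≤-<-trans
      (∣∣≤ (√-seq m i ℚ.- √-seq m j) (+ 1 ℚ./ suc N) (ℚ.≤-trans (√-step m i j) (1/-anti q))
           (subst (ℚ._≤ + 1 ℚ./ suc N) (lem (√-seq m j) (√-seq m i)) (ℚ.≤-trans (√-step m j i) (1/-anti p))))
      h
    where
    lem : ∀ a b → a ℚ.- b ≡ ℚ.- (b ℚ.- a)
    lem = RingSolver.solve-∀ ℚ-ring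

√_ : ℕ → ℝ
√ m = mkℝ (√-seq m) (√-cauchy m)

√5 φ : ℝ
√5 = √ 5
φ  = fromℚ ½ * (1ℝ + √5)

private
  1≤√5-seq : ∀ n → 1ℚ ℚ.≤ √-seq 5 n
  1≤√5-seq n = /-mono 1 0 (√-num 5 n) n
    (subst₂ ℕ._≤_ (sym (ℕ.*-identityˡ (suc n))) (sym (ℕ.*-identityʳ (√-num 5 n)))
    (ℕ.s≤s⁻¹ (sq-cancel-< (suc n) (suc (√-num 5 n))
      (ℕ.≤-<-trans (ℕ.m≤m+n _ _) (⌊√⌋-upper (5 ℕ.* (suc n ℕ.* suc n)))))))

√5#0 : √5 #0
√5#0 = 1ℚ , ℚ.positive⁻¹ 1ℚ , 0 , λ n _ → ℚ.≤-trans (1≤√5-seq n) (p≤∣p∣ (√-seq 5 n))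

φ#0 : φ #0
φ#0 = 1ℚ , ℚ.positive⁻¹ 1ℚ , 0 , λ n _ → ℚ.≤-trans
  (ℚ.*-monoˡ-≤-nonNeg ½ {1ℚ ℚ.+ 1ℚ} {1ℚ ℚ.+ √-seq 5 n} (ℚ.+-monoʳ-≤ 1ℚ (1≤√5-seq n))) (p≤∣p∣ (½ ℚ.* (1ℚ ℚ.+ √-seq 5 n)))

φ⁻¹ √5⁻¹ b : ℝ
φ⁻¹  = φ ⁻¹⟨ φ#0 ⟩
√5⁻¹ = √5 ⁻¹⟨ √5#0 ⟩
b    = - φ⁻¹ ^ 2

-- F 0 = 0 extends F 1 = F 2 = 1 consistently with the recurrence.
F : ℕ → ℕ
F 0             = 0
F 1             = 1
F (suc (suc n)) = F (suc n) ℕ.+ F n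

F-pos : ∀ n → 0 ℕ.< F (suc n)
F-pos zero    = ℕ.s≤s ℕ.z≤n
F-pos (suc n) = ℕ.≤-trans (F-pos n) (ℕ.m≤m+n _ _)

F-nonZero : ∀ n → NonZero (F (suc n))
F-nonZero n = ℕ.>-nonZero (F-pos n)

μ : (n : ℕ) → .{{NonZero n}} → ℤ
μ n with unique? ℕ._≟_ (factors (factorise n))
... | yes _ = -1ℤ ℤ.^ length (factors (factorise n))
... | no  _ = 0ℤ

Matrix : ℕ → Set
Matrix n = Fin n → Fin n → ℤ

-- Laplace expansion along the first row.
det : ∀ {n} → Matrix n → ℤ
det {zero}  A = 1ℤ
det {suc n} A = sum ℤ.+-0-commutativeMonoid λ j →
  -1ℤ ℤ.^ toℕ j ℤ.* A zero j ℤ.* det (λ i k → A (suc i) (punchIn j k))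

fibRedheffer : ℕ → ℕ → ℤ
fibRedheffer i 1 = 1ℤ
fibRedheffer i j with i ∣? j
... | yes _ = + F i
... | no  _ = 0ℤ

-- Rows and columns are numbered from 1.
FR : ∀ n → Matrix n
FR n i j = fibRedheffer (suc (toℕ i)) (suc (toℕ j))

{-# OPTIONS --safe #-}
module Submission where

-- Write P = F₁ ⋯ Fₙ and S = ∑_{k ≤ n} μ(k) / Fₖ. Since ∑_{d ∣ j} μ(d) = 0 for j > 1, the combination
-- ∑ᵢ (μ(i) / Fᵢ) ⋅ rowᵢ of the rows of the matrix is (S, 0, …, 0), and the rest of the matrix is
-- triangular, so the determinant is P S. Binet's formula Fₖ = φᵏ (1 - bᵏ) / √5 gives
-- P = φ^(n(n+1)/2) 5^(-n/2) ∏_{k ≤ n} (1 - bᵏ), so the ratio in question is C C_φ divided by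
-- S ∏_{k ≤ n} (1 - bᵏ). The sum and the product converge geometrically; evaluating them at n = 50 and
-- n = 26 in fixed-point arithmetic bounds C and C_φ closely enough for the printed decimals.

open import Defs
open import Algebra.Bundles using (CommutativeRing)
import Algebra.Properties.Group
import Algebra.Properties.Semiring.Sum
import Algebra.Solver.CommutativeMonoid
open import Data.Fin.Base as Fin using (Fin; zero; suc; toℕ; punchIn; fromℕ<)
import Data.Fin.Properties as Fin
open import Data.Integer.Base as ℤ using (ℤ; +_; 0ℤ; 1ℤ; -1ℤ; _/ℕ_; _%ℕ_)
import Data.Integer.DivMod as ℤ
import Data.Integer.Properties as ℤ
open import Data.Integer.Tactic.RingSolver using () renaming (solve-∀ to ℤ-solve)
open import Data.List.Base using (List; []; _∷_; length)
open import Data.List.Membership.Propositional using (_∈_)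
open import Data.List.Relation.Binary.Permutation.Propositional using (_↭_; ↭-sym; ↭⇒↭ₛ)
open import Data.List.Relation.Binary.Permutation.Propositional.Properties using (↭-length)
open import Data.List.Relation.Binary.Permutation.Setoid.Properties using (Unique-resp-↭)
open import Data.List.Relation.Unary.All as All using (All; _∷_)
open import Data.List.Relation.Unary.All.Properties using (¬Any⇒All¬)
open import Data.List.Relation.Unary.AllPairs as AllPairs using (_∷_)
open import Data.Nat.Base as ℕ using (ℕ; zero; suc; NonZero)
open import Data.Nat.Coprimality using (Coprime; coprime-divisor)
import Data.Nat.DivMod as ℕ
open import Data.Nat.Divisibility using (_∣_; _∣?_; divides; ∣-refl; ∣⇒≤; m∣m*n; n∣m*n; ∣m⇒∣m*n; ∣n⇒∣m*n; *-monoʳ-∣; *-cancelˡ-∣)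
open import Data.Nat.ListAction using (product)
open import Data.Nat.ListAction.Properties using (∈⇒∣product)
open import Data.Nat.Primality using (Prime; prime⇒nonZero; prime⇒irreducible)
open import Data.Nat.Primality.Factorisation using (PrimeFactorisation; factors; factorise; factorisationUnique; factorisationHasAllPrimeFactors)
import Data.Nat.Properties as ℕ
open import Data.Nat.Tactic.RingSolver using () renaming (solve-∀ to ℕ-solve)
open import Data.Product.Base using (∃-syntax; _×_; _,_; proj₁; proj₂)
open import Data.Rational.Base as ℚ using (ℚ; 0ℚ; 1ℚ; ½)
import Data.Rational.Properties as ℚ
open import Data.Rational.Unnormalised.Base as ℚᵘ using (mkℚᵘ)
import Data.Rational.Unnormalised.Properties as ℚᵘ
open import Data.Sum.Base using (inj₁; inj₂)
open import Level using (0ℓ)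
open import Relation.Binary.Bundles using (Setoid)
open import Relation.Binary.PropositionalEquality using (_≡_; _≢_; refl; sym; trans; cong; cong₂; subst; subst₂; setoid; module ≡-Reasoning)
import Relation.Binary.Reasoning.Setoid as ≈-Reasoning
open import Relation.Nullary using (Dec; yes; no; ¬_; ¬?; contradiction)
open import Relation.Nullary.Decidable using (from-yes; dec⇒maybe)
import Tactic.RingSolver as RingSolver
open import Tactic.RingSolver.Core.AlmostCommutativeRing using (AlmostCommutativeRing; fromCommutativeRing)

open import Data.List.Relation.Unary.Unique.DecPropositional ℕ._≟_ using (Unique; unique?)

open PrimeFactorisation using (isFactorisation; factorsPrime)

-- The numerical bounds serve more than the decimals. The quotient in `_∼_` needs determinants apart
-- from 0, and that C does not vanish is known only because `S n` stays within `nano` of `ŝ` for n ≥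
-- 50; hence the quotient starts at 50. A real is a Cauchy sequence of rationals, and b is
-- accessible only through rational approximations β. The product is therefore studied as a
-- polynomial `Q n β`, with estimates uniform over all β of absolute value at most 2/5, and C_φ is
-- represented by the diagonal sequence `Q n (seq b n)`. An identity such as Binet's formula holds
-- for b but not for its approximations, and becomes the statement that a difference of sequences is
-- null. The determinant, in contrast, is treated over ℤ: the rows are combined with the integers P
-- μ(i) / Fᵢ, and the extra factor P is cancelled at the end. Since `det` is defined by expansion
-- along the first row, the combined row is put into that row, which requires only the exchange of
-- the first two rows.

module Σℤ = Algebra.Properties.Semiring.Sum ℤ.+-*-semiring
open Σℤ using (sum)

-- Determinants

sum-zero : ∀ {n} (t : Fin n → ℤ) → (∀ i → t i ≡ 0ℤ) → sum t ≡ 0ℤ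
sum-zero {n} t h = trans (Σℤ.sum-cong-≗ h) (Σℤ.sum-replicate-zero n)

sum-neg : ∀ {m} (t : Fin m → ℤ) → sum (λ i → ℤ.- t i) ≡ ℤ.- sum t
sum-neg {zero}  t = refl
sum-neg {suc m} t = trans (cong (λ z → ℤ.- t zero ℤ.+ z) (sum-neg λ i → t (suc i))) (sym (ℤ.neg-distrib-+ (t zero) _))

sgn : ∀ {n} → Fin n → ℤ
sgn j = -1ℤ ℤ.^ toℕ j

det-cong : ∀ {n} {A B : Matrix n} → (∀ i j → A i j ≡ B i j) → det A ≡ det B
det-cong {zero}  h = refl
det-cong {suc n} h = Σℤ.sum-cong-≗ λ j →
  cong₂ ℤ._*_ (cong (sgn j ℤ.*_) (h zero j)) (det-cong λ i k → h (suc i) (punchIn j k))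

-- The pairs (j , k) and (punchIn j k , punchIn⁻ j k) delete the same two columns in opposite order.
punchIn⁻ : ∀ {n} → Fin (suc n) → Fin n → Fin n
punchIn⁻ zero    zero    = zero
punchIn⁻ zero    (suc _) = zero
punchIn⁻ (suc j) zero    = j
punchIn⁻ (suc j) (suc k) = suc (punchIn⁻ j k)

punchIn-punchIn⁻ : ∀ {n} (j : Fin (suc n)) (k : Fin n) → punchIn (punchIn j k) (punchIn⁻ j k) ≡ j
punchIn-punchIn⁻ zero    zero    = refl
punchIn-punchIn⁻ zero    (suc k) = refl
punchIn-punchIn⁻ (suc j) zero    = refl
punchIn-punchIn⁻ (suc j) (suc k) = cong suc (punchIn-punchIn⁻ j k)

punchIn-comm : ∀ {n} (j : Fin (suc (suc n))) (k : Fin (suc n)) c →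
  punchIn j (punchIn k c) ≡ punchIn (punchIn j k) (punchIn (punchIn⁻ j k) c)
punchIn-comm zero    zero    c       = refl
punchIn-comm zero    (suc k) c       = refl
punchIn-comm (suc j) zero    c       = refl
punchIn-comm (suc j) (suc k) zero    = refl
punchIn-comm (suc j) (suc k) (suc c) = cong suc (punchIn-comm j k c)

-- Deleting the left one of two columns first lowers the index of the right one by one, while
-- deleting the right one first changes nothing, so the two orders have index sums of opposite
-- parity.
sgn-punchIn : ∀ {n} (j : Fin (suc n)) (k : Fin n) →
  sgn j ℤ.* sgn k ≡ ℤ.- (sgn (punchIn j k) ℤ.* sgn (punchIn⁻ j k))
sgn-punchIn zero zero = refl
sgn-punchIn zero (suc k) = lem (sgn (suc k))
  where
  lem : ∀ x → 1ℤ ℤ.* x ≡ ℤ.- (-1ℤ ℤ.* x ℤ.* 1ℤ)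
  lem = ℤ-solve
sgn-punchIn (suc j) zero = lem (sgn j)
  where
  lem : ∀ x → -1ℤ ℤ.* x ℤ.* 1ℤ ≡ ℤ.- (1ℤ ℤ.* x)
  lem = ℤ-solve
sgn-punchIn (suc j) (suc k) = begin
  -1ℤ ℤ.* sgn j ℤ.* (-1ℤ ℤ.* sgn k)              ≡⟨ lem (sgn j) (sgn k) ⟩
  sgn j ℤ.* sgn k                                ≡⟨ sgn-punchIn j k ⟩
  ℤ.- (sgn j′ ℤ.* sgn k′)                        ≡⟨ cong ℤ.-_ (lem (sgn j′) (sgn k′)) ⟨
  ℤ.- (-1ℤ ℤ.* sgn j′ ℤ.* (-1ℤ ℤ.* sgn k′))      ∎
  where
  open ≡-Reasoning
  j′ = punchIn j k
  k′ = punchIn⁻ j k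
  lem : ∀ x y → -1ℤ ℤ.* x ℤ.* (-1ℤ ℤ.* y) ≡ x ℤ.* y
  lem = ℤ-solve

-- The involution (j , k) ↦ (`punchIn j k` , `punchIn⁻ j k`) exchanges the pairs with j = 0 and
-- those with k = 0, j > 0, and acts on the remaining pairs as the involution one size smaller.
-- Induction along this decomposition avoids reindexing a double sum.
sum-punchIn-antisym : ∀ {n} (g h : Fin (suc n) → Fin n → ℤ) →
  (∀ j k → g j k ≡ ℤ.- h (punchIn j k) (punchIn⁻ j k)) →
  sum (λ j → sum (g j)) ≡ ℤ.- sum (λ j → sum (h j))
sum-punchIn-antisym {zero}  g h anti = refl
sum-punchIn-antisym {suc n} g h anti = begin
  sum (g zero) ℤ.+ sum (λ j → g (suc j) zero ℤ.+ sum (λ k → g (suc j) (suc k)))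
    ≡⟨ cong (λ z → sum (g zero) ℤ.+ z) (Σℤ.∑-distrib-+ (λ j → g (suc j) zero) λ j → sum λ k → g (suc j) (suc k)) ⟩
  sum (g zero) ℤ.+ (sum (λ j → g (suc j) zero) ℤ.+ sum (λ j → sum (λ k → g (suc j) (suc k))))
    ≡⟨ cong₂ ℤ._+_ (trans (Σℤ.sum-cong-≗ g₀) (sum-neg (λ k → h (suc k) zero)))
        (cong₂ ℤ._+_ (trans (Σℤ.sum-cong-≗ λ j → anti (suc j) zero) (sum-neg (h zero)))
          (sum-punchIn-antisym (λ j k → g (suc j) (suc k)) (λ j k → h (suc j) (suc k)) λ j k → anti (suc j) (suc k))) ⟩
  ℤ.- H₁ ℤ.+ (ℤ.- H₀ ℤ.+ ℤ.- H₂)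
    ≡⟨ lem H₀ H₁ H₂ ⟩
  ℤ.- (H₀ ℤ.+ (H₁ ℤ.+ H₂))
    ≡⟨ cong (λ z → ℤ.- (H₀ ℤ.+ z)) (Σℤ.∑-distrib-+ (λ j → h (suc j) zero) λ j → sum λ k → h (suc j) (suc k)) ⟨
  ℤ.- (H₀ ℤ.+ sum (λ j → h (suc j) zero ℤ.+ sum (λ k → h (suc j) (suc k)))) ∎
  where
  open ≡-Reasoning
  H₀ = sum (h zero)
  H₁ = sum (λ j → h (suc j) zero)
  H₂ = sum (λ j → sum (λ k → h (suc j) (suc k)))
  lem : ∀ x y z → ℤ.- y ℤ.+ (ℤ.- x ℤ.+ ℤ.- z) ≡ ℤ.- (x ℤ.+ (y ℤ.+ z))
  lem = ℤ-solve
  g₀ : ∀ k → g zero k ≡ ℤ.- h (suc k) zero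
  g₀ zero    = anti zero zero
  g₀ (suc k) = anti zero (suc k)

swap₀₁ : ∀ {n} → Matrix (suc (suc n)) → Matrix (suc (suc n))
swap₀₁ A zero          = A (suc zero)
swap₀₁ A (suc zero)    = A zero
swap₀₁ A (suc (suc i)) = A (suc (suc i))

laplace₂ : ∀ {n} → Matrix (suc (suc n)) → Fin (suc (suc n)) → Fin (suc n) → ℤ
laplace₂ A j k = sgn j ℤ.* A zero j ℤ.*
  (sgn k ℤ.* A (suc zero) (punchIn j k) ℤ.* det λ i c → A (suc (suc i)) (punchIn j (punchIn k c)))

det≡∑laplace₂ : ∀ {n} (A : Matrix (suc (suc n))) → det A ≡ sum λ j → sum λ k → laplace₂ A j k
det≡∑laplace₂ A = Σℤ.sum-cong-≗ λ j → Σℤ.*-distribˡ-sum (sgn j ℤ.* A zero j) λ k →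
  sgn k ℤ.* A (suc zero) (punchIn j k) ℤ.* det λ i c → A (suc (suc i)) (punchIn j (punchIn k c))

-- Expansion along two rows is a sum over ordered pairs of columns. Deleting a pair in the opposite
-- order leaves the same minor, so exchanging the rows only reverses the sign of each pair.
det-swap₀₁ : ∀ {n} (A : Matrix (suc (suc n))) → det A ≡ ℤ.- det (swap₀₁ A)
det-swap₀₁ A = trans (det≡∑laplace₂ A) (trans
  (sum-punchIn-antisym (laplace₂ A) (laplace₂ (swap₀₁ A)) anti)
  (cong ℤ.-_ (sym (det≡∑laplace₂ (swap₀₁ A)))))
  where
  open ≡-Reasoning
  lem : ∀ s t x y d → s ℤ.* x ℤ.* (t ℤ.* y ℤ.* d) ≡ s ℤ.* t ℤ.* (x ℤ.* y ℤ.* d)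
  lem = ℤ-solve
  lem′ : ∀ s t x y d → ℤ.- (s ℤ.* t) ℤ.* (x ℤ.* y ℤ.* d) ≡ ℤ.- (s ℤ.* y ℤ.* (t ℤ.* x ℤ.* d))
  lem′ = ℤ-solve
  anti : ∀ j k → laplace₂ A j k ≡ ℤ.- laplace₂ (swap₀₁ A) (punchIn j k) (punchIn⁻ j k)
  anti j k = begin
    sgn j ℤ.* A zero j ℤ.* (sgn k ℤ.* A (suc zero) j′ ℤ.* D)
      ≡⟨ lem (sgn j) (sgn k) (A zero j) (A (suc zero) j′) D ⟩
    sgn j ℤ.* sgn k ℤ.* (A zero j ℤ.* A (suc zero) j′ ℤ.* D)
      ≡⟨ cong₂ ℤ._*_ (sgn-punchIn j k)
           (cong₂ (λ l d → A zero l ℤ.* A (suc zero) j′ ℤ.* d) (sym (punchIn-punchIn⁻ j k))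
             (det-cong λ i c → cong (A (suc (suc i))) (punchIn-comm j k c))) ⟩
    ℤ.- (sgn j′ ℤ.* sgn k′) ℤ.* (A zero (punchIn j′ k′) ℤ.* A (suc zero) j′ ℤ.* D′)
      ≡⟨ lem′ (sgn j′) (sgn k′) (A zero (punchIn j′ k′)) (A (suc zero) j′) D′ ⟩
    ℤ.- (sgn j′ ℤ.* A (suc zero) j′ ℤ.* (sgn k′ ℤ.* A zero (punchIn j′ k′) ℤ.* D′)) ∎
    where
    j′ = punchIn j k
    k′ = punchIn⁻ j k
    D  = det λ i c → A (suc (suc i)) (punchIn j (punchIn k c))
    D′ = det λ i c → A (suc (suc i)) (punchIn j′ (punchIn k′ c))

i≡-i⇒i≡0 : ∀ i → i ≡ ℤ.- i → i ≡ 0ℤ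
i≡-i⇒i≡0 (+ zero) _ = refl

-- If the copy is row 1, exchanging both rows changes nothing but the sign. Otherwise the exchange
-- puts row 0 on top of every minor of the expansion, with its copy one place closer, and induction
-- applies to the minors.
det-repeated-row : ∀ {n} (A : Matrix (suc n)) p → (∀ j → A zero j ≡ A (suc p) j) → det A ≡ 0ℤ
det-repeated-row {suc n} A zero h = i≡-i⇒i≡0 (det A) (trans (det-swap₀₁ A) (cong ℤ.-_ (det-cong eq)))
  where
  eq : ∀ i j → swap₀₁ A i j ≡ A i j
  eq zero          j = sym (h j)
  eq (suc zero)    j = h j
  eq (suc (suc i)) j = refl
det-repeated-row {suc n} A (suc p) h = trans (det-swap₀₁ A) (cong ℤ.-_ (sum-zero _ λ j →
  trans (cong (sgn j ℤ.* A (suc zero) j ℤ.*_)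
    (det-repeated-row (λ i k → swap₀₁ A (suc i) (punchIn j k)) p λ k → h (punchIn j k)))
  (ℤ.*-zeroʳ (sgn j ℤ.* A (suc zero) j))))

_[0]≔_ : ∀ {n} → Matrix (suc n) → (Fin (suc n) → ℤ) → Matrix (suc n)
(A [0]≔ v) zero    = v
(A [0]≔ v) (suc i) = A (suc i)

det-row₀-linear : ∀ {m n} (A : Matrix (suc n)) (x : Fin m → ℤ) (v : Fin m → Fin (suc n) → ℤ) →
  det (A [0]≔ λ j → sum λ i → x i ℤ.* v i j) ≡ sum λ i → x i ℤ.* det (A [0]≔ v i)
det-row₀-linear A x v = begin
  sum (λ j → sgn j ℤ.* sum (λ i → x i ℤ.* v i j) ℤ.* D j)
    ≡⟨ Σℤ.sum-cong-≗ (λ j → cong (ℤ._* D j) (Σℤ.*-distribˡ-sum (sgn j) λ i → x i ℤ.* v i j)) ⟩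
  sum (λ j → sum (λ i → sgn j ℤ.* (x i ℤ.* v i j)) ℤ.* D j)
    ≡⟨ Σℤ.sum-cong-≗ (λ j → Σℤ.*-distribʳ-sum (D j) λ i → sgn j ℤ.* (x i ℤ.* v i j)) ⟩
  sum (λ j → sum (λ i → sgn j ℤ.* (x i ℤ.* v i j) ℤ.* D j))
    ≡⟨ Σℤ.∑-comm (λ j i → sgn j ℤ.* (x i ℤ.* v i j) ℤ.* D j) ⟩
  sum (λ i → sum (λ j → sgn j ℤ.* (x i ℤ.* v i j) ℤ.* D j))
    ≡⟨ Σℤ.sum-cong-≗ (λ i → Σℤ.sum-cong-≗ λ j → lem (sgn j) (x i) (v i j) (D j)) ⟩
  sum (λ i → sum (λ j → x i ℤ.* (sgn j ℤ.* v i j ℤ.* D j)))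
    ≡⟨ Σℤ.sum-cong-≗ (λ i → Σℤ.*-distribˡ-sum (x i) λ j → sgn j ℤ.* v i j ℤ.* D j) ⟨
  sum (λ i → x i ℤ.* det (A [0]≔ v i)) ∎
  where
  open ≡-Reasoning
  D : Fin _ → ℤ
  D j = det λ i k → A (suc i) (punchIn j k)
  lem : ∀ s x v d → s ℤ.* (x ℤ.* v) ℤ.* d ≡ x ℤ.* (s ℤ.* v ℤ.* d)
  lem = ℤ-solve

-- By linearity in row 0, every summand other than that of row 0 itself is a determinant with a
-- repeated row.
det-combine-rows : ∀ {n} (A : Matrix (suc n)) (x : Fin (suc n) → ℤ) →
  det (A [0]≔ λ j → sum λ i → x i ℤ.* A i j) ≡ x zero ℤ.* det A
det-combine-rows A x = begin
  det (A [0]≔ λ j → sum λ i → x i ℤ.* A i j)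
    ≡⟨ det-row₀-linear A x A ⟩
  x zero ℤ.* det (A [0]≔ A zero) ℤ.+ sum (λ p → x (suc p) ℤ.* det (A [0]≔ A (suc p)))
    ≡⟨ cong₂ ℤ._+_ (cong (x zero ℤ.*_) (det-cong same)) (sum-zero _ λ p →
         trans (cong (x (suc p) ℤ.*_) (det-repeated-row (A [0]≔ A (suc p)) p λ _ → refl)) (ℤ.*-zeroʳ (x (suc p)))) ⟩
  x zero ℤ.* det A ℤ.+ 0ℤ
    ≡⟨ ℤ.+-identityʳ _ ⟩
  x zero ℤ.* det A ∎
  where
  open ≡-Reasoning
  same : ∀ i j → (A [0]≔ A zero) i j ≡ A i j
  same zero    j = refl
  same (suc i) j = refl

det-row₀-sparse : ∀ {n} (A : Matrix (suc n)) → (∀ j → A zero (suc j) ≡ 0ℤ) →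
  det A ≡ A zero zero ℤ.* det (λ i j → A (suc i) (suc j))
det-row₀-sparse A h = begin
  1ℤ ℤ.* A zero zero ℤ.* D ℤ.+ sum (λ j → sgn (suc j) ℤ.* A zero (suc j) ℤ.* E j)
    ≡⟨ cong₂ ℤ._+_ (cong (ℤ._* D) (ℤ.*-identityˡ (A zero zero))) (sum-zero _ λ j →
         trans (cong (λ z → sgn (suc j) ℤ.* z ℤ.* E j) (h j)) (cong (ℤ._* E j) (ℤ.*-zeroʳ (sgn (suc j))))) ⟩
  A zero zero ℤ.* D ℤ.+ 0ℤ
    ≡⟨ ℤ.+-identityʳ _ ⟩
  A zero zero ℤ.* D ∎
  where
  open ≡-Reasoning
  D = det λ i j → A (suc i) (suc j)
  E : Fin _ → ℤ
  E j = det λ i k → A (suc i) (punchIn (suc j) k)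

-- The expansion runs along a row, so the zero column is followed into the minors: deleting a later
-- column leaves column 0 in place.
det-column₀-zero : ∀ {n} (A : Matrix (suc n)) → (∀ i → A i zero ≡ 0ℤ) → det A ≡ 0ℤ
det-column₀-zero A h = sum-zero _ (term A h)
  where
  term : ∀ {n} (A : Matrix (suc n)) → (∀ i → A i zero ≡ 0ℤ) → ∀ j →
    sgn j ℤ.* A zero j ℤ.* det (λ i k → A (suc i) (punchIn j k)) ≡ 0ℤ
  term A h zero = cong (λ z → 1ℤ ℤ.* z ℤ.* det (λ i k → A (suc i) (suc k))) (h zero)
  term {suc n} A h (suc j) = trans
    (cong (sgn (suc j) ℤ.* A zero (suc j) ℤ.*_)
      (det-column₀-zero (λ i k → A (suc i) (punchIn (suc j) k)) λ i → h (suc i)))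
    (ℤ.*-zeroʳ (sgn (suc j) ℤ.* A zero (suc j)))

∏ᶠ : ∀ {n} → (Fin n → ℤ) → ℤ
∏ᶠ {zero}  t = 1ℤ
∏ᶠ {suc n} t = t zero ℤ.* ∏ᶠ λ i → t (suc i)

-- In the expansion along row 0, every minor but the first retains column 0, which vanishes below
-- the diagonal.
det-triangular : ∀ {n} (A : Matrix n) → (∀ i j → j Fin.< i → A i j ≡ 0ℤ) → det A ≡ ∏ᶠ λ i → A i i
det-triangular {zero}  A h = refl
det-triangular {suc n} A h = begin
  1ℤ ℤ.* A zero zero ℤ.* det A′ ℤ.+ sum (λ j → sgn (suc j) ℤ.* A zero (suc j) ℤ.* E j)
    ≡⟨ cong₂ ℤ._+_ (cong₂ ℤ._*_ (ℤ.*-identityˡ (A zero zero)) (det-triangular A′ λ i j j<i → h (suc i) (suc j) (ℕ.s≤s j<i)))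
         (sum-zero _ λ j → trans (cong (sgn (suc j) ℤ.* A zero (suc j) ℤ.*_) (E≡0 j)) (ℤ.*-zeroʳ (sgn (suc j) ℤ.* A zero (suc j)))) ⟩
  A zero zero ℤ.* ∏ᶠ (λ i → A′ i i) ℤ.+ 0ℤ
    ≡⟨ ℤ.+-identityʳ _ ⟩
  A zero zero ℤ.* ∏ᶠ (λ i → A′ i i) ∎
  where
  open ≡-Reasoning
  A′ : Matrix n
  A′ i j = A (suc i) (suc j)
  E : Fin n → ℤ
  E j = det λ i k → A (suc i) (punchIn (suc j) k)
  zero-column : ∀ {m} (B : Fin m → Fin (suc m) → ℤ) → (∀ i → B i zero ≡ 0ℤ) →
    ∀ j → det (λ i k → B i (punchIn (suc j) k)) ≡ 0ℤ
  zero-column {suc m} B hB j = det-column₀-zero (λ i k → B i (punchIn (suc j) k)) hB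
  E≡0 : ∀ j → E j ≡ 0ℤ
  E≡0 = zero-column (λ i → A (suc i)) λ i → h (suc i) zero (ℕ.s≤s ℕ.z≤n)

-- The Möbius function

μᴸ : List ℕ → ℤ
μᴸ ps with unique? ps
... | yes _ = -1ℤ ℤ.^ length ps
... | no  _ = 0ℤ

μᴸ-unique : ∀ {ps} → Unique ps → μᴸ ps ≡ -1ℤ ℤ.^ length ps
μᴸ-unique {ps} u with unique? ps
... | yes _ = refl
... | no ¬u = contradiction u ¬u

μᴸ-¬unique : ∀ {ps} → ¬ Unique ps → μᴸ ps ≡ 0ℤ
μᴸ-¬unique {ps} ¬u with unique? ps
... | yes u = contradiction u ¬u
... | no  _ = refl

μᴸ-↭ : ∀ {ps qs} → ps ↭ qs → μᴸ ps ≡ μᴸ qs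
μᴸ-↭ {ps} {qs} σ with unique? ps
... | yes u = trans (cong (-1ℤ ℤ.^_) (↭-length σ)) (sym (μᴸ-unique (Unique-resp-↭ (setoid ℕ) (↭⇒↭ₛ σ) u)))
... | no ¬u = sym (μᴸ-¬unique λ u → ¬u (Unique-resp-↭ (setoid ℕ) (↭⇒↭ₛ (↭-sym σ)) u))

-- Factorisations are unique up to order, so `μ` may be read off from any of them, in particular
-- from one with a chosen prime in front.
μ≡μᴸ : ∀ n .{{_ : NonZero n}} (f : PrimeFactorisation n) → μ n ≡ μᴸ (factors f)
μ≡μᴸ n f = trans lem (μᴸ-↭ (factorisationUnique (factorise n) f))
  where
  lem : μ n ≡ μᴸ (factors (factorise n))
  lem with unique? (factors (factorise n))
  ... | yes _ = refl
  ... | no  _ = refl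

∣-1^n∣≡1 : ∀ n → ℤ.∣ -1ℤ ℤ.^ n ∣ ≡ 1
∣-1^n∣≡1 zero    = refl
∣-1^n∣≡1 (suc n) = trans (ℤ.abs-* -1ℤ (-1ℤ ℤ.^ n)) (trans (ℕ.*-identityˡ _) (∣-1^n∣≡1 n))

∣μ∣≤1 : ∀ n .{{_ : NonZero n}} → ℤ.∣ μ n ∣ ℕ.≤ 1
∣μ∣≤1 n with unique? (factors (factorise n))
... | yes _ = ℕ.≤-reflexive (∣-1^n∣≡1 (length (factors (factorise n))))
... | no  _ = ℕ.z≤n

module _ {p e} (pr : Prime p) .{{_ : NonZero e}} where

  private
    fe = factorise e

    extend : ∀ {d} → d ≡ p ℕ.* e → PrimeFactorisation d
    extend d≡pe = record
      { factors         = p ∷ factors fe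
      ; isFactorisation = trans d≡pe (cong (p ℕ.*_) (isFactorisation fe))
      ; factorsPrime    = pr ∷ factorsPrime fe
      }

  -- `d` is a variable with an equation because the lemma is applied to indices `suc (toℕ i)`, which
  -- equal `p ℕ.* e` only propositionally.
  μ-∤ : ∀ {d} .{{_ : NonZero d}} → d ≡ p ℕ.* e → ¬ p ∣ e → μ d ≡ ℤ.- μ e
  μ-∤ {d} d≡pe p∤e = trans (μ≡μᴸ d (extend d≡pe)) (trans (lem (unique? (factors fe))) (cong ℤ.-_ (sym (μ≡μᴸ e fe))))
    where
    p∉ : All (p ≢_) (factors fe)
    p∉ = ¬Any⇒All¬ (factors fe) λ p∈ → p∤e (subst (p ∣_) (sym (isFactorisation fe)) (∈⇒∣product p∈))
    lem : Dec (Unique (factors fe)) → μᴸ (p ∷ factors fe) ≡ ℤ.- μᴸ (factors fe)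
    lem (yes u) = trans (μᴸ-unique (p∉ ∷ u)) (trans (ℤ.-1*i≡-i _) (cong ℤ.-_ (sym (μᴸ-unique u))))
    lem (no ¬u) = trans (μᴸ-¬unique λ u → ¬u (AllPairs.tail u)) (cong ℤ.-_ (sym (μᴸ-¬unique ¬u)))

  μ-∣ : ∀ {d} .{{_ : NonZero d}} → d ≡ p ℕ.* e → p ∣ e → μ d ≡ 0ℤ
  μ-∣ {d} d≡pe p∣e = trans (μ≡μᴸ d (extend d≡pe)) (μᴸ-¬unique λ u → All.lookup (AllPairs.head u) p∈ refl)
    where
    p∈ : p ∈ factors fe
    p∈ = factorisationHasAllPrimeFactors pr (subst (p ∣_) (isFactorisation fe) p∣e) (factorsPrime fe)

primeDivisor : ∀ j → ∃[ p ] ∃[ m ] (Prime p × suc (suc j) ≡ p ℕ.* m)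
primeDivisor j = go (factorise (suc (suc j)))
  where
  go : PrimeFactorisation (suc (suc j)) → _
  -- The empty factorisation has product 1 and is ruled out by the type of its equation.
  go record { factors = p ∷ ps ; isFactorisation = eq ; factorsPrime = pr ∷ _ } = p , product ps , pr , eq

sum-single : ∀ {n} (t : Fin n → ℤ) i → (∀ k → k ≢ i → t k ≡ 0ℤ) → sum t ≡ t i
sum-single {suc n} t i h = begin
  sum t                                      ≡⟨ Σℤ.sum-remove {i = i} t ⟩
  t i ℤ.+ sum (λ k → t (punchIn i k))        ≡⟨ cong (λ z → t i ℤ.+ z) (sum-zero _ λ k → h (punchIn i k) (Fin.punchInᵢ≢i i k)) ⟩
  t i ℤ.+ 0ℤ                                 ≡⟨ ℤ.+-identityʳ (t i) ⟩
  t i                                        ∎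
  where open ≡-Reasoning

infix 8 [_]_

-- The Iverson bracket as a factor.
[_]_ : ∀ {P : Set} → Dec P → ℤ → ℤ
[ yes _ ] i = i
[ no  _ ] i = 0ℤ

[]-yes : ∀ {P : Set} (d : Dec P) {i} → P → [ d ] i ≡ i
[]-yes (yes _) p = refl
[]-yes (no ¬p) p = contradiction p ¬p

[]-no : ∀ {P : Set} (d : Dec P) {i} → ¬ P → [ d ] i ≡ 0ℤ
[]-no (yes p) ¬p = contradiction p ¬p
[]-no (no _)  ¬p = refl

[]-zero : ∀ {P : Set} (d : Dec P) {i} → i ≡ 0ℤ → [ d ] i ≡ 0ℤ
[]-zero (yes p) i≡0 = i≡0
[]-zero (no _)  i≡0 = refl

-- With p prime and j = p m, the divisors of j prime to p are the e ∣ m prime to p, and the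
-- term of e cancels against that of p e; the terms of p e with p ∣ e vanish.
module _ {p m j n} (pr : Prime p) (j≡pm : suc j ≡ p ℕ.* m) (j<n : j ℕ.< n) where

  private
    instance
      p≢0 : NonZero p
      p≢0 = prime⇒nonZero pr

    d : Fin n → ℕ
    d i = suc (toℕ i)

    d-injective : ∀ {i k} → d i ≡ d k → i ≡ k
    d-injective eq = Fin.toℕ-injective (ℕ.suc-injective eq)

    -- The term of a divisor prime to `p`. The value at 0 is a dummy, as `μ` takes nonzero
    -- arguments; the indices `d k` are positive.
    A : ℕ → ℤ
    A zero    = 0ℤ
    A (suc e) = [ suc e ∣? m ] ([ ¬? (p ∣? suc e) ] μ (suc e))

    B : Fin n → ℤ
    B i = [ p ∣? d i ] ([ d i ∣? suc j ] μ (d i))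

    -- A kernel supported on the graph of e ↦ p e. Summing over `i` gives the terms `A`, summing
    -- over `k` the negatives of the terms `B`, so the two families cancel by exchanging the order
    -- of summation, without a bijection of index sets.
    K : Fin n → Fin n → ℤ
    K i k = [ d i ℕ.≟ p ℕ.* d k ] A (d k)

    p∤d⇒coprime : ∀ {d} → ¬ p ∣ d → Coprime d p
    p∤d⇒coprime p∤d (c∣d , c∣p) with prime⇒irreducible pr c∣p
    ... | inj₁ c≡1 = c≡1
    ... | inj₂ refl = contradiction c∣d p∤d

    split : ∀ i → [ d i ∣? suc j ] μ (d i) ≡ A (d i) ℤ.+ B i
    split i with p ∣? d i | d i ∣? m | d i ∣? suc j
    ... | yes p∣d | d∣?m    | d∣?j    = sym (trans (cong (λ z → z ℤ.+ [ d∣?j ] μ (d i)) ([]-zero d∣?m refl)) (ℤ.+-identityˡ _))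
    ... | no  p∤d | yes d∣m | yes _   = sym (ℤ.+-identityʳ _)
    ... | no  p∤d | no d∤m  | no _    = refl
    ... | no  p∤d | yes d∣m | no d∤j  = contradiction (subst (d i ∣_) (sym j≡pm) (∣n⇒∣m*n p d∣m)) d∤j
    ... | no  p∤d | no d∤m  | yes d∣j = contradiction (coprime-divisor (p∤d⇒coprime p∤d) (subst (d i ∣_) j≡pm d∣j)) d∤m

    A≡∑K : ∀ k → A (d k) ≡ sum λ i → K i k
    A≡∑K k = go (d k ∣? m)
      where
      go : Dec (d k ∣ m) → A (d k) ≡ sum λ i → K i k
      go (no ¬∣) = trans A≡0 (sym (sum-zero _ λ i → []-zero (d i ℕ.≟ p ℕ.* d k) A≡0))
        where
        A≡0 : A (d k) ≡ 0ℤ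
        A≡0 = []-no (d k ∣? m) ¬∣
      go (yes d∣m) = sym (trans (sum-single (λ i → K i k) i₀ λ i i≢i₀ → []-no (d i ℕ.≟ p ℕ.* d k) λ eq → i≢i₀ (d-injective (trans eq (sym di₀))))
                        ([]-yes (d i₀ ℕ.≟ p ℕ.* d k) di₀))
        where
        pd∣j : p ℕ.* d k ∣ suc j
        pd∣j = subst (p ℕ.* d k ∣_) (sym j≡pm) (*-monoʳ-∣ p d∣m)
        spd : suc (ℕ.pred (p ℕ.* d k)) ≡ p ℕ.* d k
        spd = ℕ.suc-pred (p ℕ.* d k) {{ℕ.m*n≢0 p (d k)}}
        -- Here `j<n` enters: p times a divisor of m divides `suc j` and so is still the number of a
        -- row.
        pd≤n : ℕ.pred (p ℕ.* d k) ℕ.< n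
        pd≤n = subst (ℕ._≤ n) (sym spd) (ℕ.≤-trans (∣⇒≤ pd∣j) j<n)
        i₀ = fromℕ< pd≤n
        di₀ : d i₀ ≡ p ℕ.* d k
        di₀ = trans (cong suc (Fin.toℕ-fromℕ< pd≤n)) spd

    B≡-∑K : ∀ i → B i ≡ ℤ.- sum (K i)
    B≡-∑K i with p ∣? d i
    ... | no p∤d = cong ℤ.-_ (sym (sum-zero _ λ k → []-no (d i ℕ.≟ p ℕ.* d k) λ eq → p∤d (subst (p ∣_) (sym eq) (m∣m*n (d k)))))
    ... | yes (divides (suc e) d≡ep) = trans (trans B′ (cong ℤ.-_ (sym K₀)))
        (cong ℤ.-_ (sym (sum-single (K i) k₀ λ k k≢k₀ → []-no (d i ℕ.≟ p ℕ.* d k) λ eq →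
          k≢k₀ (d-injective (ℕ.*-cancelˡ-≡ (d k) (d k₀) p (trans (sym eq) (trans d≡pe (cong (p ℕ.*_) (sym dk₀)))))))))
      where
      d≡pe : d i ≡ p ℕ.* suc e
      d≡pe = trans d≡ep (ℕ.*-comm (suc e) p)
      e<n : e ℕ.< n
      e<n = ℕ.≤-trans (subst (suc e ℕ.≤_) (sym d≡pe) (ℕ.m≤n*m (suc e) p)) (Fin.toℕ<n i)
      k₀ = fromℕ< e<n
      dk₀ : d k₀ ≡ suc e
      dk₀ = cong suc (Fin.toℕ-fromℕ< e<n)
      K₀ : K i k₀ ≡ A (suc e)
      K₀ = trans ([]-yes (d i ℕ.≟ p ℕ.* d k₀) (trans d≡pe (cong (p ℕ.*_) (sym dk₀)))) (cong A dk₀)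
      B′ : [ d i ∣? suc j ] μ (d i) ≡ ℤ.- A (suc e)
      B′ with d i ∣? suc j | suc e ∣? m | p ∣? suc e
      ... | no _    | no _    | _       = refl
      ... | yes d∣j | no e∤m  | _       = contradiction (*-cancelˡ-∣ p (subst₂ _∣_ d≡pe j≡pm d∣j)) e∤m
      ... | no d∤j  | yes e∣m | _       = contradiction (subst₂ _∣_ (sym d≡pe) (sym j≡pm) (*-monoʳ-∣ p e∣m)) d∤j
      ... | yes _   | yes _   | yes p∣e = μ-∣ pr d≡pe p∣e
      ... | yes _   | yes _   | no p∤e  = μ-∤ pr d≡pe p∤e

  ∑-μ-divisors-prime : sum {n} (λ i → [ suc (toℕ i) ∣? suc j ] μ (suc (toℕ i))) ≡ 0ℤ
  ∑-μ-divisors-prime = begin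
    sum (λ i → [ d i ∣? suc j ] μ (d i))             ≡⟨ Σℤ.sum-cong-≗ split ⟩
    sum (λ i → A (d i) ℤ.+ B i)                      ≡⟨ Σℤ.∑-distrib-+ (λ i → A (d i)) B ⟩
    sum (λ i → A (d i)) ℤ.+ sum B                    ≡⟨ cong₂ ℤ._+_ (trans (Σℤ.sum-cong-≗ A≡∑K) (sym (Σℤ.∑-comm K)))
                                                          (trans (Σℤ.sum-cong-≗ B≡-∑K) (sum-neg λ i → sum (K i))) ⟩
    sum (λ i → sum (K i)) ℤ.- sum (λ i → sum (K i))  ≡⟨ ℤ.+-inverseʳ (sum λ i → sum (K i)) ⟩
    0ℤ                                               ∎
    where open ≡-Reasoning

∑-μ-divisors : ∀ {n} j → suc j ℕ.< n → sum {n} (λ i → [ suc (toℕ i) ∣? suc (suc j) ] μ (suc (toℕ i))) ≡ 0ℤ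
∑-μ-divisors j j<n = let (_ , _ , pr , eq) = primeDivisor j in ∑-μ-divisors-prime pr eq j<n

-- The determinant of the Fibonacci–Redheffer matrix

ι : ℤ → ℚ
ι i = i ℚ./ 1

private
  toℚᵘ-/ : ∀ i n → ℚ.toℚᵘ (i ℚ./ suc n) ℚᵘ.≃ mkℚᵘ i n
  toℚᵘ-/ i n = ℚ.toℚᵘ-fromℚᵘ (mkℚᵘ i n)

ι-+ : ∀ i j → ι (i ℤ.+ j) ≡ ι i ℚ.+ ι j
ι-+ i j = ℚ.toℚᵘ-injective (begin
  ℚ.toℚᵘ (ι (i ℤ.+ j))                 ≈⟨ toℚᵘ-/ (i ℤ.+ j) 0 ⟩
  mkℚᵘ (i ℤ.+ j) 0                     ≈⟨ ℚᵘ.*≡* (lem i j) ⟩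
  mkℚᵘ i 0 ℚᵘ.+ mkℚᵘ j 0               ≈⟨ ℚᵘ.+-cong (toℚᵘ-/ i 0) (toℚᵘ-/ j 0) ⟨
  ℚ.toℚᵘ (ι i) ℚᵘ.+ ℚ.toℚᵘ (ι j)       ≈⟨ ℚ.toℚᵘ-homo-+ (ι i) (ι j) ⟨
  ℚ.toℚᵘ (ι i ℚ.+ ι j)                 ∎)
  where
  open ℚᵘ.≃-Reasoning
  lem : ∀ i j → (i ℤ.+ j) ℤ.* 1ℤ ≡ (i ℤ.* 1ℤ ℤ.+ j ℤ.* 1ℤ) ℤ.* 1ℤ
  lem = ℤ-solve

ι-* : ∀ i j → ι (i ℤ.* j) ≡ ι i ℚ.* ι j
ι-* i j = ℚ.toℚᵘ-injective (begin
  ℚ.toℚᵘ (ι (i ℤ.* j))                 ≈⟨ toℚᵘ-/ (i ℤ.* j) 0 ⟩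
  mkℚᵘ i 0 ℚᵘ.* mkℚᵘ j 0               ≈⟨ ℚᵘ.*-cong (toℚᵘ-/ i 0) (toℚᵘ-/ j 0) ⟨
  ℚ.toℚᵘ (ι i) ℚᵘ.* ℚ.toℚᵘ (ι j)       ≈⟨ ℚ.toℚᵘ-homo-* (ι i) (ι j) ⟨
  ℚ.toℚᵘ (ι i ℚ.* ι j)                 ∎)
  where open ℚᵘ.≃-Reasoning

ι-mono-≤ : ∀ {i j} → i ℤ.≤ j → ι i ℚ.≤ ι j
ι-mono-≤ {i} {j} i≤j = ℚ.toℚᵘ-cancel-≤
  (ℚᵘ.≤-respˡ-≃ (ℚᵘ.≃-sym (toℚᵘ-/ i 0)) (ℚᵘ.≤-respʳ-≃ (ℚᵘ.≃-sym (toℚᵘ-/ j 0))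
    (ℚᵘ.*≤* (ℤ.*-monoʳ-≤-nonNeg 1ℤ i≤j))))

/-*-cancel : ∀ i n .{{_ : NonZero n}} → (i ℚ./ n) ℚ.* ι (+ n) ≡ ι i
/-*-cancel i (suc n) = ℚ.toℚᵘ-injective (begin
  ℚ.toℚᵘ ((i ℚ./ suc n) ℚ.* ι (+ suc n))              ≈⟨ ℚ.toℚᵘ-homo-* (i ℚ./ suc n) (ι (+ suc n)) ⟩
  ℚ.toℚᵘ (i ℚ./ suc n) ℚᵘ.* ℚ.toℚᵘ (ι (+ suc n))      ≈⟨ ℚᵘ.*-cong (toℚᵘ-/ i n) (toℚᵘ-/ (+ suc n) 0) ⟩
  mkℚᵘ i n ℚᵘ.* mkℚᵘ (+ suc n) 0                      ≈⟨ ℚᵘ.*≡* (trans (lem i (+ suc n)) (cong (λ k → i ℤ.* + k) (sym (ℕ.*-identityʳ (suc n))))) ⟩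
  mkℚᵘ i 0                                            ≈⟨ toℚᵘ-/ i 0 ⟨
  ℚ.toℚᵘ (ι i)                                        ∎)
  where
  open ℚᵘ.≃-Reasoning
  lem : ∀ i k → i ℤ.* k ℤ.* 1ℤ ≡ i ℤ.* k
  lem = ℤ-solve

∑ℚ : ℕ → (ℕ → ℚ) → ℚ
∑ℚ zero    f = 0ℚ
∑ℚ (suc n) f = ∑ℚ n f ℚ.+ f n

sum-snoc : ∀ n (f : ℕ → ℤ) → sum {suc n} (λ i → f (toℕ i)) ≡ sum {n} (λ i → f (toℕ i)) ℤ.+ f n
sum-snoc zero    f = trans (ℤ.+-identityʳ (f 0)) (sym (ℤ.+-identityˡ (f 0)))
sum-snoc (suc n) f = trans (cong (λ z → f 0 ℤ.+ z) (sum-snoc n λ i → f (suc i))) (sym (ℤ.+-assoc (f 0) _ (f (suc n))))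

ι-sum : ∀ n (f : ℕ → ℤ) → ι (sum {n} λ i → f (toℕ i)) ≡ ∑ℚ n λ i → ι (f i)
ι-sum zero    f = refl
ι-sum (suc n) f = trans (cong ι (sum-snoc n f)) (trans (ι-+ (sum {n} λ i → f (toℕ i)) (f n)) (cong (ℚ._+ ι (f n)) (ι-sum n f)))

Fprod : ℕ → ℕ
Fprod zero    = 1
Fprod (suc n) = Fprod n ℕ.* F (suc n)

Fprod-pos : ∀ n → 0 ℕ.< Fprod n
Fprod-pos zero    = ℕ.s≤s ℕ.z≤n
Fprod-pos (suc n) = ℕ.*-mono-< (Fprod-pos n) (F-pos n)

F∣Fprod : ∀ {i n} → i ℕ.< n → F (suc i) ∣ Fprod n
F∣Fprod {i} {suc n} i<1+n with ℕ.m≤n⇒m<n∨m≡n (ℕ.s≤s⁻¹ i<1+n)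
... | inj₁ i<n  = ∣m⇒∣m*n (F (suc n)) (F∣Fprod i<n)
... | inj₂ refl = n∣m*n (Fprod n)

Fcofactor : ℕ → ℕ → ℕ
Fcofactor n i = ℕ._/_ (Fprod n) (F (suc i)) {{F-nonZero i}}

Fcofactor-* : ∀ {n i} → i ℕ.< n → Fcofactor n i ℕ.* F (suc i) ≡ Fprod n
Fcofactor-* {n} {i} i<n = ℕ.m/n*n≡m {{F-nonZero i}} (F∣Fprod i<n)

∏ᶠ-snoc : ∀ n (f : ℕ → ℤ) → ∏ᶠ {suc n} (λ i → f (toℕ i)) ≡ ∏ᶠ {n} (λ i → f (toℕ i)) ℤ.* f n
∏ᶠ-snoc zero    f = trans (ℤ.*-identityʳ (f 0)) (sym (ℤ.*-identityˡ (f 0)))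
∏ᶠ-snoc (suc n) f = trans (cong (f 0 ℤ.*_) (∏ᶠ-snoc n λ i → f (suc i))) (sym (ℤ.*-assoc (f 0) _ (f (suc n))))

∏ᶠ-F : ∀ n → ∏ᶠ {n} (λ i → + F (suc (toℕ i))) ≡ + Fprod n
∏ᶠ-F zero    = refl
∏ᶠ-F (suc n) = trans (∏ᶠ-snoc n λ i → + F (suc i)) (trans (cong (ℤ._* + F (suc n)) (∏ᶠ-F n)) (sym (ℤ.pos-* (Fprod n) (F (suc n)))))

fibRedheffer-suc-suc : ∀ i j → fibRedheffer i (suc (suc j)) ≡ [ i ∣? suc (suc j) ] (+ F i)
fibRedheffer-suc-suc i j with i ∣? suc (suc j)
... | yes _ = refl
... | no  _ = refl

-- By Möbius inversion the combination ∑ᵢ (μ(i) / Fᵢ) ⋅ rowᵢ vanishes beyond its first entry.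
det-FR : ∀ n → det (FR (suc n)) ≡ sum {suc n} λ i → μ (suc (toℕ i)) ℤ.* + Fcofactor (suc n) (toℕ i)
det-FR n = ℤ.*-cancelˡ-≡ (+ P) (det A) (sum x) {{ℕ.>-nonZero (Fprod-pos (suc n))}} (begin
  + P ℤ.* det A                               ≡⟨ cong (ℤ._* det A) x₀ ⟨
  x zero ℤ.* det A                            ≡⟨ det-combine-rows A x ⟨
  det (A [0]≔ row)                            ≡⟨ det-row₀-sparse (A [0]≔ row) row-sparse ⟩
  row zero ℤ.* det A′                         ≡⟨ cong₂ ℤ._*_ (Σℤ.sum-cong-≗ λ i → ℤ.*-identityʳ (x i)) det-A′ ⟩
  sum x ℤ.* + P                               ≡⟨ ℤ.*-comm (sum x) (+ P) ⟩
  + P ℤ.* sum x                               ∎)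
  where
  open ≡-Reasoning
  P = Fprod (suc n)
  A = FR (suc n)
  x : Fin (suc n) → ℤ
  x i = μ (suc (toℕ i)) ℤ.* + Fcofactor (suc n) (toℕ i)
  row : Fin (suc n) → ℤ
  row j = sum λ i → x i ℤ.* A i j
  A′ : Matrix n
  A′ i j = A (suc i) (suc j)

  cofactor : ∀ i → Fcofactor (suc n) (toℕ i) ℕ.* F (suc (toℕ i)) ≡ P
  cofactor i = Fcofactor-* (Fin.toℕ<n i)

  -- Because F₁ = 1, both the coefficient of row 0 and the determinant of the remaining triangular
  -- block equal P; this is why P can be cancelled.
  x₀ : x zero ≡ + P
  x₀ = trans (ℤ.*-identityˡ (+ Fcofactor (suc n) 0)) (cong +_ (trans (sym (ℕ.*-identityʳ (Fcofactor (suc n) 0))) (cofactor zero)))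

  term : ∀ j i → x i ℤ.* A i (suc j) ≡ + P ℤ.* [ suc (toℕ i) ∣? suc (suc (toℕ j)) ] μ (suc (toℕ i))
  term j i = trans (cong (x i ℤ.*_) (fibRedheffer-suc-suc (suc (toℕ i)) (toℕ j))) (go (suc (toℕ i) ∣? suc (suc (toℕ j))))
    where
    lem : ∀ m c f → m ℤ.* c ℤ.* f ≡ c ℤ.* f ℤ.* m
    lem = ℤ-solve
    go : (d : Dec (suc (toℕ i) ∣ suc (suc (toℕ j)))) → x i ℤ.* [ d ] (+ F (suc (toℕ i))) ≡ + P ℤ.* [ d ] μ (suc (toℕ i))
    go (yes _) = trans (lem (μ (suc (toℕ i))) (+ Fcofactor (suc n) (toℕ i)) (+ F (suc (toℕ i))))
      (cong (ℤ._* μ (suc (toℕ i))) (trans (sym (ℤ.pos-* (Fcofactor (suc n) (toℕ i)) (F (suc (toℕ i))))) (cong +_ (cofactor i))))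
    go (no _)  = trans (ℤ.*-zeroʳ (x i)) (sym (ℤ.*-zeroʳ (+ P)))

  row-sparse : ∀ j → row (suc j) ≡ 0ℤ
  row-sparse j = begin
    row (suc j)                   ≡⟨ Σℤ.sum-cong-≗ (term j) ⟩
    sum (λ i → + P ℤ.* δ i)       ≡⟨ Σℤ.*-distribˡ-sum (+ P) δ ⟨
    + P ℤ.* sum δ                 ≡⟨ cong (+ P ℤ.*_) (∑-μ-divisors (toℕ j) (ℕ.s≤s (Fin.toℕ<n j))) ⟩
    + P ℤ.* 0ℤ                    ≡⟨ ℤ.*-zeroʳ (+ P) ⟩
    0ℤ                            ∎
    where
    δ : Fin (suc n) → ℤ
    δ i = [ suc (toℕ i) ∣? suc (suc (toℕ j)) ] μ (suc (toℕ i))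

  entry-below : ∀ i j → j ℕ.< i → fibRedheffer (suc (suc i)) (suc (suc j)) ≡ 0ℤ
  entry-below i j j<i = trans (fibRedheffer-suc-suc (suc (suc i)) j)
    ([]-no (suc (suc i) ∣? suc (suc j)) λ ∣j → ℕ.<⇒≱ (ℕ.s≤s (ℕ.s≤s j<i)) (∣⇒≤ ∣j))

  entry-diagonal : ∀ i → fibRedheffer (suc (suc i)) (suc (suc i)) ≡ + F (suc (suc i))
  entry-diagonal i = trans (fibRedheffer-suc-suc (suc (suc i)) i) ([]-yes (suc (suc i) ∣? suc (suc i)) ∣-refl)

  ∏ᶠ-cong : ∀ {m} {s t : Fin m → ℤ} → (∀ i → s i ≡ t i) → ∏ᶠ s ≡ ∏ᶠ t
  ∏ᶠ-cong {zero}  h = refl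
  ∏ᶠ-cong {suc m} h = cong₂ ℤ._*_ (h zero) (∏ᶠ-cong λ i → h (suc i))

  det-A′ : det A′ ≡ + P
  det-A′ = begin
    det A′                                            ≡⟨ det-triangular A′ (λ i j → entry-below (toℕ i) (toℕ j)) ⟩
    ∏ᶠ (λ i → A′ i i)                                 ≡⟨ ∏ᶠ-cong {n} (λ i → entry-diagonal (toℕ i)) ⟩
    ∏ᶠ {n} (λ i → + F (suc (suc (toℕ i))))            ≡⟨ ℤ.*-identityˡ _ ⟨
    ∏ᶠ {suc n} (λ i → + F (suc (toℕ i)))              ≡⟨ ∏ᶠ-F (suc n) ⟩
    + P                                               ∎

S : ℕ → ℚ
S n = ∑ℚ n λ k → ℚ._/_ (μ (suc k)) (F (suc k)) {{F-nonZero k}}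

∑ℚ-cong : ∀ n {f g : ℕ → ℚ} → (∀ i → i ℕ.< n → f i ≡ g i) → ∑ℚ n f ≡ ∑ℚ n g
∑ℚ-cong zero    h = refl
∑ℚ-cong (suc n) h = cong₂ ℚ._+_ (∑ℚ-cong n λ i i<n → h i (ℕ.m<n⇒m<1+n i<n)) (h n ℕ.≤-refl)

*-distribˡ-∑ℚ : ∀ n c (f : ℕ → ℚ) → c ℚ.* ∑ℚ n f ≡ ∑ℚ n λ i → c ℚ.* f i
*-distribˡ-∑ℚ zero    c f = ℚ.*-zeroʳ c
*-distribˡ-∑ℚ (suc n) c f = trans (ℚ.*-distribˡ-+ c (∑ℚ n f) (f n)) (cong (ℚ._+ c ℚ.* f n) (*-distribˡ-∑ℚ n c f))

ι-det-FR : ∀ n → ι (det (FR (suc n))) ≡ ι (+ Fprod (suc n)) ℚ.* S (suc n)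
ι-det-FR n = begin
  ι (det (FR (suc n)))                                    ≡⟨ cong ι (det-FR n) ⟩
  ι (sum {suc n} λ i → x (toℕ i))                         ≡⟨ ι-sum (suc n) x ⟩
  ∑ℚ (suc n) (λ i → ι (x i))                              ≡⟨ ∑ℚ-cong (suc n) term ⟩
  ∑ℚ (suc n) (λ i → ι (+ Fprod (suc n)) ℚ.* s i)          ≡⟨ *-distribˡ-∑ℚ (suc n) (ι (+ Fprod (suc n))) s ⟨
  ι (+ Fprod (suc n)) ℚ.* S (suc n)                       ∎
  where
  open ≡-Reasoning
  x : ℕ → ℤ
  x i = μ (suc i) ℤ.* + Fcofactor (suc n) i
  s : ℕ → ℚ
  s k = ℚ._/_ (μ (suc k)) (F (suc k)) {{F-nonZero k}}
  term : ∀ i → i ℕ.< suc n → ι (x i) ≡ ι (+ Fprod (suc n)) ℚ.* s i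
  term i i<n = begin
    ι (x i)                                              ≡⟨ ι-* (μ (suc i)) (+ c) ⟩
    ι (μ (suc i)) ℚ.* ι (+ c)                            ≡⟨ cong (ℚ._* ι (+ c)) (/-*-cancel (μ (suc i)) (F (suc i)) {{F-nonZero i}}) ⟨
    s i ℚ.* ι (+ F (suc i)) ℚ.* ι (+ c)                  ≡⟨ ℚ.*-assoc (s i) (ι (+ F (suc i))) (ι (+ c)) ⟩
    s i ℚ.* (ι (+ F (suc i)) ℚ.* ι (+ c))                ≡⟨ ℚ.*-comm (s i) _ ⟩
    ι (+ F (suc i)) ℚ.* ι (+ c) ℚ.* s i                  ≡⟨ cong (ℚ._* s i) (ι-* (+ F (suc i)) (+ c)) ⟨
    ι (+ F (suc i) ℤ.* + c) ℚ.* s i                      ≡⟨ cong (λ z → ι z ℚ.* s i) (trans (sym (ℤ.pos-* (F (suc i)) c))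
                                                              (cong +_ (trans (ℕ.*-comm (F (suc i)) c) (Fcofactor-* i<n)))) ⟩
    ι (+ Fprod (suc n)) ℚ.* s i                          ∎
    where c = Fcofactor (suc n) i

-- Inequalities between rationals

ℚ-ring : AlmostCommutativeRing _ _
ℚ-ring = fromCommutativeRing ℚ.+-*-commutativeRing λ x → dec⇒maybe (0ℚ ℚ.≟ x)

ιₙ : ℕ → ℚ
ιₙ n = ι (+ n)

ιₙ-* : ∀ m n → ιₙ (m ℕ.* n) ≡ ιₙ m ℚ.* ιₙ n
ιₙ-* m n = trans (cong ι (ℤ.pos-* m n)) (ι-* (+ m) (+ n))

ιₙ-mono-≤ : ∀ {m n} → m ℕ.≤ n → ιₙ m ℚ.≤ ιₙ n
ιₙ-mono-≤ m≤n = ι-mono-≤ (ℤ.+≤+ m≤n)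

0≤ιₙ : ∀ n → 0ℚ ℚ.≤ ιₙ n
0≤ιₙ n = ιₙ-mono-≤ {0} {n} ℕ.z≤n

0<ιₙ : ∀ n → 0ℚ ℚ.< ιₙ (suc n)
0<ιₙ n = ℚ.<-≤-trans (ℚ.positive⁻¹ 1ℚ) (ιₙ-mono-≤ {1} {suc n} (ℕ.s≤s ℕ.z≤n))

≤-*ˡ : ∀ {c a b} → 0ℚ ℚ.≤ c → a ℚ.≤ b → c ℚ.* a ℚ.≤ c ℚ.* b
≤-*ˡ {c} 0≤c = ℚ.*-monoˡ-≤-nonNeg c {{ℚ.nonNegative 0≤c}}

≤-*ʳ : ∀ {c a b} → 0ℚ ℚ.≤ c → a ℚ.≤ b → a ℚ.* c ℚ.≤ b ℚ.* c
≤-*ʳ {c} 0≤c = ℚ.*-monoʳ-≤-nonNeg c {{ℚ.nonNegative 0≤c}}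

≤-* : ∀ {a b c d} → 0ℚ ℚ.≤ c → 0ℚ ℚ.≤ b → a ℚ.≤ b → c ℚ.≤ d → a ℚ.* c ℚ.≤ b ℚ.* d
≤-* 0≤c 0≤b a≤b c≤d = ℚ.≤-trans (≤-*ʳ 0≤c a≤b) (≤-*ˡ 0≤b c≤d)

*-cancelʳ-≤ : ∀ {a b c} → 0ℚ ℚ.< c → a ℚ.* c ℚ.≤ b ℚ.* c → a ℚ.≤ b
*-cancelʳ-≤ {c = c} 0<c = ℚ.*-cancelʳ-≤-pos c {{ℚ.positive 0<c}}

0≤* : ∀ {a b} → 0ℚ ℚ.≤ a → 0ℚ ℚ.≤ b → 0ℚ ℚ.≤ a ℚ.* b
0≤* {a} {b} 0≤a 0≤b = subst (ℚ._≤ a ℚ.* b) (ℚ.*-zeroʳ a) (≤-*ˡ 0≤a 0≤b)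

0<* : ∀ {a b} → 0ℚ ℚ.< a → 0ℚ ℚ.< b → 0ℚ ℚ.< a ℚ.* b
0<* {a} {b} 0<a 0<b = ℚ.positive⁻¹ (a ℚ.* b) {{ℚ.pos*pos⇒pos a {{ℚ.positive 0<a}} b {{ℚ.positive 0<b}}}}

∣∣-+ : ∀ {a b x y} → ℚ.∣ a ∣ ℚ.≤ x → ℚ.∣ b ∣ ℚ.≤ y → ℚ.∣ a ℚ.+ b ∣ ℚ.≤ x ℚ.+ y
∣∣-+ {a} {b} a≤x b≤y = ℚ.≤-trans (ℚ.∣p+q∣≤∣p∣+∣q∣ a b) (ℚ.+-mono-≤ a≤x b≤y)

∣∣-* : ∀ {a b x y} → ℚ.∣ a ∣ ℚ.≤ x → ℚ.∣ b ∣ ℚ.≤ y → ℚ.∣ a ℚ.* b ∣ ℚ.≤ x ℚ.* y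
∣∣-* {a} {b} a≤x b≤y = ℚ.≤-trans (ℚ.≤-reflexive (ℚ.∣p*q∣≡∣p∣*∣q∣ a b))
  (≤-* (ℚ.0≤∣p∣ b) (ℚ.≤-trans (ℚ.0≤∣p∣ a) a≤x) a≤x b≤y)

∣∣-swap : ∀ a b → ℚ.∣ a ℚ.- b ∣ ≡ ℚ.∣ b ℚ.- a ∣
∣∣-swap a b = trans (sym (ℚ.∣-p∣≡∣p∣ (a ℚ.- b))) (cong ℚ.∣_∣ (lem a b))
  where
  lem : ∀ a b → ℚ.- (a ℚ.- b) ≡ b ℚ.- a
  lem = RingSolver.solve-∀ ℚ-ring

∣∣-triangle : ∀ {x y} a b c → ℚ.∣ a ℚ.- b ∣ ℚ.≤ x → ℚ.∣ b ℚ.- c ∣ ℚ.≤ y → ℚ.∣ a ℚ.- c ∣ ℚ.≤ x ℚ.+ y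
∣∣-triangle {x} {y} a b c h k = subst (λ z → ℚ.∣ z ∣ ℚ.≤ x ℚ.+ y) (lem a b c) (∣∣-+ h k)
  where
  lem : ∀ a b c → (a ℚ.- b) ℚ.+ (b ℚ.- c) ≡ a ℚ.- c
  lem = RingSolver.solve-∀ ℚ-ring

∣∣-bound : ∀ {p q} → p ℚ.≤ q → ℚ.- p ℚ.≤ q → ℚ.∣ p ∣ ℚ.≤ q
∣∣-bound {p} h k with ℚ.∣p∣≡p∨∣p∣≡-p p
... | inj₁ e = ℚ.≤-trans (ℚ.≤-reflexive e) h
... | inj₂ e = ℚ.≤-trans (ℚ.≤-reflexive e) k

∣∣-lower : ∀ {a b x y} → ℚ.∣ a ℚ.- b ∣ ℚ.≤ x → y ℚ.+ x ℚ.≤ ℚ.∣ b ∣ → y ℚ.≤ ℚ.∣ a ∣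
∣∣-lower {a} {b} {x} {y} h k = subst₂ ℚ._≤_ (lem y x) (lem ℚ.∣ a ∣ x) (ℚ.+-monoˡ-≤ (ℚ.- x) (begin
  y ℚ.+ x                          ≤⟨ k ⟩
  ℚ.∣ b ∣                          ≡⟨ cong ℚ.∣_∣ (lem′ a b) ⟩
  ℚ.∣ a ℚ.+ (b ℚ.- a) ∣            ≤⟨ ∣∣-+ {a} {b ℚ.- a} ℚ.≤-refl (subst (ℚ._≤ x) (∣∣-swap a b) h) ⟩
  ℚ.∣ a ∣ ℚ.+ x                    ∎))
  where
  open ℚ.≤-Reasoning
  lem : ∀ y x → y ℚ.+ x ℚ.- x ≡ y
  lem = RingSolver.solve-∀ ℚ-ring
  lem′ : ∀ a b → b ≡ a ℚ.+ (b ℚ.- a)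
  lem′ = RingSolver.solve-∀ ℚ-ring

½-+ : ∀ ε → ½ ℚ.* ε ℚ.+ ½ ℚ.* ε ≡ ε
½-+ ε = trans (sym (ℚ.*-distribʳ-+ ε ½ ½)) (ℚ.*-identityˡ ε)

0<½ : ∀ {ε} → 0ℚ ℚ.< ε → 0ℚ ℚ.< ½ ℚ.* ε
0<½ = 0<* (ℚ.positive⁻¹ ½)

½ε<ε : ∀ {ε} → 0ℚ ℚ.< ε → ½ ℚ.* ε ℚ.< ε
½ε<ε {ε} 0<ε = subst₂ ℚ._<_ (ℚ.+-identityʳ _) (½-+ ε) (ℚ.+-monoʳ-< (½ ℚ.* ε) (0<½ 0<ε))

archimedean : ∀ c ε → 0ℚ ℚ.< ε → ∃[ N ] (ιₙ c ℚ.≤ ε ℚ.* ιₙ N)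
-- The numerator is positive, so ε is at least 1 / `suc d`.
archimedean c ε@(ℚ.mkℚ (+ suc k) d _) _ = suc d ℕ.* c , (begin
  ιₙ c                                ≡⟨ ℚ.*-identityˡ (ιₙ c) ⟨
  1ℚ ℚ.* ιₙ c                         ≤⟨ ≤-*ʳ (0≤ιₙ c) (ιₙ-mono-≤ {1} {suc k} (ℕ.s≤s ℕ.z≤n)) ⟩
  ιₙ (suc k) ℚ.* ιₙ c                 ≡⟨ cong (ℚ._* ιₙ c) (/-*-cancel (+ suc k) (suc d)) ⟨
  (+ suc k ℚ./ suc d) ℚ.* ιₙ (suc d) ℚ.* ιₙ c  ≡⟨ cong (λ z → z ℚ.* ιₙ (suc d) ℚ.* ιₙ c) (ℚ.↥p/↧p≡p ε) ⟩
  ε ℚ.* ιₙ (suc d) ℚ.* ιₙ c           ≡⟨ ℚ.*-assoc ε (ιₙ (suc d)) (ιₙ c) ⟩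
  ε ℚ.* (ιₙ (suc d) ℚ.* ιₙ c)         ≡⟨ cong (ε ℚ.*_) (ιₙ-* (suc d) c) ⟨
  ε ℚ.* ιₙ (suc d ℕ.* c)              ∎)
  where open ℚ.≤-Reasoning
archimedean c (ℚ.mkℚ (+ zero) d _) (ℚ.*<* (ℤ.+<+ ()))
archimedean c (ℚ.mkℚ (ℤ.-[1+ k ]) d _) (ℚ.*<* ())

-- A rate of 1 / n is all that the approximations of √5 offer. For the geometric tails it is
-- wasteful, but it reduces the choice of N to `archimedean`.
vanishing : (u : ℕ → ℚ) (c : ℕ) → (∀ n → u n ℚ.* ιₙ (suc n) ℚ.≤ ιₙ c) →
  ∀ ε → 0ℚ ℚ.< ε → ∃[ N ] (∀ n → N ℕ.≤ n → u n ℚ.≤ ε)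
vanishing u c h ε 0<ε = let (N , N-large) = archimedean c ε 0<ε in
  N , λ n N≤n → *-cancelʳ-≤ (0<ιₙ n) (ℚ.≤-trans (h n) (ℚ.≤-trans N-large
    (≤-*ˡ (ℚ.<⇒≤ 0<ε) (ιₙ-mono-≤ {N} {suc n} (ℕ.m≤n⇒m≤1+n N≤n)))))

-- Null sequences and equality of reals

Null : (ℕ → ℚ) → Set
Null s = ∀ ε → 0ℚ ℚ.< ε → ∃[ N ] (∀ n → N ℕ.≤ n → ℚ.∣ s n ∣ ℚ.≤ ε)

Null-cong : ∀ {s t} → (∀ n → s n ≡ t n) → Null s → Null t
Null-cong h s-null ε 0<ε = let (N , f) = s-null ε 0<ε in
  N , λ n N≤n → subst (λ z → ℚ.∣ z ∣ ℚ.≤ ε) (h n) (f n N≤n)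

Null-+ : ∀ {s t} → Null s → Null t → Null λ n → s n ℚ.+ t n
Null-+ s-null t-null ε 0<ε =
  let (N , f) = s-null (½ ℚ.* ε) (0<½ 0<ε) ; (M , g) = t-null (½ ℚ.* ε) (0<½ 0<ε) in
  N ℕ.⊔ M , λ n p → subst (_ ℚ.≤_) (½-+ ε) (∣∣-+ (f n (ℕ.m⊔n≤o⇒m≤o N M p)) (g n (ℕ.m⊔n≤o⇒n≤o N M p)))

bounded : ∀ x → ∃[ B ] (0ℚ ℚ.< B × ∃[ N ] (∀ n → N ℕ.≤ n → ℚ.∣ seq x n ∣ ℚ.≤ B))
bounded x = let (N , f) = cauchy x 1ℚ (ℚ.positive⁻¹ 1ℚ) in
  1ℚ ℚ.+ ℚ.∣ seq x N ∣ , ℚ.+-mono-<-≤ (ℚ.positive⁻¹ 1ℚ) (ℚ.0≤∣p∣ (seq x N)) ,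
  N , λ n N≤n → subst (λ z → ℚ.∣ z ∣ ℚ.≤ _) (lem (seq x n) (seq x N)) (∣∣-+ {seq x n ℚ.- seq x N} {seq x N} (ℚ.<⇒≤ (f n N N≤n ℕ.≤-refl)) ℚ.≤-refl)
  where
  lem : ∀ a b → a ℚ.- b ℚ.+ b ≡ a
  lem = RingSolver.solve-∀ ℚ-ring

-- Null sequences form an ideal in the ring of Cauchy sequences. The equations for φ and b are
-- proved accordingly: the difference of the two sides is written as a combination of differences
-- already known to be null, and the coefficients are the second arguments of `Null-*`.
Null-* : ∀ {s} → Null s → ∀ x → Null λ n → s n ℚ.* seq x n
Null-* {s} s-null x ε 0<ε =
  let (B , 0<B , M , g) = bounded x
      B>0 = ℚ.positive 0<B
      B⁻¹ = ℚ.1/_ B {{ℚ.pos⇒nonZero B {{B>0}}}}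
      (N , f) = s-null (ε ℚ.* B⁻¹) (0<* 0<ε (ℚ.positive⁻¹ B⁻¹ {{ℚ.1/pos⇒pos B {{B>0}}}})) in
  N ℕ.⊔ M , λ n p → ℚ.≤-trans (∣∣-* (f n (ℕ.m⊔n≤o⇒m≤o N M p)) (g n (ℕ.m⊔n≤o⇒n≤o N M p)))
    (ℚ.≤-reflexive (trans (ℚ.*-assoc ε B⁻¹ B)
      (trans (cong (ε ℚ.*_) (ℚ.*-inverseˡ B {{ℚ.pos⇒nonZero B {{B>0}}}})) (ℚ.*-identityʳ ε))))

infix 4 _≃_

-- As a record type it determines `x` and `y`, which their sequences alone do not, the Cauchy proofs
-- being absent from them.
record _≃_ (x y : ℝ) : Set where
  constructor mk≃
  field difference-null : Null λ n → seq x n ℚ.- seq y n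

open _≃_ using (difference-null)

pointwise : ∀ {x y} → (∀ n → seq x n ≡ seq y n) → x ≃ y
pointwise {x} {y} h = mk≃ λ ε 0<ε → 0 , λ n _ →
  subst (λ z → ℚ.∣ z ∣ ℚ.≤ ε) (sym (trans (cong (ℚ._- seq y n) (h n)) (ℚ.+-inverseʳ (seq y n)))) (ℚ.<⇒≤ 0<ε)

≃-refl : ∀ {x} → x ≃ x
≃-refl = pointwise λ _ → refl

≃-sym : ∀ {x y} → x ≃ y → y ≃ x
≃-sym {x} {y} (mk≃ h) = mk≃ λ ε 0<ε → let (N , f) = h ε 0<ε in
  N , λ n p → subst (ℚ._≤ ε) (∣∣-swap (seq x n) (seq y n)) (f n p)

≃-trans : ∀ {x y z} → x ≃ y → y ≃ z → x ≃ z
≃-trans {x} {y} {z} (mk≃ h) (mk≃ k) = mk≃ (Null-cong (λ n → lem (seq x n) (seq y n) (seq z n)) (Null-+ h k))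
  where
  lem : ∀ a b c → (a ℚ.- b) ℚ.+ (b ℚ.- c) ≡ a ℚ.- c
  lem = RingSolver.solve-∀ ℚ-ring

≃-setoid : Setoid 0ℓ 0ℓ
≃-setoid = record { Carrier = ℝ ; _≈_ = _≃_ ; isEquivalence = record { refl = ≃-refl ; sym = ≃-sym ; trans = ≃-trans } }

+-cong : ∀ {x x′ y y′} → x ≃ x′ → y ≃ y′ → x + y ≃ x′ + y′
+-cong {x} {x′} {y} {y′} (mk≃ h) (mk≃ k) =
  mk≃ (Null-cong (λ n → lem (seq x n) (seq x′ n) (seq y n) (seq y′ n)) (Null-+ h k))
  where
  lem : ∀ a b c d → (a ℚ.- b) ℚ.+ (c ℚ.- d) ≡ (a ℚ.+ c) ℚ.- (b ℚ.+ d)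
  lem = RingSolver.solve-∀ ℚ-ring

neg-cong : ∀ {x y} → x ≃ y → - x ≃ - y
neg-cong {x} {y} (mk≃ h) = mk≃ λ ε 0<ε → let (N , f) = h ε 0<ε in
  N , λ n p → subst (ℚ._≤ ε) (trans (sym (ℚ.∣-p∣≡∣p∣ _)) (cong ℚ.∣_∣ (ℚ.neg-distrib-+ (seq x n) _))) (f n p)

*-cong : ∀ {x x′ y y′} → x ≃ x′ → y ≃ y′ → x * y ≃ x′ * y′
*-cong {x} {x′} {y} {y′} (mk≃ h) (mk≃ k) = mk≃ (Null-cong (λ n → lem (seq x n) (seq x′ n) (seq y n) (seq y′ n))
  (Null-+ (Null-* h y) (Null-* k x′)))
  where
  lem : ∀ a b c d → (a ℚ.- b) ℚ.* c ℚ.+ (c ℚ.- d) ℚ.* b ≡ (a ℚ.* c) ℚ.- (b ℚ.* d)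
  lem = RingSolver.solve-∀ ℚ-ring

ℝ-commutativeRing : CommutativeRing 0ℓ 0ℓ
ℝ-commutativeRing = record
  { Carrier = ℝ ; _≈_ = _≃_ ; _+_ = _+_ ; _*_ = _*_ ; -_ = -_ ; 0# = 0ℝ ; 1# = 1ℝ
  ; isCommutativeRing = record
    { isRing = record
      { +-isAbelianGroup = record
        { isGroup = record
          { isMonoid = record
            { isSemigroup = record
              { isMagma = record { isEquivalence = Setoid.isEquivalence ≃-setoid ; ∙-cong = +-cong }
              ; assoc = λ x y z → pointwise λ n → ℚ.+-assoc (seq x n) (seq y n) (seq z n)
              }
            ; identity = (λ x → pointwise λ n → ℚ.+-identityˡ (seq x n)) , λ x → pointwise λ n → ℚ.+-identityʳ (seq x n)
            }
          ; inverse = (λ x → pointwise λ n → ℚ.+-inverseˡ (seq x n)) , λ x → pointwise λ n → ℚ.+-inverseʳ (seq x n)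
          ; ⁻¹-cong = neg-cong
          }
        ; comm = λ x y → pointwise λ n → ℚ.+-comm (seq x n) (seq y n)
        }
      ; *-cong = *-cong
      ; *-assoc = λ x y z → pointwise λ n → ℚ.*-assoc (seq x n) (seq y n) (seq z n)
      ; *-identity = (λ x → pointwise λ n → ℚ.*-identityˡ (seq x n)) , λ x → pointwise λ n → ℚ.*-identityʳ (seq x n)
      ; distrib = (λ x y z → pointwise λ n → ℚ.*-distribˡ-+ (seq x n) (seq y n) (seq z n))
                , λ x y z → pointwise λ n → ℚ.*-distribʳ-+ (seq x n) (seq y n) (seq z n)
      }
    ; *-comm = λ x y → pointwise λ n → ℚ.*-comm (seq x n) (seq y n)
    }
  }

*-inverseʳ : ∀ x (x#0 : x #0) → x * x ⁻¹⟨ x#0 ⟩ ≃ 1ℝ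
*-inverseʳ x (δ , 0<δ , N , h) = mk≃ λ ε 0<ε → N , λ n N≤n →
  subst (λ z → ℚ.∣ z ∣ ℚ.≤ ε) (sym (lem (seq x n) (seq x n ℚ.≟ 0ℚ) (h n N≤n))) (ℚ.<⇒≤ 0<ε)
  where
  lem : ∀ q (d : Dec (q ≡ 0ℚ)) → 0ℚ ℚ.+ δ ℚ.≤ ℚ.∣ q ∣ → q ℚ.* inverseℚ q d ℚ.- 1ℚ ≡ 0ℚ
  -- The dummy value of `inverseℚ` at 0 does not occur from N on, where the terms are at least δ in
  -- absolute value.
  lem q (yes refl) δ≤0 = contradiction (ℚ.<-≤-trans 0<δ (subst (ℚ._≤ 0ℚ) (ℚ.+-identityˡ δ) δ≤0)) (ℚ.<-irrefl refl)
  lem q (no q≢0)   _   = trans (cong (ℚ._- 1ℚ) (ℚ.*-inverseʳ q {{ℚ.≢-nonZero q≢0}})) (ℚ.+-inverseʳ 1ℚ)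

-- Binet's formula

5ℚ : ℚ
5ℚ = ιₙ 5

-- The n-th term is r / p with p = n + 1 and r² ≤ 5 p² < (r + 1)². Hence 0 ≤ 5 p² - r² ≤ 2 r ≤ 6 p,
-- as r ≤ 3 p, and dividing by p leaves the constant 6.
√5-seq²-bound : ∀ n → ℚ.∣ seq √5 n ℚ.* seq √5 n ℚ.- 5ℚ ∣ ℚ.* ιₙ (suc n) ℚ.≤ ιₙ 6
√5-seq²-bound n = *-cancelʳ-≤ {c = p} (0<ιₙ n) (begin
  ℚ.∣ s ℚ.* s ℚ.- 5ℚ ∣ ℚ.* p ℚ.* p                 ≡⟨ ℚ.*-assoc ℚ.∣ s ℚ.* s ℚ.- 5ℚ ∣ p p ⟩
  ℚ.∣ s ℚ.* s ℚ.- 5ℚ ∣ ℚ.* (p ℚ.* p)               ≡⟨ cong (ℚ.∣ s ℚ.* s ℚ.- 5ℚ ∣ ℚ.*_) (ℚ.0≤p⇒∣p∣≡p (0≤* (0≤ιₙ (suc n)) (0≤ιₙ (suc n)))) ⟨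
  ℚ.∣ s ℚ.* s ℚ.- 5ℚ ∣ ℚ.* ℚ.∣ p ℚ.* p ∣           ≡⟨ ℚ.∣p*q∣≡∣p∣*∣q∣ (s ℚ.* s ℚ.- 5ℚ) (p ℚ.* p) ⟨
  ℚ.∣ (s ℚ.* s ℚ.- 5ℚ) ℚ.* (p ℚ.* p) ∣             ≡⟨ cong ℚ.∣_∣ (lem s 5ℚ p) ⟩
  ℚ.∣ s ℚ.* p ℚ.* (s ℚ.* p) ℚ.- 5ℚ ℚ.* (p ℚ.* p) ∣ ≡⟨ cong ℚ.∣_∣ (cong₂ ℚ._-_ r²-eq 5p²-eq) ⟩
  ℚ.∣ ιₙ (r ℕ.* r) ℚ.- ιₙ (5 ℕ.* (p′ ℕ.* p′)) ∣    ≡⟨ ∣∣-swap (ιₙ (r ℕ.* r)) (ιₙ (5 ℕ.* (p′ ℕ.* p′))) ⟩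
  ℚ.∣ ιₙ (5 ℕ.* (p′ ℕ.* p′)) ℚ.- ιₙ (r ℕ.* r) ∣    ≤⟨ ∣∣-bound below above ⟩
  ιₙ (6 ℕ.* p′)                                    ≡⟨ ιₙ-* 6 p′ ⟩
  ιₙ 6 ℚ.* p                                       ∎)
  where
  open ℚ.≤-Reasoning
  p′ = suc n
  p  = ιₙ p′
  r  = √-num 5 n
  s  = seq √5 n
  lem : ∀ s f p → (s ℚ.* s ℚ.- f) ℚ.* (p ℚ.* p) ≡ s ℚ.* p ℚ.* (s ℚ.* p) ℚ.- f ℚ.* (p ℚ.* p)
  lem = RingSolver.solve-∀ ℚ-ring
  sp≡r : s ℚ.* p ≡ ιₙ r
  sp≡r = /-*-cancel (+ r) p′
  r²-eq : s ℚ.* p ℚ.* (s ℚ.* p) ≡ ιₙ (r ℕ.* r)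
  r²-eq = trans (cong₂ ℚ._*_ sp≡r sp≡r) (sym (ιₙ-* r r))
  5p²-eq : 5ℚ ℚ.* (p ℚ.* p) ≡ ιₙ (5 ℕ.* (p′ ℕ.* p′))
  5p²-eq = trans (cong (5ℚ ℚ.*_) (sym (ιₙ-* p′ p′))) (sym (ιₙ-* 5 (p′ ℕ.* p′)))
  r²≤ : r ℕ.* r ℕ.≤ 5 ℕ.* (p′ ℕ.* p′)
  r²≤ = ⌊√⌋-lower (5 ℕ.* (p′ ℕ.* p′))
  r≤3p : r ℕ.≤ 3 ℕ.* p′
  r≤3p = ℕ.≮⇒≥ λ 3p<r → ℕ.<⇒≱ (ℕ.*-mono-< 3p<r 3p<r)
    (ℕ.≤-trans r²≤ (subst (5 ℕ.* (p′ ℕ.* p′) ℕ.≤_) (e₁ p′) (ℕ.m≤m+n _ _)))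
    where
    e₁ : ∀ p → 5 ℕ.* (p ℕ.* p) ℕ.+ 4 ℕ.* (p ℕ.* p) ≡ 3 ℕ.* p ℕ.* (3 ℕ.* p)
    e₁ = ℕ-solve
  5p²≤ : 5 ℕ.* (p′ ℕ.* p′) ℕ.≤ 6 ℕ.* p′ ℕ.+ r ℕ.* r
  5p²≤ = ℕ.≤-trans (ℕ.s≤s⁻¹ (subst (5 ℕ.* (p′ ℕ.* p′) ℕ.<_) (e₂ r) (⌊√⌋-upper (5 ℕ.* (p′ ℕ.* p′)))))
    (ℕ.+-monoˡ-≤ (r ℕ.* r) (subst (2 ℕ.* r ℕ.≤_) (e₃ p′) (ℕ.*-monoʳ-≤ 2 r≤3p)))
    where
    e₂ : ∀ r → suc r ℕ.* suc r ≡ suc (2 ℕ.* r ℕ.+ r ℕ.* r)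
    e₂ = ℕ-solve
    e₃ : ∀ p → 2 ℕ.* (3 ℕ.* p) ≡ 6 ℕ.* p
    e₃ = ℕ-solve
  a≤b+c⇒a-c≤b : ∀ {a b c} → a ℚ.≤ b ℚ.+ c → a ℚ.- c ℚ.≤ b
  a≤b+c⇒a-c≤b {a} {b} {c} h = subst (a ℚ.- c ℚ.≤_) (e b c) (ℚ.+-monoˡ-≤ (ℚ.- c) h)
    where
    e : ∀ b c → b ℚ.+ c ℚ.- c ≡ b
    e = RingSolver.solve-∀ ℚ-ring
  below : ιₙ (5 ℕ.* (p′ ℕ.* p′)) ℚ.- ιₙ (r ℕ.* r) ℚ.≤ ιₙ (6 ℕ.* p′)
  below = a≤b+c⇒a-c≤b (subst (ιₙ (5 ℕ.* (p′ ℕ.* p′)) ℚ.≤_) (ι-+ (+ (6 ℕ.* p′)) (+ (r ℕ.* r))) (ιₙ-mono-≤ {5 ℕ.* (p′ ℕ.* p′)} {6 ℕ.* p′ ℕ.+ r ℕ.* r} 5p²≤))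
  above : ℚ.- (ιₙ (5 ℕ.* (p′ ℕ.* p′)) ℚ.- ιₙ (r ℕ.* r)) ℚ.≤ ιₙ (6 ℕ.* p′)
  above = subst (ℚ._≤ ιₙ (6 ℕ.* p′)) (e (ιₙ (r ℕ.* r)) (ιₙ (5 ℕ.* (p′ ℕ.* p′))))
    (a≤b+c⇒a-c≤b (ℚ.≤-trans (ιₙ-mono-≤ {r ℕ.* r} {5 ℕ.* (p′ ℕ.* p′)} r²≤) (subst (ℚ._≤ ιₙ (6 ℕ.* p′) ℚ.+ ιₙ (5 ℕ.* (p′ ℕ.* p′))) (ℚ.+-identityˡ _)
      (ℚ.+-monoˡ-≤ (ιₙ (5 ℕ.* (p′ ℕ.* p′))) (0≤ιₙ (6 ℕ.* p′))))))
    where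
    e : ∀ a b → a ℚ.- b ≡ ℚ.- (b ℚ.- a)
    e = RingSolver.solve-∀ ℚ-ring

√5²≃5 : √5 * √5 ≃ fromℚ 5ℚ
√5²≃5 = mk≃ (vanishing (λ n → ℚ.∣ seq √5 n ℚ.* seq √5 n ℚ.- 5ℚ ∣) 6 √5-seq²-bound)

triangle : ℕ → ℕ
triangle n = (n ℕ.* suc n) ℕ./ 2

triangle-suc : ∀ n → triangle (suc n) ≡ triangle n ℕ.+ suc n
triangle-suc n = trans (cong (ℕ._/ 2) (lem n)) (trans (ℕ.+-distrib-/-∣ʳ (n ℕ.* suc n) (n∣m*n (suc n)))
  (cong (triangle n ℕ.+_) (ℕ.m*n/n≡m (suc n) 2)))
  where
  lem : ∀ n → suc n ℕ.* suc (suc n) ≡ n ℕ.* suc n ℕ.+ suc n ℕ.* 2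
  lem = ℕ-solve

-- The argument is purely algebraic: it rests on the quadratic equations of the two roots, their
-- difference s and an inverse of s, and so is carried out in any commutative ring.
module Binet {c ℓ} (R : CommutativeRing c ℓ) where

  open CommutativeRing R
    renaming (_+_ to _⊕_; _*_ to _⊛_; refl to ≈-refl; sym to ≈-sym; trans to ≈-trans; *-cong to ⊛-cong; +-cong to ⊕-cong)
    hiding (-_; _-_)
  open ≈-Reasoning (CommutativeRing.setoid R)
  open Algebra.Solver.CommutativeMonoid *-commutativeMonoid using (solve; _⊜_) renaming (_⊕_ to _⊗_)

  pow : Carrier → ℕ → Carrier
  pow x zero    = 1#
  pow x (suc n) = pow x n ⊛ x

  prod : ℕ → (ℕ → Carrier) → Carrier
  prod zero    f = 1#
  prod (suc n) f = prod n f ⊛ f n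

  fib : ℕ → Carrier
  fib 0             = 0#
  fib 1             = 1#
  fib (suc (suc n)) = fib (suc n) ⊕ fib n

  pow-+ : ∀ x m n → pow x (m ℕ.+ n) ≈ pow x m ⊛ pow x n
  pow-+ x m zero    = subst (λ k → pow x k ≈ pow x m ⊛ 1#) (sym (ℕ.+-identityʳ m)) (≈-sym (*-identityʳ (pow x m)))
  pow-+ x m (suc n) = subst (λ k → pow x k ≈ pow x m ⊛ pow x (suc n)) (sym (ℕ.+-suc m n))
    (≈-trans (*-congʳ (pow-+ x m n)) (*-assoc (pow x m) (pow x n) x))

  pow-* : ∀ x y n → pow x n ⊛ pow y n ≈ pow (x ⊛ y) n
  pow-* x y zero    = *-identityʳ 1#
  pow-* x y (suc n) = ≈-trans
    (solve 4 (λ a x b y → (a ⊗ x) ⊗ (b ⊗ y) ⊜ (a ⊗ b) ⊗ (x ⊗ y)) ≈-refl (pow x n) x (pow y n) y)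
    (*-congʳ (pow-* x y n))

  pow-fibonacci : ∀ {x} → x ⊛ x ≈ x ⊕ 1# → ∀ n → pow x (suc (suc n)) ≈ pow x (suc n) ⊕ pow x n
  pow-fibonacci {x} h n = begin
    pow x n ⊛ x ⊛ x               ≈⟨ *-assoc (pow x n) x x ⟩
    pow x n ⊛ (x ⊛ x)             ≈⟨ *-congˡ h ⟩
    pow x n ⊛ (x ⊕ 1#)            ≈⟨ distribˡ (pow x n) x 1# ⟩
    pow x n ⊛ x ⊕ pow x n ⊛ 1#    ≈⟨ +-congˡ (*-identityʳ (pow x n)) ⟩
    pow x n ⊛ x ⊕ pow x n         ∎

  -- φ b plays the part of the conjugate root ψ = -1 / φ, and s that of √5 = φ - ψ. With b as the
  -- parameter, φⁿ - ψⁿ factors at once as φⁿ (1 - bⁿ).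
  module _ (φ b s s⁻¹ : Carrier)
           (φ² : φ ⊛ φ ≈ φ ⊕ 1#) (ψ² : φ ⊛ b ⊛ (φ ⊛ b) ≈ φ ⊛ b ⊕ 1#)
           (φ≈s+ψ : φ ≈ s ⊕ φ ⊛ b) (ss⁻¹ : s ⊛ s⁻¹ ≈ 1#) where

    private
      ψ : Carrier
      ψ = φ ⊛ b

    -- Both sides obey the Fibonacci recurrence and agree at 0 and 1. The additive form avoids
    -- negation; likewise 1 - bⁿ enters below as an element `d` that completes bⁿ to 1.
    binet : ∀ n → pow φ n ≈ s ⊛ fib n ⊕ pow ψ n
    binet 0 = ≈-sym (≈-trans (+-congʳ (zeroʳ s)) (+-identityˡ 1#))
    binet 1 = begin
      1# ⊛ φ                ≈⟨ *-identityˡ φ ⟩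
      φ                     ≈⟨ φ≈s+ψ ⟩
      s ⊕ ψ                 ≈⟨ ⊕-cong (*-identityʳ s) (*-identityˡ ψ) ⟨
      s ⊛ 1# ⊕ 1# ⊛ ψ       ∎
    binet (suc (suc n)) = begin
      pow φ (suc (suc n))
        ≈⟨ pow-fibonacci φ² n ⟩
      pow φ (suc n) ⊕ pow φ n
        ≈⟨ ⊕-cong (binet (suc n)) (binet n) ⟩
      (s ⊛ fib (suc n) ⊕ pow ψ (suc n)) ⊕ (s ⊛ fib n ⊕ pow ψ n)
        ≈⟨ +-interchange (s ⊛ fib (suc n)) (pow ψ (suc n)) (s ⊛ fib n) (pow ψ n) ⟩
      (s ⊛ fib (suc n) ⊕ s ⊛ fib n) ⊕ (pow ψ (suc n) ⊕ pow ψ n)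
        ≈⟨ ⊕-cong (distribˡ s (fib (suc n)) (fib n)) (pow-fibonacci ψ² n) ⟨
      s ⊛ fib (suc (suc n)) ⊕ pow ψ (suc (suc n)) ∎
      where
      open Algebra.Solver.CommutativeMonoid +-commutativeMonoid using () renaming (solve to solve⁺; _⊕_ to _⊞_; _⊜_ to _⊜⁺_)
      +-interchange : ∀ a b c d → (a ⊕ b) ⊕ (c ⊕ d) ≈ (a ⊕ c) ⊕ (b ⊕ d)
      +-interchange = solve⁺ 4 (λ a b c d → (a ⊞ b) ⊞ (c ⊞ d) ⊜⁺ (a ⊞ c) ⊞ (b ⊞ d)) ≈-refl

    fib≈ : ∀ n d → d ⊕ pow b n ≈ 1# → fib n ≈ pow φ n ⊛ s⁻¹ ⊛ d
    fib≈ n d d+b^n≈1 = begin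
      fib n                          ≈⟨ *-identityˡ (fib n) ⟨
      1# ⊛ fib n                     ≈⟨ *-congʳ ss⁻¹ ⟨
      s ⊛ s⁻¹ ⊛ fib n                ≈⟨ solve 3 (λ s t f → (s ⊗ t) ⊗ f ⊜ t ⊗ (s ⊗ f)) ≈-refl s s⁻¹ (fib n) ⟩
      s⁻¹ ⊛ (s ⊛ fib n)              ≈⟨ *-congˡ s*fib ⟩
      s⁻¹ ⊛ (pow φ n ⊛ d)            ≈⟨ solve 3 (λ t p d → t ⊗ (p ⊗ d) ⊜ (p ⊗ t) ⊗ d) ≈-refl s⁻¹ (pow φ n) d ⟩
      pow φ n ⊛ s⁻¹ ⊛ d              ∎
      where
      s*fib : s ⊛ fib n ≈ pow φ n ⊛ d
      s*fib = Algebra.Properties.Group.∙-cancelʳ +-group (pow ψ n) (s ⊛ fib n) (pow φ n ⊛ d) (begin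
        s ⊛ fib n ⊕ pow ψ n                    ≈⟨ binet n ⟨
        pow φ n                                ≈⟨ *-identityʳ (pow φ n) ⟨
        pow φ n ⊛ 1#                           ≈⟨ *-congˡ d+b^n≈1 ⟨
        pow φ n ⊛ (d ⊕ pow b n)                ≈⟨ distribˡ (pow φ n) d (pow b n) ⟩
        pow φ n ⊛ d ⊕ pow φ n ⊛ pow b n        ≈⟨ +-congˡ (pow-* φ b n) ⟩
        pow φ n ⊛ d ⊕ pow ψ n                  ∎)

    prod-fib : (d : ℕ → Carrier) → (∀ k → d k ⊕ pow b (suc k) ≈ 1#) →
      ∀ n → prod n (λ k → fib (suc k)) ≈ pow φ (triangle n) ⊛ pow s⁻¹ n ⊛ prod n d
    prod-fib d hd zero    = ≈-sym (≈-trans (*-identityʳ (1# ⊛ 1#)) (*-identityʳ 1#))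
    prod-fib d hd (suc n) = begin
      prod n (λ k → fib (suc k)) ⊛ fib (suc n)
        ≈⟨ ⊛-cong (prod-fib d hd n) (fib≈ (suc n) (d n) (hd n)) ⟩
      pow φ t ⊛ pow s⁻¹ n ⊛ prod n d ⊛ (pow φ (suc n) ⊛ s⁻¹ ⊛ d n)
        ≈⟨ solve 6 (λ a b c d e f → ((a ⊗ b) ⊗ c) ⊗ ((d ⊗ e) ⊗ f) ⊜ ((a ⊗ d) ⊗ (b ⊗ e)) ⊗ (c ⊗ f)) ≈-refl
             (pow φ t) (pow s⁻¹ n) (prod n d) (pow φ (suc n)) s⁻¹ (d n) ⟩
      pow φ t ⊛ pow φ (suc n) ⊛ pow s⁻¹ (suc n) ⊛ prod (suc n) d
        ≈⟨ *-congʳ (*-congʳ (pow-+ φ t (suc n))) ⟨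
      pow φ (t ℕ.+ suc n) ⊛ pow s⁻¹ (suc n) ⊛ prod (suc n) d
        ≡⟨ cong (λ k → pow φ k ⊛ pow s⁻¹ (suc n) ⊛ prod (suc n) d) (triangle-suc n) ⟨
      pow φ (triangle (suc n)) ⊛ pow s⁻¹ (suc n) ⊛ prod (suc n) d ∎
      where t = triangle n

φ²≃φ+1 : φ * φ ≃ φ + 1ℝ
φ²≃φ+1 = mk≃ (Null-cong (λ n → lem (seq √5 n)) (Null-* (difference-null √5²≃5) (fromℚ (½ ℚ.* ½))))
  where
  lem : ∀ s → (s ℚ.* s ℚ.- ιₙ 5) ℚ.* (½ ℚ.* ½) ≡ ½ ℚ.* (1ℚ ℚ.+ s) ℚ.* (½ ℚ.* (1ℚ ℚ.+ s)) ℚ.- (½ ℚ.* (1ℚ ℚ.+ s) ℚ.+ 1ℚ)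
  lem = RingSolver.solve-∀ ℚ-ring

φ⁻¹≃φ-1 : φ⁻¹ ≃ φ - 1ℝ
φ⁻¹≃φ-1 = mk≃ (Null-cong (λ n → lem (seq φ n) (seq φ⁻¹ n))
  (Null-+ (Null-* (difference-null φ²≃φ+1) (- φ⁻¹)) (Null-* (difference-null (*-inverseʳ φ φ#0)) (φ - 1ℝ))))
  where
  lem : ∀ x y → (x ℚ.* x ℚ.- (x ℚ.+ 1ℚ)) ℚ.* (ℚ.- y) ℚ.+ (x ℚ.* y ℚ.- 1ℚ) ℚ.* (x ℚ.- 1ℚ) ≡ y ℚ.- (x ℚ.- 1ℚ)
  lem = RingSolver.solve-∀ ℚ-ring

b≃φ-2 : b ≃ φ - fromℚ (ιₙ 2)
b≃φ-2 = mk≃ (Null-cong (λ n → lem (seq φ n) (seq φ⁻¹ n))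
  (Null-+ (Null-* (difference-null φ⁻¹≃φ-1) (- (φ⁻¹ + (φ - 1ℝ)))) (Null-* (difference-null φ²≃φ+1) (- 1ℝ))))
  where
  lem : ∀ x y → (y ℚ.- (x ℚ.- 1ℚ)) ℚ.* (ℚ.- (y ℚ.+ (x ℚ.- 1ℚ))) ℚ.+ (x ℚ.* x ℚ.- (x ℚ.+ 1ℚ)) ℚ.* (ℚ.- 1ℚ)
        ≡ ℚ.- (1ℚ ℚ.* y ℚ.* y) ℚ.- (x ℚ.- ιₙ 2)
  lem = RingSolver.solve-∀ ℚ-ring

φ*b≃1-φ : φ * b ≃ 1ℝ - φ
φ*b≃1-φ = mk≃ (Null-cong (λ n → lem (seq φ n) (seq b n)) (Null-+ (Null-* (difference-null b≃φ-2) φ) (difference-null φ²≃φ+1)))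
  where
  lem : ∀ x y → (y ℚ.- (x ℚ.- ιₙ 2)) ℚ.* x ℚ.+ (x ℚ.* x ℚ.- (x ℚ.+ 1ℚ)) ≡ x ℚ.* y ℚ.- (1ℚ ℚ.- x)
  lem = RingSolver.solve-∀ ℚ-ring

[φb]²≃φb+1 : φ * b * (φ * b) ≃ φ * b + 1ℝ
[φb]²≃φb+1 = mk≃ (Null-cong (λ n → lem (seq φ n) (seq φ n ℚ.* seq b n))
  (Null-+ (Null-* (difference-null φ*b≃1-φ) (φ * b - φ)) (difference-null φ²≃φ+1)))
  where
  lem : ∀ x w → (w ℚ.- (1ℚ ℚ.- x)) ℚ.* (w ℚ.- x) ℚ.+ (x ℚ.* x ℚ.- (x ℚ.+ 1ℚ)) ≡ w ℚ.* w ℚ.- (w ℚ.+ 1ℚ)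
  lem = RingSolver.solve-∀ ℚ-ring

φ≃√5+φb : φ ≃ √5 + φ * b
φ≃√5+φb = mk≃ (Null-cong (λ n → lem (seq √5 n) (seq φ n ℚ.* seq b n)) (Null-* (difference-null φ*b≃1-φ) (- 1ℝ)))
  where
  lem : ∀ s w → (w ℚ.- (1ℚ ℚ.- ½ ℚ.* (1ℚ ℚ.+ s))) ℚ.* (ℚ.- 1ℚ) ≡ ½ ℚ.* (1ℚ ℚ.+ s) ℚ.- (s ℚ.+ w)
  lem = RingSolver.solve-∀ ℚ-ring

open Binet ℝ-commutativeRing using (pow; prod; fib; prod-fib)

seq-pow : ∀ x k n → seq (pow x k) n ≡ seq (x ^ k) n
seq-pow x zero    n = refl
seq-pow x (suc k) n = cong (ℚ._* seq x n) (seq-pow x k n)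

seq-prod : ∀ k f n → seq (prod k f) n ≡ seq (∏ k f) n
seq-prod zero    f n = refl
seq-prod (suc k) f n = cong (ℚ._* seq (f k) n) (seq-prod k f n)

seq-fib : ∀ k n → seq (fib k) n ≡ ιₙ (F k)
seq-fib 0             n = refl
seq-fib 1             n = refl
seq-fib (suc (suc k)) n = trans (cong₂ ℚ._+_ (seq-fib (suc k) n) (seq-fib k n)) (sym (ι-+ (+ F (suc k)) (+ F k)))

seq-prod-fib : ∀ k n → seq (prod k λ i → fib (suc i)) n ≡ ιₙ (Fprod k)
seq-prod-fib zero    n = refl
seq-prod-fib (suc k) n = trans (cong₂ ℚ._*_ (seq-prod-fib k n) (seq-fib (suc k) n)) (sym (ιₙ-* (Fprod k) (F (suc k))))

Π : ℕ → ℝ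
Π n = ∏ n λ k → 1ℝ - b ^ suc k

Fprod≃ : ∀ n → fromℚ (ιₙ (Fprod n)) ≃ φ ^ ((n ℕ.* suc n) ℕ./ 2) * √5⁻¹ ^ n * Π n
Fprod≃ n = mk≃ (Null-cong
  (λ i → cong₂ ℚ._-_ (seq-prod-fib n i)
    (cong₂ ℚ._*_ (cong₂ ℚ._*_ (seq-pow φ (triangle n) i) (seq-pow √5⁻¹ n i)) (seq-prod n d i)))
  (difference-null (prod-fib φ b √5 √5⁻¹ (mk≃ (difference-null φ²≃φ+1)) (mk≃ (difference-null [φb]²≃φb+1))
    (mk≃ (difference-null φ≃√5+φb)) (mk≃ (difference-null (*-inverseʳ √5 √5#0))) d (λ k → mk≃ (complement k)) n)))
  where
  d : ℕ → ℝ
  d k = 1ℝ - b ^ suc k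
  lem : ∀ x → 1ℚ ℚ.- x ℚ.+ x ≡ 1ℚ
  lem = RingSolver.solve-∀ ℚ-ring
  complement : ∀ k → Null λ n → seq (d k) n ℚ.+ seq (pow b (suc k)) n ℚ.- 1ℚ
  complement k = difference-null {(d k) + pow b (suc k)} {1ℝ}
    (pointwise λ n → trans (cong (seq (d k) n ℚ.+_) (seq-pow b (suc k) n)) (lem (seq (b ^ suc k) n)))

*-cancelʳ-≡ : ∀ {a b c} → 0ℚ ℚ.< c → a ℚ.* c ≡ b ℚ.* c → a ≡ b
*-cancelʳ-≡ 0<c eq = ℚ.≤-antisym (*-cancelʳ-≤ 0<c (ℚ.≤-reflexive eq)) (*-cancelʳ-≤ 0<c (ℚ.≤-reflexive (sym eq)))

ι-∣∣ : ∀ i → ℚ.∣ ι i ∣ ≡ ιₙ ℤ.∣ i ∣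
ι-∣∣ (+ n)          = ℚ.0≤p⇒∣p∣≡p (0≤ιₙ n)
ι-∣∣ (ℤ.-[1+ n ])   = trans (ℚ.∣-p∣≡∣p∣ (ιₙ (suc n))) (ℚ.0≤p⇒∣p∣≡p (0≤ιₙ (suc n)))

-- The steps of `a` add up to at most g n - g m, and g m is nonnegative. The majorants will be
-- `tailS` and `tailQ`.
telescope : (a g : ℕ → ℚ) (n₀ : ℕ) →
  (∀ m → n₀ ℕ.≤ m → ℚ.∣ a (suc m) ℚ.- a m ∣ ℚ.≤ g m ℚ.- g (suc m)) → (∀ m → 0ℚ ℚ.≤ g m) →
  ∀ n m → n₀ ℕ.≤ n → n ℕ.≤ m → ℚ.∣ a m ℚ.- a n ∣ ℚ.≤ g n
telescope a g n₀ step 0≤g n m n₀≤n n≤m = ℚ.≤-trans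
  (subst (λ k → ℚ.∣ a k ℚ.- a n ∣ ℚ.≤ g n ℚ.- g k) (ℕ.m+[n∸m]≡n n≤m) (go (m ℕ.∸ n)))
  (subst (g n ℚ.- g m ℚ.≤_) (ℚ.+-identityʳ (g n)) (ℚ.+-monoʳ-≤ (g n) (ℚ.neg-antimono-≤ (0≤g m))))
  where
  lem : ∀ x y z → (x ℚ.- y) ℚ.+ (z ℚ.- x) ≡ z ℚ.- y
  lem = RingSolver.solve-∀ ℚ-ring
  go : ∀ k → ℚ.∣ a (n ℕ.+ k) ℚ.- a n ∣ ℚ.≤ g n ℚ.- g (n ℕ.+ k)
  go zero = subst (λ k → ℚ.∣ a k ℚ.- a n ∣ ℚ.≤ g n ℚ.- g k) (sym (ℕ.+-identityʳ n))
    (ℚ.≤-reflexive (trans (cong ℚ.∣_∣ (ℚ.+-inverseʳ (a n))) (sym (ℚ.+-inverseʳ (g n)))))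
  go (suc k) = subst (λ j → ℚ.∣ a j ℚ.- a n ∣ ℚ.≤ g n ℚ.- g j) (sym (ℕ.+-suc n k))
    (subst (ℚ.∣ a (suc (n ℕ.+ k)) ℚ.- a n ∣ ℚ.≤_) (lem (g (n ℕ.+ k)) (g (suc (n ℕ.+ k))) (g n))
      (∣∣-triangle (a (suc (n ℕ.+ k))) (a (n ℕ.+ k)) (a n) (step (n ℕ.+ k) (ℕ.≤-trans n₀≤n (ℕ.m≤m+n n k))) (go k)))

-- The sum of μ(k) / F k

recip : ℕ → ℚ
recip n = ℚ._/_ (+ 1) (F (suc n)) {{F-nonZero n}}

0<ιF : ∀ n → 0ℚ ℚ.< ιₙ (F (suc n))
0<ιF n = ℚ.<-≤-trans (ℚ.positive⁻¹ 1ℚ) (ιₙ-mono-≤ {1} {F (suc n)} (F-pos n))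

recip-* : ∀ n → recip n ℚ.* ιₙ (F (suc n)) ≡ 1ℚ
recip-* n = /-*-cancel (+ 1) (F (suc n)) {{F-nonZero n}}

0≤recip : ∀ n → 0ℚ ℚ.≤ recip n
0≤recip n = *-cancelʳ-≤ (0<ιF n) (subst₂ ℚ._≤_ (sym (ℚ.*-zeroˡ (ιₙ (F (suc n))))) (sym (recip-* n)) (ℚ.<⇒≤ (ℚ.positive⁻¹ 1ℚ)))

F-mono : ∀ n → F n ℕ.≤ F (suc n)
F-mono zero    = ℕ.z≤n
F-mono (suc n) = ℕ.m≤m+n (F (suc n)) (F n)

3F≤2F : ∀ n → 3 ℕ.* F (suc (suc n)) ℕ.≤ 2 ℕ.* F (suc (suc (suc n)))
3F≤2F n = subst₂ ℕ._≤_ (lem (F (suc n)) (F n)) (lem′ (F (suc n)) (F n))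
  (ℕ.+-monoʳ-≤ (3 ℕ.* F (suc n) ℕ.+ 2 ℕ.* F n) (F-mono n))
  where
  lem : ∀ x y → 3 ℕ.* x ℕ.+ 2 ℕ.* y ℕ.+ y ≡ 3 ℕ.* (x ℕ.+ y)
  lem = ℕ-solve
  lem′ : ∀ x y → 3 ℕ.* x ℕ.+ 2 ℕ.* y ℕ.+ x ≡ 2 ℕ.* (x ℕ.+ y ℕ.+ x)
  lem′ = ℕ-solve

-- The linear growth that `vanishing` asks for.
n<2F : ∀ n → suc n ℕ.≤ 2 ℕ.* F (suc n)
n<2F 0             = ℕ.s≤s ℕ.z≤n
n<2F 1             = ℕ.s≤s (ℕ.s≤s ℕ.z≤n)
n<2F (suc (suc n)) = subst₂ ℕ._≤_ (ℕ.+-comm (suc (suc n)) 1) (sym (ℕ.*-distribˡ-+ 2 (F (suc (suc n))) (F (suc n))))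
  (ℕ.+-mono-≤ (n<2F (suc n)) (ℕ.≤-trans (F-pos n) (ℕ.m≤m+n (F (suc n)) _)))

-- From F₂ on the Fibonacci numbers grow by a factor of at least 3/2, so the reciprocals are
-- dominated by a geometric series of ratio 2/3, and 3 = 1 / (1 - 2/3).
tailS : ℕ → ℚ
tailS n = ιₙ 3 ℚ.* recip n

0≤tailS : ∀ n → 0ℚ ℚ.≤ tailS n
0≤tailS n = 0≤* (0≤ιₙ 3) (0≤recip n)

tailS-step : ∀ n → recip (suc n) ℚ.≤ tailS (suc n) ℚ.- tailS (suc (suc n))
tailS-step n = begin
  u                                    ≡⟨ lem u ⟩
  ιₙ 3 ℚ.* u ℚ.- ιₙ 2 ℚ.* u            ≤⟨ ℚ.+-monoʳ-≤ (ιₙ 3 ℚ.* u) (ℚ.neg-antimono-≤ 3v≤2u) ⟩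
  ιₙ 3 ℚ.* u ℚ.- ιₙ 3 ℚ.* v            ∎
  where
  open ℚ.≤-Reasoning
  u = recip (suc n)
  v = recip (suc (suc n))
  x = ιₙ (F (suc (suc n)))
  y = ιₙ (F (suc (suc (suc n))))
  lem : ∀ u → u ≡ ιₙ 3 ℚ.* u ℚ.- ιₙ 2 ℚ.* u
  lem = RingSolver.solve-∀ ℚ-ring
  lem₁ : ∀ c v x y → c ℚ.* v ℚ.* (x ℚ.* y) ≡ v ℚ.* y ℚ.* (c ℚ.* x)
  lem₁ = RingSolver.solve-∀ ℚ-ring
  lem₂ : ∀ c u x y → c ℚ.* u ℚ.* (x ℚ.* y) ≡ u ℚ.* x ℚ.* (c ℚ.* y)
  lem₂ = RingSolver.solve-∀ ℚ-ring
  3v≤2u : ιₙ 3 ℚ.* v ℚ.≤ ιₙ 2 ℚ.* u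
  3v≤2u = *-cancelʳ-≤ (0<* (0<ιF (suc n)) (0<ιF (suc (suc n)))) (begin
    ιₙ 3 ℚ.* v ℚ.* (x ℚ.* y)                    ≡⟨ lem₁ (ιₙ 3) v x y ⟩
    v ℚ.* y ℚ.* (ιₙ 3 ℚ.* x)                    ≡⟨ cong₂ ℚ._*_ (recip-* (suc (suc n))) (sym (ιₙ-* 3 (F (suc (suc n))))) ⟩
    1ℚ ℚ.* ιₙ (3 ℕ.* F (suc (suc n)))           ≤⟨ ≤-*ˡ {1ℚ} (ℚ.<⇒≤ (ℚ.positive⁻¹ 1ℚ)) (ιₙ-mono-≤ {3 ℕ.* F (suc (suc n))} {2 ℕ.* F (suc (suc (suc n)))} (3F≤2F n)) ⟩
    1ℚ ℚ.* ιₙ (2 ℕ.* F (suc (suc (suc n))))     ≡⟨ cong₂ ℚ._*_ (recip-* (suc n)) (sym (ιₙ-* 2 (F (suc (suc (suc n)))))) ⟨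
    u ℚ.* x ℚ.* (ιₙ 2 ℚ.* y)                    ≡⟨ lem₂ (ιₙ 2) u x y ⟨
    ιₙ 2 ℚ.* u ℚ.* (x ℚ.* y)                    ∎)

/≡ι* : ∀ i n .{{_ : NonZero n}} → i ℚ./ n ≡ ι i ℚ.* (+ 1 ℚ./ n)
/≡ι* i n@(suc k) = *-cancelʳ-≡ (0<ιₙ k) (trans (/-*-cancel i n) (sym
  (trans (ℚ.*-assoc (ι i) (+ 1 ℚ./ n) (ιₙ n)) (trans (cong (ι i ℚ.*_) (/-*-cancel (+ 1) n)) (ℚ.*-identityʳ (ι i))))))

-- m = 0 is excluded because F₁ = F₂, so that `tailS` does not decrease there.
S-step : ∀ m → 1 ℕ.≤ m → ℚ.∣ S (suc m) ℚ.- S m ∣ ℚ.≤ tailS m ℚ.- tailS (suc m)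
S-step (suc m) _ = begin
  ℚ.∣ S n ℚ.+ t ℚ.- S n ∣                     ≡⟨ cong ℚ.∣_∣ (lem (S n) t) ⟩
  ℚ.∣ t ∣                                     ≡⟨ cong ℚ.∣_∣ (/≡ι* (μ (suc n)) (F (suc n)) {{F-nonZero n}}) ⟩
  ℚ.∣ ι (μ (suc n)) ℚ.* recip n ∣             ≤⟨ ∣∣-* {ι (μ (suc n))} {recip n} {1ℚ} ∣μ∣ (ℚ.≤-reflexive (ℚ.0≤p⇒∣p∣≡p (0≤recip n))) ⟩
  1ℚ ℚ.* recip n                              ≡⟨ ℚ.*-identityˡ (recip n) ⟩
  recip n                                     ≤⟨ tailS-step m ⟩
  tailS n ℚ.- tailS (suc n)                   ∎
  where
  open ℚ.≤-Reasoning
  n = suc m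
  t = ℚ._/_ (μ (suc n)) (F (suc n)) {{F-nonZero n}}
  lem : ∀ a t → a ℚ.+ t ℚ.- a ≡ t
  lem = RingSolver.solve-∀ ℚ-ring
  ∣μ∣ : ℚ.∣ ι (μ (suc n)) ∣ ℚ.≤ 1ℚ
  ∣μ∣ = subst (ℚ._≤ 1ℚ) (sym (ι-∣∣ (μ (suc n)))) (ιₙ-mono-≤ {ℤ.∣ μ (suc n) ∣} {1} (∣μ∣≤1 (suc n)))

S-tail : ∀ n m → 1 ℕ.≤ n → n ℕ.≤ m → ℚ.∣ S m ℚ.- S n ∣ ℚ.≤ tailS n
S-tail = telescope S tailS 1 S-step 0≤tailS

tailS-vanishing : ∀ ε → 0ℚ ℚ.< ε → ∃[ N ] (∀ n → N ℕ.≤ n → tailS n ℚ.≤ ε)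
tailS-vanishing = vanishing tailS 6 λ n → begin
  ιₙ 3 ℚ.* recip n ℚ.* ιₙ (suc n)                    ≤⟨ ≤-*ˡ (0≤tailS n) (ιₙ-mono-≤ {suc n} {2 ℕ.* F (suc n)} (n<2F n)) ⟩
  ιₙ 3 ℚ.* recip n ℚ.* ιₙ (2 ℕ.* F (suc n))          ≡⟨ cong (ιₙ 3 ℚ.* recip n ℚ.*_) (ιₙ-* 2 (F (suc n))) ⟩
  ιₙ 3 ℚ.* recip n ℚ.* (ιₙ 2 ℚ.* ιₙ (F (suc n)))     ≡⟨ lem (recip n) (ιₙ (F (suc n))) ⟩
  ιₙ 6 ℚ.* (recip n ℚ.* ιₙ (F (suc n)))              ≡⟨ cong (ιₙ 6 ℚ.*_) (recip-* n) ⟩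
  ιₙ 6 ℚ.* 1ℚ                                        ≡⟨ ℚ.*-identityʳ (ιₙ 6) ⟩
  ιₙ 6                                               ∎
  where
  open ℚ.≤-Reasoning
  lem : ∀ r f → ιₙ 3 ℚ.* r ℚ.* (ιₙ 2 ℚ.* f) ≡ ιₙ 6 ℚ.* (r ℚ.* f)
  lem = RingSolver.solve-∀ ℚ-ring

tail⇒cauchy : (a g : ℕ → ℚ) (n₀ : ℕ) → (∀ n m → n₀ ℕ.≤ n → n ℕ.≤ m → ℚ.∣ a m ℚ.- a n ∣ ℚ.≤ g n) →
  (∀ ε → 0ℚ ℚ.< ε → ∃[ N ] (∀ n → N ℕ.≤ n → g n ℚ.≤ ε)) → IsCauchy a
tail⇒cauchy a g n₀ tail g-vanishing ε 0<ε =
  let (N , f) = g-vanishing (½ ℚ.* (½ ℚ.* ε)) (0<½ (0<½ 0<ε))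
      K = n₀ ℕ.⊔ N
      near = λ m K≤m → ℚ.≤-trans (tail K m (ℕ.m≤m⊔n n₀ N) K≤m) (f K (ℕ.m≤n⊔m n₀ N)) in
  K , λ m n K≤m K≤n → ℚ.≤-<-trans
    (subst (_ ℚ.≤_) (½-+ (½ ℚ.* ε)) (∣∣-triangle (a m) (a K) (a n) (near m K≤m) (subst (ℚ._≤ _) (∣∣-swap (a n) (a K)) (near n K≤n))))
    (½ε<ε 0<ε)

C : ℝ
C = mkℝ S (tail⇒cauchy S tailS 1 S-tail tailS-vanishing)

-- The product of 1 - bᵏ

powℚ : ℚ → ℕ → ℚ
powℚ q zero    = 1ℚ
powℚ q (suc n) = powℚ q n ℚ.* q

Q : ℕ → ℚ → ℚ
Q zero    β = 1ℚ
Q (suc n) β = Q n β ℚ.* (1ℚ ℚ.- powℚ β (suc n))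

-- A bound for the absolute value 0.3819... of b, with room for its approximations.
⅖ : ℚ
⅖ = + 2 ℚ./ 5

0≤pow⅖ : ∀ n → 0ℚ ℚ.≤ powℚ ⅖ n
0≤pow⅖ zero    = ℚ.<⇒≤ (ℚ.positive⁻¹ 1ℚ)
0≤pow⅖ (suc n) = 0≤* (0≤pow⅖ n) (ℚ.<⇒≤ (ℚ.positive⁻¹ ⅖))

-- As the products are bounded by 3, the step at m is at most 3 (2/5)^(m + 1), and 3 (2/5) / (1 -
-- 2/5) = 2.
tailQ : ℕ → ℚ
tailQ n = ιₙ 2 ℚ.* powℚ ⅖ n

0≤tailQ : ∀ n → 0ℚ ℚ.≤ tailQ n
0≤tailQ n = 0≤* (0≤ιₙ 2) (0≤pow⅖ n)

tailQ-vanishing : ∀ ε → 0ℚ ℚ.< ε → ∃[ N ] (∀ n → N ℕ.≤ n → tailQ n ℚ.≤ ε)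
tailQ-vanishing = vanishing tailQ 2 λ n → begin
  ιₙ 2 ℚ.* powℚ ⅖ n ℚ.* ιₙ (suc n)      ≡⟨ ℚ.*-assoc (ιₙ 2) (powℚ ⅖ n) (ιₙ (suc n)) ⟩
  ιₙ 2 ℚ.* (powℚ ⅖ n ℚ.* ιₙ (suc n))    ≤⟨ ≤-*ˡ (0≤ιₙ 2) (go n) ⟩
  ιₙ 2 ℚ.* 1ℚ                           ≡⟨ ℚ.*-identityʳ (ιₙ 2) ⟩
  ιₙ 2                                  ∎
  where
  open ℚ.≤-Reasoning
  step : ∀ n → ⅖ ℚ.* ιₙ (suc (suc n)) ℚ.≤ ιₙ (suc n)
  step n = *-cancelʳ-≤ {c = ιₙ 5} (0<ιₙ 4) (begin
    ⅖ ℚ.* ιₙ (suc (suc n)) ℚ.* ιₙ 5     ≡⟨ lem (ιₙ (suc (suc n))) ⟩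
    ιₙ 2 ℚ.* ιₙ (suc (suc n))           ≡⟨ ιₙ-* 2 (suc (suc n)) ⟨
    ιₙ (2 ℕ.* suc (suc n))              ≤⟨ ιₙ-mono-≤ {2 ℕ.* suc (suc n)} {suc n ℕ.* 5} (subst (2 ℕ.* suc (suc n) ℕ.≤_) (lem′ n) (ℕ.m≤m+n _ _)) ⟩
    ιₙ (suc n ℕ.* 5)                    ≡⟨ ιₙ-* (suc n) 5 ⟩
    ιₙ (suc n) ℚ.* ιₙ 5                 ∎)
    where
    lem : ∀ x → ⅖ ℚ.* x ℚ.* ιₙ 5 ≡ ιₙ 2 ℚ.* x
    lem = RingSolver.solve-∀ ℚ-ring
    lem′ : ∀ n → 2 ℕ.* suc (suc n) ℕ.+ (3 ℕ.* n ℕ.+ 1) ≡ suc n ℕ.* 5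
    lem′ = ℕ-solve
  go : ∀ n → powℚ ⅖ n ℚ.* ιₙ (suc n) ℚ.≤ 1ℚ
  go zero    = ℚ.≤-refl
  go (suc n) = begin
    powℚ ⅖ n ℚ.* ⅖ ℚ.* ιₙ (suc (suc n))      ≡⟨ ℚ.*-assoc (powℚ ⅖ n) ⅖ (ιₙ (suc (suc n))) ⟩
    powℚ ⅖ n ℚ.* (⅖ ℚ.* ιₙ (suc (suc n)))    ≤⟨ ≤-*ˡ (0≤pow⅖ n) (step n) ⟩
    powℚ ⅖ n ℚ.* ιₙ (suc n)                  ≤⟨ go n ⟩
    1ℚ                                       ∎

module _ {β} (∣β∣≤⅖ : ℚ.∣ β ∣ ℚ.≤ ⅖) where

  ∣powℚ∣≤ : ∀ n → ℚ.∣ powℚ β n ∣ ℚ.≤ powℚ ⅖ n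
  ∣powℚ∣≤ zero    = ℚ.≤-refl
  ∣powℚ∣≤ (suc n) = ∣∣-* {powℚ β n} {β} (∣powℚ∣≤ n) ∣β∣≤⅖

  -- The induction closes because (3 - 2ρ) (1 + ⅖ ρ) ≤ 3 - 2 (⅖ ρ).
  ∣Q∣≤3-tailQ : ∀ n → ℚ.∣ Q n β ∣ ℚ.≤ ιₙ 3 ℚ.- tailQ n
  ∣Q∣≤3-tailQ zero    = from-yes (1ℚ ℚ.≤? ιₙ 3 ℚ.- ιₙ 2 ℚ.* 1ℚ)
  ∣Q∣≤3-tailQ (suc n) = begin
    ℚ.∣ Q n β ℚ.* (1ℚ ℚ.- powℚ β (suc n)) ∣
      ≤⟨ ∣∣-* {Q n β} {1ℚ ℚ.- powℚ β (suc n)} (∣Q∣≤3-tailQ n)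
           (∣∣-+ {1ℚ} {ℚ.- powℚ β (suc n)} {1ℚ} ℚ.≤-refl (subst (ℚ._≤ powℚ ⅖ (suc n)) (sym (ℚ.∣-p∣≡∣p∣ (powℚ β (suc n)))) (∣powℚ∣≤ (suc n)))) ⟩
    (ιₙ 3 ℚ.- ιₙ 2 ℚ.* ρ) ℚ.* (1ℚ ℚ.+ ρ ℚ.* ⅖)
      ≡⟨ lem ρ ⟩
    ιₙ 3 ℚ.- ιₙ 2 ℚ.* (ρ ℚ.* ⅖) ℚ.- ρ ℚ.* ρ ℚ.* (ιₙ 2 ℚ.* ⅖)
      ≤⟨ ℚ.+-monoʳ-≤ (ιₙ 3 ℚ.- ιₙ 2 ℚ.* (ρ ℚ.* ⅖)) (ℚ.neg-antimono-≤ (0≤* (0≤* (0≤pow⅖ n) (0≤pow⅖ n)) (ℚ.<⇒≤ (ℚ.positive⁻¹ (ιₙ 2 ℚ.* ⅖))))) ⟩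
    ιₙ 3 ℚ.- ιₙ 2 ℚ.* (ρ ℚ.* ⅖) ℚ.+ 0ℚ
      ≡⟨ ℚ.+-identityʳ _ ⟩
    ιₙ 3 ℚ.- ιₙ 2 ℚ.* (ρ ℚ.* ⅖) ∎
    where
    open ℚ.≤-Reasoning
    ρ = powℚ ⅖ n
    lem : ∀ ρ → (ιₙ 3 ℚ.- ιₙ 2 ℚ.* ρ) ℚ.* (1ℚ ℚ.+ ρ ℚ.* ⅖) ≡ ιₙ 3 ℚ.- ιₙ 2 ℚ.* (ρ ℚ.* ⅖) ℚ.- ρ ℚ.* ρ ℚ.* (ιₙ 2 ℚ.* ⅖)
    lem = RingSolver.solve-∀ ℚ-ring

  ∣Q∣≤3 : ∀ n → ℚ.∣ Q n β ∣ ℚ.≤ ιₙ 3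
  ∣Q∣≤3 n = ℚ.≤-trans (∣Q∣≤3-tailQ n) (subst (ιₙ 3 ℚ.- tailQ n ℚ.≤_) (ℚ.+-identityʳ (ιₙ 3))
    (ℚ.+-monoʳ-≤ (ιₙ 3) (ℚ.neg-antimono-≤ (0≤tailQ n))))

  Q-step : ∀ m → 0 ℕ.≤ m → ℚ.∣ Q (suc m) β ℚ.- Q m β ∣ ℚ.≤ tailQ m ℚ.- tailQ (suc m)
  Q-step m _ = begin
    ℚ.∣ Q m β ℚ.* (1ℚ ℚ.- powℚ β (suc m)) ℚ.- Q m β ∣   ≡⟨ cong ℚ.∣_∣ (lem (Q m β) (powℚ β (suc m))) ⟩
    ℚ.∣ ℚ.- (Q m β ℚ.* powℚ β (suc m)) ∣                ≡⟨ ℚ.∣-p∣≡∣p∣ (Q m β ℚ.* powℚ β (suc m)) ⟩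
    ℚ.∣ Q m β ℚ.* powℚ β (suc m) ∣                      ≤⟨ ∣∣-* {Q m β} {powℚ β (suc m)} (∣Q∣≤3 m) (∣powℚ∣≤ (suc m)) ⟩
    ιₙ 3 ℚ.* (powℚ ⅖ m ℚ.* ⅖)                           ≡⟨ lem′ (powℚ ⅖ m) ⟩
    tailQ m ℚ.- tailQ (suc m)                           ∎
    where
    open ℚ.≤-Reasoning
    lem : ∀ q x → q ℚ.* (1ℚ ℚ.- x) ℚ.- q ≡ ℚ.- (q ℚ.* x)
    lem = RingSolver.solve-∀ ℚ-ring
    lem′ : ∀ ρ → ιₙ 3 ℚ.* (ρ ℚ.* ⅖) ≡ ιₙ 2 ℚ.* ρ ℚ.- ιₙ 2 ℚ.* (ρ ℚ.* ⅖)
    lem′ = RingSolver.solve-∀ ℚ-ring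

  Q-tail : ∀ n m → n ℕ.≤ m → ℚ.∣ Q m β ℚ.- Q n β ∣ ℚ.≤ tailQ n
  Q-tail n m n≤m = telescope (λ k → Q k β) tailQ 0 Q-step 0≤tailQ n m ℕ.z≤n n≤m

-- Numerical bounds

floor-error : ∀ i n .{{_ : NonZero n}} → ℚ.∣ i ℚ./ n ℚ.- ι (i /ℕ n) ∣ ℚ.≤ 1ℚ
floor-error i n@(suc k) = *-cancelʳ-≤ (0<ιₙ k) (begin
  ℚ.∣ x ℚ.- ι q ∣ ℚ.* ιₙ n             ≡⟨ cong (ℚ.∣ x ℚ.- ι q ∣ ℚ.*_) (ℚ.0≤p⇒∣p∣≡p (0≤ιₙ n)) ⟨
  ℚ.∣ x ℚ.- ι q ∣ ℚ.* ℚ.∣ ιₙ n ∣       ≡⟨ ℚ.∣p*q∣≡∣p∣*∣q∣ (x ℚ.- ι q) (ιₙ n) ⟨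
  ℚ.∣ (x ℚ.- ι q) ℚ.* ιₙ n ∣           ≡⟨ cong ℚ.∣_∣ (lem x (ι q) (ιₙ n)) ⟩
  ℚ.∣ x ℚ.* ιₙ n ℚ.- ι q ℚ.* ιₙ n ∣    ≡⟨ cong (λ z → ℚ.∣ z ℚ.- ι q ℚ.* ιₙ n ∣) xn ⟩
  ℚ.∣ ιₙ r ℚ.+ ι q ℚ.* ιₙ n ℚ.- ι q ℚ.* ιₙ n ∣  ≡⟨ cong ℚ.∣_∣ (lem′ (ιₙ r) (ι q ℚ.* ιₙ n)) ⟩
  ℚ.∣ ιₙ r ∣                           ≡⟨ ℚ.0≤p⇒∣p∣≡p (0≤ιₙ r) ⟩
  ιₙ r                                 ≤⟨ ιₙ-mono-≤ {r} {n} (ℕ.<⇒≤ (ℤ.n%ℕd<d i n)) ⟩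
  ιₙ n                                 ≡⟨ ℚ.*-identityˡ (ιₙ n) ⟨
  1ℚ ℚ.* ιₙ n                          ∎)
  where
  open ℚ.≤-Reasoning
  x = i ℚ./ n
  q = i /ℕ n
  r = i %ℕ n
  lem : ∀ a b c → (a ℚ.- b) ℚ.* c ≡ a ℚ.* c ℚ.- b ℚ.* c
  lem = RingSolver.solve-∀ ℚ-ring
  lem′ : ∀ a b → a ℚ.+ b ℚ.- b ≡ a
  lem′ = RingSolver.solve-∀ ℚ-ring
  xn : x ℚ.* ιₙ n ≡ ιₙ r ℚ.+ ι q ℚ.* ιₙ n
  xn = trans (/-*-cancel i n) (trans (cong ι (ℤ.a≡a%ℕn+[a/ℕn]*n i n))
    (trans (ι-+ (+ r) (q ℤ.* + n)) (cong (ιₙ r ℚ.+_) (ι-* q (+ n)))))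

-- The scale of the fixed-point arithmetic: an integer a stands for a / 10²⁰. The accuracy `nano` is
-- then 10¹¹ units, far above the 9 ⋅ 10⁸ units to which `∏-error` grows in 26 steps.
D : ℕ
D = 100000000000000000000

u : ℚ
u = + 1 ℚ./ D

u*D : u ℚ.* ιₙ D ≡ 1ℚ
u*D = /-*-cancel (+ 1) D

0≤u : 0ℚ ℚ.≤ u
0≤u = from-yes (0ℚ ℚ.≤? u)

floor-error-u : ∀ i → ℚ.∣ ι i ℚ.* u ℚ.* u ℚ.- ι (i /ℕ D) ℚ.* u ∣ ℚ.≤ u
floor-error-u i = subst₂ ℚ._≤_ (cong ℚ.∣_∣ (lem (ι i ℚ.* u) (ι (i /ℕ D)) u)) (ℚ.*-identityˡ u)
  (∣∣-* {ι i ℚ.* u ℚ.- ι (i /ℕ D)} {u} {1ℚ}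
    (subst (λ z → ℚ.∣ z ℚ.- ι (i /ℕ D) ∣ ℚ.≤ 1ℚ) (/≡ι* i D) (floor-error i D)) (ℚ.≤-reflexive (ℚ.0≤p⇒∣p∣≡p 0≤u)))
  where
  lem : ∀ a b c → (a ℚ.- b) ℚ.* c ≡ a ℚ.* c ℚ.- b ℚ.* c
  lem = RingSolver.solve-∀ ℚ-ring

-- Fixed-point evaluation of S; the pair of Fibonacci numbers is carried along because F k
-- itself takes exponentially many reduction steps.

∑-fixed-step : ℕ → ℤ × ℕ × ℕ → ℤ × ℕ × ℕ
∑-fixed-step k (a , f , zero)       = a , f , zero
∑-fixed-step k (a , f , f′@(suc _)) = a ℤ.+ (μ (suc k) ℤ.* + D) /ℕ f′ , f′ , f′ ℕ.+ f

∑-fixed : ℕ → ℤ × ℕ × ℕ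
∑-fixed zero    = 0ℤ , 0 , 1
∑-fixed (suc k) = ∑-fixed-step k (∑-fixed k)

S-fixed : ℕ → ℤ
S-fixed zero    = 0ℤ
S-fixed (suc k) = S-fixed k ℤ.+ _/ℕ_ (μ (suc k) ℤ.* + D) (F (suc k)) {{F-nonZero k}}

∑-fixed≡ : ∀ k → ∑-fixed k ≡ (S-fixed k , F k , F (suc k))
∑-fixed≡ zero    = refl
∑-fixed≡ (suc k) = trans (cong (∑-fixed-step k) (∑-fixed≡ k)) (lem (F (suc k)) {{F-nonZero k}})
  where
  -- `∑-fixed-step` matches on the carried Fibonacci number, so `F (suc k)` is replaced by a
  -- variable known to be nonzero; its branch for 0 is never taken.
  lem : ∀ f′ .{{_ : NonZero f′}} → ∑-fixed-step k (S-fixed k , F k , f′) ≡ (S-fixed k ℤ.+ (μ (suc k) ℤ.* + D) /ℕ f′ , f′ , f′ ℕ.+ F k)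
  lem (suc _) = refl

-- Each term is rounded once, at a cost of at most one unit.
S-fixed-near : ∀ k → ℚ.∣ S k ℚ.- ι (S-fixed k) ℚ.* u ∣ ℚ.≤ ιₙ k ℚ.* u
S-fixed-near zero    = ℚ.≤-reflexive (trans (cong (λ z → ℚ.∣ 0ℚ ℚ.- z ∣) (ℚ.*-zeroˡ u)) (sym (ℚ.*-zeroˡ u)))
S-fixed-near (suc k) = begin
  ℚ.∣ S k ℚ.+ t ℚ.- ι (S-fixed k ℤ.+ q) ℚ.* u ∣
    ≡⟨ cong₂ (λ z z′ → ℚ.∣ S k ℚ.+ z ℚ.- z′ ℚ.* u ∣) t≡ (ι-+ (S-fixed k) q) ⟩
  ℚ.∣ S k ℚ.+ t′ ℚ.* u ℚ.- (ι (S-fixed k) ℚ.+ ι q) ℚ.* u ∣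
    ≡⟨ cong ℚ.∣_∣ (lem (S k) t′ (ι (S-fixed k)) (ι q) u) ⟩
  ℚ.∣ (S k ℚ.- ι (S-fixed k) ℚ.* u) ℚ.+ (t′ ℚ.- ι q) ℚ.* u ∣
    ≤⟨ ∣∣-+ {S k ℚ.- ι (S-fixed k) ℚ.* u} {(t′ ℚ.- ι q) ℚ.* u} (S-fixed-near k)
         (∣∣-* {t′ ℚ.- ι q} {u} (floor-error (μ (suc k) ℤ.* + D) (F (suc k)) {{F-nonZero k}})
           (ℚ.≤-reflexive (ℚ.0≤p⇒∣p∣≡p 0≤u))) ⟩
  ιₙ k ℚ.* u ℚ.+ 1ℚ ℚ.* u
    ≡⟨ ℚ.*-distribʳ-+ u (ιₙ k) 1ℚ ⟨
  (ιₙ k ℚ.+ 1ℚ) ℚ.* u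
    ≡⟨ cong (ℚ._* u) (trans (ℚ.+-comm (ιₙ k) 1ℚ) (sym (ι-+ (+ 1) (+ k)))) ⟩
  ιₙ (suc k) ℚ.* u ∎
  where
  open ℚ.≤-Reasoning
  t  = ℚ._/_ (μ (suc k)) (F (suc k)) {{F-nonZero k}}
  t′ = ℚ._/_ (μ (suc k) ℤ.* + D) (F (suc k)) {{F-nonZero k}}
  q  = _/ℕ_ (μ (suc k) ℤ.* + D) (F (suc k)) {{F-nonZero k}}
  lem : ∀ s t a q u → s ℚ.+ t ℚ.* u ℚ.- (a ℚ.+ q) ℚ.* u ≡ (s ℚ.- a ℚ.* u) ℚ.+ (t ℚ.- q) ℚ.* u
  lem = RingSolver.solve-∀ ℚ-ring
  lem′ : ∀ m d r u → m ℚ.* d ℚ.* r ℚ.* u ≡ m ℚ.* r ℚ.* (u ℚ.* d)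
  lem′ = RingSolver.solve-∀ ℚ-ring
  t≡ : t ≡ t′ ℚ.* u
  t≡ = sym (begin-equality
    t′ ℚ.* u                                          ≡⟨ cong (ℚ._* u) (/≡ι* (μ (suc k) ℤ.* + D) (F (suc k)) {{F-nonZero k}}) ⟩
    ι (μ (suc k) ℤ.* + D) ℚ.* recip k ℚ.* u           ≡⟨ cong (λ z → z ℚ.* recip k ℚ.* u) (ι-* (μ (suc k)) (+ D)) ⟩
    ι (μ (suc k)) ℚ.* ιₙ D ℚ.* recip k ℚ.* u          ≡⟨ lem′ (ι (μ (suc k))) (ιₙ D) (recip k) u ⟩
    ι (μ (suc k)) ℚ.* recip k ℚ.* (u ℚ.* ιₙ D)        ≡⟨ cong (ι (μ (suc k)) ℚ.* recip k ℚ.*_) u*D ⟩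
    ι (μ (suc k)) ℚ.* recip k ℚ.* 1ℚ                  ≡⟨ ℚ.*-identityʳ _ ⟩
    ι (μ (suc k)) ℚ.* recip k                         ≡⟨ /≡ι* (μ (suc k)) (F (suc k)) {{F-nonZero k}} ⟨
    t                                                 ∎)

-- The error has three parts: `d` for the tail beyond k, k units of rounding, and the distance of
-- the computed value from `s`. The number `f` is F (k + 1) as carried by the recursion, so the tail
-- 3 / F (k + 1) is bounded without evaluating `F`.
S-near : ∀ k a f s e → ∑-fixed k ≡ (a , proj₁ (proj₂ (∑-fixed k)) , f) → 1 ℕ.≤ k →
  ∀ d → ιₙ 3 ℚ.≤ d ℚ.* ιₙ f → d ℚ.+ (ιₙ k ℚ.* u ℚ.+ ℚ.∣ ι a ℚ.* u ℚ.- s ∣) ℚ.≤ e →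
  ∀ n → k ℕ.≤ n → ℚ.∣ S n ℚ.- s ∣ ℚ.≤ e
S-near k a f s e eq 1≤k d tail-small total n k≤n = ℚ.≤-trans
  (∣∣-triangle (S n) (S k) s (ℚ.≤-trans (S-tail k n 1≤k k≤n) tail≤d)
    (∣∣-triangle (S k) (ι a ℚ.* u) s (subst (λ z → ℚ.∣ S k ℚ.- ι z ℚ.* u ∣ ℚ.≤ ιₙ k ℚ.* u) S-fixed≡a (S-fixed-near k)) ℚ.≤-refl))
  total
  where
  S-fixed≡a : S-fixed k ≡ a
  S-fixed≡a = cong proj₁ (trans (sym (∑-fixed≡ k)) eq)
  F≡f : F (suc k) ≡ f
  F≡f = cong (λ z → proj₂ (proj₂ z)) (trans (sym (∑-fixed≡ k)) eq)
  tail≤d : tailS k ℚ.≤ d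
  tail≤d = *-cancelʳ-≤ (0<ιF k) (ℚ.≤-trans
    (ℚ.≤-reflexive (trans (ℚ.*-assoc (ιₙ 3) (recip k) (ιₙ (F (suc k)))) (trans (cong (ιₙ 3 ℚ.*_) (recip-* k)) (ℚ.*-identityʳ (ιₙ 3)))))
    (subst (λ z → ιₙ 3 ℚ.≤ d ℚ.* ιₙ z) (sym F≡f) tail-small))

-- C to ten places.
ŝ : ℚ
ŝ = ℤ.- (+ 6457247183) ℚ./ 10000000000

nano : ℚ
nano = + 1 ℚ./ 1000000000

S-bound : ∀ n → 50 ℕ.≤ n → ℚ.∣ S n ℚ.- ŝ ∣ ℚ.≤ nano
S-bound = S-near 50 (proj₁ (∑-fixed 50)) (proj₂ (proj₂ (∑-fixed 50))) ŝ nano refl (ℕ.s≤s ℕ.z≤n)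
  -- F 51 = 20365011074, so the tail 3 / F 51 is below 2 ⋅ 10⁻¹⁰.
  (+ 2 ℚ./ 10000000000) (ℚ.≤ᵇ⇒≤ _) (ℚ.≤ᵇ⇒≤ _)

-- b ⋅ 10²⁰, rounded.
b̂ : ℤ
b̂ = ℤ.- (+ 38196601125010515180)

pow-fixed : ℕ → ℤ
pow-fixed zero    = b̂
pow-fixed (suc k) = (pow-fixed k ℤ.* b̂) /ℕ D

∏-fixed : ℕ → ℤ
∏-fixed zero    = + D
∏-fixed (suc k) = (∏-fixed k ℤ.* (+ D ℤ.+ ℤ.- pow-fixed k)) /ℕ D

-- In units of u: a step at most doubles the error, as ∣1 - βᵏ∣ ≤ 2, and adds 3 ⋅ 4 for the
-- error in βᵏ (as ∣Q∣ ≤ 3) and 1 for the rounding.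
∏-error : ℕ → ℕ
∏-error zero    = 0
∏-error (suc k) = 2 ℕ.* ∏-error k ℕ.+ 13

ι-neg : ∀ i → ι (ℤ.- i) ≡ ℚ.- ι i
ι-neg (+ zero)       = refl
ι-neg (+ suc n)      = refl
ι-neg (ℤ.-[1+ n ])   = sym (lem (ιₙ (suc n)))
  where
  lem : ∀ x → ℚ.- (ℚ.- x) ≡ x
  lem = RingSolver.solve-∀ ℚ-ring

module _ {β} (∣β∣≤⅖ : ℚ.∣ β ∣ ℚ.≤ ⅖) (β-near : ℚ.∣ β ℚ.- ι b̂ ℚ.* u ∣ ℚ.≤ ιₙ 3 ℚ.* u) where

  private
    pow⅖≤1 : ∀ n → powℚ ⅖ n ℚ.≤ 1ℚ
    pow⅖≤1 zero    = ℚ.≤-refl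
    pow⅖≤1 (suc n) = ℚ.≤-trans (≤-* (ℚ.≤ᵇ⇒≤ _) (ℚ.≤ᵇ⇒≤ _) (pow⅖≤1 n) (ℚ.≤-refl {⅖})) (ℚ.≤ᵇ⇒≤ _)

    ∣pow∣≤⅖ : ∀ k → ℚ.∣ powℚ β (suc k) ∣ ℚ.≤ ⅖
    ∣pow∣≤⅖ k = ℚ.≤-trans (∣powℚ∣≤ ∣β∣≤⅖ (suc k))
      (ℚ.≤-trans (≤-*ʳ {⅖} (ℚ.≤ᵇ⇒≤ _) (pow⅖≤1 k)) (ℚ.≤-reflexive (ℚ.*-identityˡ ⅖)))

  -- The error does not accumulate: the old 4 units are multiplied by at most 2/5, so are the 3
  -- units of error in b, and the rounding adds 1, with 8/5 + 6/5 + 1 ≤ 4.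
  pow-fixed-near : ∀ k → ℚ.∣ powℚ β (suc k) ℚ.- ι (pow-fixed k) ℚ.* u ∣ ℚ.≤ ιₙ 4 ℚ.* u
  pow-fixed-near zero    = ℚ.≤-trans
    (subst (λ z → ℚ.∣ z ℚ.- ι b̂ ℚ.* u ∣ ℚ.≤ ιₙ 3 ℚ.* u) (sym (ℚ.*-identityˡ β)) β-near) (ℚ.≤ᵇ⇒≤ _)
  pow-fixed-near (suc k) = begin
    ℚ.∣ x ℚ.* β ℚ.- w ∣
      ≡⟨ cong ℚ.∣_∣ (lem x β (ι (pow-fixed k)) (ι b̂) u w) ⟩
    ℚ.∣ (x ℚ.- y) ℚ.* z ℚ.+ x ℚ.* (β ℚ.- z) ℚ.+ (ι (pow-fixed k) ℚ.* ι b̂ ℚ.* u ℚ.* u ℚ.- w) ∣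
      ≡⟨ cong (λ i → ℚ.∣ (x ℚ.- y) ℚ.* z ℚ.+ x ℚ.* (β ℚ.- z) ℚ.+ (i ℚ.* u ℚ.* u ℚ.- w) ∣) (ι-* (pow-fixed k) b̂) ⟨
    ℚ.∣ (x ℚ.- y) ℚ.* z ℚ.+ x ℚ.* (β ℚ.- z) ℚ.+ (ι (pow-fixed k ℤ.* b̂) ℚ.* u ℚ.* u ℚ.- w) ∣
      ≤⟨ ∣∣-+ {(x ℚ.- y) ℚ.* z ℚ.+ x ℚ.* (β ℚ.- z)} {ι (pow-fixed k ℤ.* b̂) ℚ.* u ℚ.* u ℚ.- w}
           (∣∣-+ {(x ℚ.- y) ℚ.* z} {x ℚ.* (β ℚ.- z)}
             (∣∣-* {x ℚ.- y} {z} {ιₙ 4 ℚ.* u} {⅖} (pow-fixed-near k) (ℚ.≤ᵇ⇒≤ _))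
             (∣∣-* {x} {β ℚ.- z} (∣pow∣≤⅖ k) β-near))
           (floor-error-u (pow-fixed k ℤ.* b̂)) ⟩
    ιₙ 4 ℚ.* u ℚ.* ⅖ ℚ.+ ⅖ ℚ.* (ιₙ 3 ℚ.* u) ℚ.+ u
      ≤⟨ ℚ.≤ᵇ⇒≤ _ ⟩
    ιₙ 4 ℚ.* u ∎
    where
    open ℚ.≤-Reasoning
    x = powℚ β (suc k)
    y = ι (pow-fixed k) ℚ.* u
    z = ι b̂ ℚ.* u
    w = ι (pow-fixed (suc k)) ℚ.* u
    lem : ∀ x β c d u w → x ℚ.* β ℚ.- w ≡
      (x ℚ.- c ℚ.* u) ℚ.* (d ℚ.* u) ℚ.+ x ℚ.* (β ℚ.- d ℚ.* u) ℚ.+ (c ℚ.* d ℚ.* u ℚ.* u ℚ.- w)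
    lem = RingSolver.solve-∀ ℚ-ring

  ∏-fixed-near : ∀ k → ℚ.∣ Q k β ℚ.- ι (∏-fixed k) ℚ.* u ∣ ℚ.≤ ιₙ (∏-error k) ℚ.* u
  ∏-fixed-near zero    = ℚ.≤ᵇ⇒≤ _
  ∏-fixed-near (suc k) = begin
    ℚ.∣ Q k β ℚ.* (1ℚ ℚ.- x) ℚ.- w ∣
      ≡⟨ cong (λ i → ℚ.∣ Q k β ℚ.* (i ℚ.- x) ℚ.- w ∣) u*D ⟨
    ℚ.∣ Q k β ℚ.* (u ℚ.* ιₙ D ℚ.- x) ℚ.- w ∣
      ≡⟨ cong ℚ.∣_∣ (lem (Q k β) x p c u (ιₙ D) w) ⟩
    ℚ.∣ (Q k β ℚ.- p ℚ.* u) ℚ.* (u ℚ.* ιₙ D ℚ.- c ℚ.* u) ℚ.+ Q k β ℚ.* (c ℚ.* u ℚ.- x) ℚ.+ (p ℚ.* (ιₙ D ℚ.- c) ℚ.* u ℚ.* u ℚ.- w) ∣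
      ≡⟨ cong₂ (λ i j → ℚ.∣ (Q k β ℚ.- p ℚ.* u) ℚ.* (i ℚ.- c ℚ.* u) ℚ.+ Q k β ℚ.* (c ℚ.* u ℚ.- x) ℚ.+ (j ℚ.* u ℚ.* u ℚ.- w) ∣) u*D p[D-c] ⟩
    ℚ.∣ (Q k β ℚ.- p ℚ.* u) ℚ.* (1ℚ ℚ.- c ℚ.* u) ℚ.+ Q k β ℚ.* (c ℚ.* u ℚ.- x) ℚ.+ (ι next ℚ.* u ℚ.* u ℚ.- w) ∣
      ≤⟨ ∣∣-+ {(Q k β ℚ.- p ℚ.* u) ℚ.* (1ℚ ℚ.- c ℚ.* u) ℚ.+ Q k β ℚ.* (c ℚ.* u ℚ.- x)} {ι next ℚ.* u ℚ.* u ℚ.- w}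
           (∣∣-+ {(Q k β ℚ.- p ℚ.* u) ℚ.* (1ℚ ℚ.- c ℚ.* u)} {Q k β ℚ.* (c ℚ.* u ℚ.- x)}
             (∣∣-* {Q k β ℚ.- p ℚ.* u} {1ℚ ℚ.- c ℚ.* u} (∏-fixed-near k) factor≤2)
             (∣∣-* {Q k β} {c ℚ.* u ℚ.- x} (∣Q∣≤3 ∣β∣≤⅖ k) c-near))
           (floor-error-u next) ⟩
    ιₙ (∏-error k) ℚ.* u ℚ.* ιₙ 2 ℚ.+ ιₙ 3 ℚ.* (ιₙ 4 ℚ.* u) ℚ.+ u
      ≡⟨ lem′ (ιₙ (∏-error k)) u ⟩
    (ιₙ 2 ℚ.* ιₙ (∏-error k) ℚ.+ ιₙ 13) ℚ.* u
      ≡⟨ cong (ℚ._* u) (trans (cong (ℚ._+ ιₙ 13) (sym (ιₙ-* 2 (∏-error k)))) (sym (ι-+ (+ (2 ℕ.* ∏-error k)) (+ 13)))) ⟩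
    ιₙ (∏-error (suc k)) ℚ.* u ∎
    where
    open ℚ.≤-Reasoning
    x = powℚ β (suc k)
    p = ι (∏-fixed k)
    c = ι (pow-fixed k)
    next = ∏-fixed k ℤ.* (+ D ℤ.+ ℤ.- pow-fixed k)
    w = ι (∏-fixed (suc k)) ℚ.* u
    lem : ∀ q x p c u d w → q ℚ.* (u ℚ.* d ℚ.- x) ℚ.- w ≡
      (q ℚ.- p ℚ.* u) ℚ.* (u ℚ.* d ℚ.- c ℚ.* u) ℚ.+ q ℚ.* (c ℚ.* u ℚ.- x) ℚ.+ (p ℚ.* (d ℚ.- c) ℚ.* u ℚ.* u ℚ.- w)
    lem = RingSolver.solve-∀ ℚ-ring
    lem′ : ∀ e u → e ℚ.* u ℚ.* ιₙ 2 ℚ.+ ιₙ 3 ℚ.* (ιₙ 4 ℚ.* u) ℚ.+ u ≡ (ιₙ 2 ℚ.* e ℚ.+ ιₙ 13) ℚ.* u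
    lem′ = RingSolver.solve-∀ ℚ-ring
    p[D-c] : p ℚ.* (ιₙ D ℚ.- c) ≡ ι next
    p[D-c] = sym (trans (ι-* (∏-fixed k) (+ D ℤ.+ ℤ.- pow-fixed k))
      (cong (p ℚ.*_) (trans (ι-+ (+ D) (ℤ.- pow-fixed k)) (cong (ιₙ D ℚ.+_) (ι-neg (pow-fixed k))))))
    c-near : ℚ.∣ c ℚ.* u ℚ.- x ∣ ℚ.≤ ιₙ 4 ℚ.* u
    c-near = subst (ℚ._≤ ιₙ 4 ℚ.* u) (∣∣-swap x (c ℚ.* u)) (pow-fixed-near k)
    factor≤2 : ℚ.∣ 1ℚ ℚ.- c ℚ.* u ∣ ℚ.≤ ιₙ 2
    factor≤2 = subst (λ z → ℚ.∣ z ∣ ℚ.≤ ιₙ 2) (lem″ (c ℚ.* u) x) (ℚ.≤-trans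
      (∣∣-+ {1ℚ ℚ.- x} {x ℚ.- c ℚ.* u} (ℚ.≤-trans (ℚ.∣p-q∣≤∣p∣+∣q∣ 1ℚ x) (ℚ.+-monoʳ-≤ 1ℚ (∣pow∣≤⅖ k))) (pow-fixed-near k))
      (ℚ.≤ᵇ⇒≤ _))
      where
      lem″ : ∀ y x → (1ℚ ℚ.- x) ℚ.+ (x ℚ.- y) ≡ 1ℚ ℚ.- y
      lem″ = RingSolver.solve-∀ ℚ-ring

-- C_φ to ten places.
q̂ : ℚ
q̂ = + 12267420107 ℚ./ 10000000000

-- √5, rounded to 20 places.
σ : ℚ
σ = + 223606797749978969640 ℚ./ D

-- s - σ is (s² - σ²) / (s + σ). The numerator is at most u + 5 u, where 5 u accounts for σ² ≠ 5,
-- and the denominator is at least 2 because already σ is.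
√5-near : ∀ {s} → 0ℚ ℚ.≤ s → ℚ.∣ s ℚ.* s ℚ.- 5ℚ ∣ ℚ.≤ u → ℚ.∣ s ℚ.- σ ∣ ℚ.≤ ιₙ 3 ℚ.* u
√5-near {s} 0≤s h = *-cancelʳ-≤ {c = ιₙ 2} (0<ιₙ 1) (begin
  ℚ.∣ s ℚ.- σ ∣ ℚ.* ιₙ 2                        ≤⟨ ≤-*ˡ (ℚ.0≤∣p∣ (s ℚ.- σ)) 2≤s+σ ⟩
  ℚ.∣ s ℚ.- σ ∣ ℚ.* (s ℚ.+ σ)                   ≡⟨ cong (ℚ.∣ s ℚ.- σ ∣ ℚ.*_) (ℚ.0≤p⇒∣p∣≡p (ℚ.≤-trans (0≤ιₙ 2) 2≤s+σ)) ⟨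
  ℚ.∣ s ℚ.- σ ∣ ℚ.* ℚ.∣ s ℚ.+ σ ∣               ≡⟨ ℚ.∣p*q∣≡∣p∣*∣q∣ (s ℚ.- σ) (s ℚ.+ σ) ⟨
  ℚ.∣ (s ℚ.- σ) ℚ.* (s ℚ.+ σ) ∣                 ≡⟨ cong ℚ.∣_∣ (lem s σ) ⟩
  ℚ.∣ s ℚ.* s ℚ.- σ ℚ.* σ ∣                     ≤⟨ ∣∣-triangle {u} {ιₙ 5 ℚ.* u} (s ℚ.* s) 5ℚ (σ ℚ.* σ) h (ℚ.≤ᵇ⇒≤ _) ⟩
  u ℚ.+ ιₙ 5 ℚ.* u                              ≡⟨ lem′ u ⟩
  ιₙ 3 ℚ.* u ℚ.* ιₙ 2                           ∎)
  where
  open ℚ.≤-Reasoning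
  lem : ∀ s t → (s ℚ.- t) ℚ.* (s ℚ.+ t) ≡ s ℚ.* s ℚ.- t ℚ.* t
  lem = RingSolver.solve-∀ ℚ-ring
  lem′ : ∀ u → u ℚ.+ ιₙ 5 ℚ.* u ≡ ιₙ 3 ℚ.* u ℚ.* ιₙ 2
  lem′ = RingSolver.solve-∀ ℚ-ring
  2≤s+σ : ιₙ 2 ℚ.≤ s ℚ.+ σ
  2≤s+σ = ℚ.≤-trans (ℚ.≤ᵇ⇒≤ {ιₙ 2} {0ℚ ℚ.+ σ} _) (ℚ.+-monoˡ-≤ σ 0≤s)

b-near : ∀ {s β} → 0ℚ ℚ.≤ s → ℚ.∣ s ℚ.* s ℚ.- 5ℚ ∣ ℚ.≤ u → ℚ.∣ β ℚ.- (½ ℚ.* (1ℚ ℚ.+ s) ℚ.- ιₙ 2) ∣ ℚ.≤ u →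
  ℚ.∣ β ℚ.- ι b̂ ℚ.* u ∣ ℚ.≤ ιₙ 3 ℚ.* u
b-near {s} {β} 0≤s h k = ℚ.≤-trans
  (∣∣-triangle {u} {½ ℚ.* (ιₙ 3 ℚ.* u)} β (½ ℚ.* (1ℚ ℚ.+ s) ℚ.- ιₙ 2) (ι b̂ ℚ.* u) k
    (subst (λ z → ℚ.∣ z ∣ ℚ.≤ ½ ℚ.* (ιₙ 3 ℚ.* u)) (trans (lem s σ) (cong (λ z → ½ ℚ.* (1ℚ ℚ.+ s) ℚ.- ιₙ 2 ℚ.- z) σ-b̂))
      (∣∣-* {½} {s ℚ.- σ} {½} {ιₙ 3 ℚ.* u} ℚ.≤-refl (√5-near 0≤s h))))
  (ℚ.≤ᵇ⇒≤ _)
  where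
  lem : ∀ s t → ½ ℚ.* (s ℚ.- t) ≡ ½ ℚ.* (1ℚ ℚ.+ s) ℚ.- ιₙ 2 ℚ.- (½ ℚ.* (1ℚ ℚ.+ t) ℚ.- ιₙ 2)
  lem = RingSolver.solve-∀ ℚ-ring
  -- The twenty-digit numerator of 1 + σ is even, so halving loses nothing and the equation is
  -- exact.
  σ-b̂ : ½ ℚ.* (1ℚ ℚ.+ σ) ℚ.- ιₙ 2 ≡ ι b̂ ℚ.* u
  σ-b̂ = refl

near⇒small : ∀ {β} → ℚ.∣ β ℚ.- ι b̂ ℚ.* u ∣ ℚ.≤ ιₙ 3 ℚ.* u → ℚ.∣ β ∣ ℚ.≤ ⅖
near⇒small {β} h = ℚ.≤-trans
  (subst (λ z → ℚ.∣ z ∣ ℚ.≤ ιₙ 3 ℚ.* u ℚ.+ ℚ.∣ ι b̂ ℚ.* u ∣) (lem β (ι b̂ ℚ.* u))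
    (∣∣-+ {β ℚ.- ι b̂ ℚ.* u} {ι b̂ ℚ.* u} h ℚ.≤-refl))
  (ℚ.≤ᵇ⇒≤ _)
  where
  lem : ∀ a b → a ℚ.- b ℚ.+ b ≡ a
  lem = RingSolver.solve-∀ ℚ-ring

0≤√5-seq : ∀ n → 0ℚ ℚ.≤ seq √5 n
0≤√5-seq n = *-cancelʳ-≤ (0<ιₙ n) (subst₂ ℚ._≤_ (sym (ℚ.*-zeroˡ (ιₙ (suc n)))) (sym (/-*-cancel (+ √-num 5 n) (suc n))) (0≤ιₙ (√-num 5 n)))

Eventually : (ℕ → Set) → Set
Eventually P = ∃[ N ] (∀ n → N ℕ.≤ n → P n)

eventually-map : ∀ {P R : ℕ → Set} → (∀ n → P n → R n) → Eventually P → Eventually R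
eventually-map h (N , p) = N , λ n N≤n → h n (p n N≤n)

eventually-map₂ : ∀ {P P′ R : ℕ → Set} → (∀ n → P n → P′ n → R n) → Eventually P → Eventually P′ → Eventually R
eventually-map₂ h (N , p) (M , p′) = N ℕ.⊔ M , λ n N⊔M≤n →
  h n (p n (ℕ.m⊔n≤o⇒m≤o N M N⊔M≤n)) (p′ n (ℕ.m⊔n≤o⇒n≤o N M N⊔M≤n))

b-eventually-near : Eventually λ n → ℚ.∣ seq b n ℚ.- ι b̂ ℚ.* u ∣ ℚ.≤ ιₙ 3 ℚ.* u
b-eventually-near = eventually-map₂ (λ n → b-near {seq √5 n} {seq b n} (0≤√5-seq n)) (difference-null √5²≃5 u (ℚ.positive⁻¹ u)) (difference-null b≃φ-2 u (ℚ.positive⁻¹ u))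

Q-near : ∀ {β} → ℚ.∣ β ∣ ℚ.≤ ⅖ → ℚ.∣ β ℚ.- ι b̂ ℚ.* u ∣ ℚ.≤ ιₙ 3 ℚ.* u → ∀ k →
  tailQ k ℚ.+ (ιₙ (∏-error k) ℚ.* u ℚ.+ ℚ.∣ ι (∏-fixed k) ℚ.* u ℚ.- q̂ ∣) ℚ.≤ nano →
  ∀ n → k ℕ.≤ n → ℚ.∣ Q n β ℚ.- q̂ ∣ ℚ.≤ nano
Q-near {β} h₁ h₂ k total n k≤n = ℚ.≤-trans
  (∣∣-triangle (Q n β) (Q k β) q̂ (Q-tail h₁ k n k≤n)
    (∣∣-triangle (Q k β) (ι (∏-fixed k) ℚ.* u) q̂ (∏-fixed-near h₁ h₂ k) ℚ.≤-refl))
  total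

-- At 26 factors the tail 2 (2/5)²⁶ is about 9 ⋅ 10⁻¹¹ and the fixed-point error about 9 ⋅ 10⁻¹².
Q-bound : ∀ {β} → ℚ.∣ β ∣ ℚ.≤ ⅖ → ℚ.∣ β ℚ.- ι b̂ ℚ.* u ∣ ℚ.≤ ιₙ 3 ℚ.* u →
  ∀ n → 26 ℕ.≤ n → ℚ.∣ Q n β ℚ.- q̂ ∣ ℚ.≤ nano
Q-bound h₁ h₂ = Q-near h₁ h₂ 26 (ℚ.≤ᵇ⇒≤ _)

-- The limits

eventually-≥ : ∀ N → Eventually (N ℕ.≤_)
eventually-≥ N = N , λ _ N≤n → N≤n

seq-^ : ∀ x k n → seq (x ^ k) n ≡ powℚ (seq x n) k
seq-^ x zero    n = refl
seq-^ x (suc k) n = cong (ℚ._* seq x n) (seq-^ x k n)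

seq-Π : ∀ k n → seq (Π k) n ≡ Q k (seq b n)
seq-Π zero    n = refl
seq-Π (suc k) n = cong₂ (λ x y → x ℚ.* (1ℚ ℚ.- y)) (seq-Π k n) (seq-^ b (suc k) n)

¼ : ℚ
¼ = ½ ℚ.* ½

-- Since `Q-tail` is uniform in β, both products can be cut at one K chosen in advance. What remains
-- is the sequence of the single real `Π K`, which is Cauchy.
Q-diagonal-cauchy : IsCauchy λ n → Q n (seq b n)
Q-diagonal-cauchy ε 0<ε =
  let (K , tail-small) = tailQ-vanishing (¼ ℚ.* ε) 0<¼ε
      (N , close) = cauchy (Π K) (¼ ℚ.* ε) 0<¼ε
      (M , b-good) = b-eventually-near
  in K ℕ.⊔ (N ℕ.⊔ M) , λ m n p q → ℚ.≤-<-trans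
    (go K m n (tail-small K ℕ.≤-refl)
      (ℚ.<⇒≤ (close m n (ℕ.m⊔n≤o⇒m≤o N M (ℕ.m⊔n≤o⇒n≤o K _ p)) (ℕ.m⊔n≤o⇒m≤o N M (ℕ.m⊔n≤o⇒n≤o K _ q))))
      (near⇒small {seq b m} (b-good m (ℕ.m⊔n≤o⇒n≤o N M (ℕ.m⊔n≤o⇒n≤o K _ p)))) (near⇒small {seq b n} (b-good n (ℕ.m⊔n≤o⇒n≤o N M (ℕ.m⊔n≤o⇒n≤o K _ q))))
      (ℕ.m⊔n≤o⇒m≤o K _ p) (ℕ.m⊔n≤o⇒m≤o K _ q))
    (three-quarters 0<ε)
  where
  0<¼ε : 0ℚ ℚ.< ¼ ℚ.* ε
  0<¼ε = 0<* (ℚ.positive⁻¹ ¼) 0<ε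
  three-quarters : ∀ {ε} → 0ℚ ℚ.< ε → ¼ ℚ.* ε ℚ.+ (¼ ℚ.* ε ℚ.+ ¼ ℚ.* ε) ℚ.< ε
  three-quarters {ε} 0<ε = subst₂ ℚ._<_ (ℚ.+-identityʳ _) (lem ε)
    (ℚ.+-monoʳ-< (¼ ℚ.* ε ℚ.+ (¼ ℚ.* ε ℚ.+ ¼ ℚ.* ε)) (0<* (ℚ.positive⁻¹ ¼) 0<ε))
    where
    lem : ∀ ε → ¼ ℚ.* ε ℚ.+ (¼ ℚ.* ε ℚ.+ ¼ ℚ.* ε) ℚ.+ ¼ ℚ.* ε ≡ ε
    lem = RingSolver.solve-∀ ℚ-ring
  go : ∀ K m n → tailQ K ℚ.≤ ¼ ℚ.* ε → ℚ.∣ seq (Π K) m ℚ.- seq (Π K) n ∣ ℚ.≤ ¼ ℚ.* ε →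
    ℚ.∣ seq b m ∣ ℚ.≤ ⅖ → ℚ.∣ seq b n ∣ ℚ.≤ ⅖ → K ℕ.≤ m → K ℕ.≤ n →
    ℚ.∣ Q m (seq b m) ℚ.- Q n (seq b n) ∣ ℚ.≤ ¼ ℚ.* ε ℚ.+ (¼ ℚ.* ε ℚ.+ ¼ ℚ.* ε)
  go K m n small close bm bn K≤m K≤n =
    ∣∣-triangle (Q m (seq b m)) (Q K (seq b m)) (Q n (seq b n)) (ℚ.≤-trans (Q-tail bm K m K≤m) small)
      (∣∣-triangle (Q K (seq b m)) (Q K (seq b n)) (Q n (seq b n))
        (subst₂ (λ x y → ℚ.∣ x ℚ.- y ∣ ℚ.≤ ¼ ℚ.* ε) (seq-Π K m) (seq-Π K n) close)
        (subst (ℚ._≤ ¼ ℚ.* ε) (∣∣-swap (Q n (seq b n)) (Q K (seq b n))) (ℚ.≤-trans (Q-tail bn K n K≤n) small)))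

C-φ : ℝ
C-φ = mkℝ (λ n → Q n (seq b n)) Q-diagonal-cauchy

-- `_<_` demands a positive gap, here ε - c. This is why the limits are proved with ε / 2 in place
-- of ε.
∣∣<-intro : ∀ {x c ε} → c ℚ.< ε → Eventually (λ n → ℚ.∣ seq x n ∣ ℚ.≤ c) → ∣ x ∣ < fromℚ ε
∣∣<-intro {x} {c} {ε} c<ε (N , h) =
  ε ℚ.- c , subst (ℚ._< ε ℚ.- c) (ℚ.+-inverseʳ c) (ℚ.+-monoˡ-< (ℚ.- c) c<ε) ,
  N , λ n N≤n → subst (ℚ.∣ seq x n ∣ ℚ.+ (ε ℚ.- c) ℚ.≤_) (lem c ε) (ℚ.+-monoˡ-≤ (ε ℚ.- c) (h n N≤n))
  where
  lem : ∀ c ε → c ℚ.+ (ε ℚ.- c) ≡ ε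
  lem = RingSolver.solve-∀ ℚ-ring

seq-∑ : ∀ n f i → seq (∑ n λ k → fromℚ (f k)) i ≡ ∑ℚ n f
seq-∑ zero    f i = refl
seq-∑ (suc n) f i = cong (ℚ._+ f n) (seq-∑ n f i)

∑⟶C : (λ n → ∑ n (λ k → fromℚ (ℚ._/_ (μ (suc k)) (F (suc k)) {{F-nonZero k}}))) ⟶ C
∑⟶C ε 0<ε = eventually-map₂ close (tailS-vanishing (½ ℚ.* ε) (0<½ 0<ε)) (eventually-≥ 1)
  where
  s : ℕ → ℚ
  s k = ℚ._/_ (μ (suc k)) (F (suc k)) {{F-nonZero k}}
  close : ∀ n → tailS n ℚ.≤ ½ ℚ.* ε → 1 ℕ.≤ n → ∣ ∑ n (λ k → fromℚ (s k)) - C ∣ < fromℚ ε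
  close n small 1≤n = ∣∣<-intro {∑ n (λ k → fromℚ (s k)) - C} (½ε<ε 0<ε) (n , λ m n≤m →
    subst (λ z → ℚ.∣ z ℚ.- S m ∣ ℚ.≤ ½ ℚ.* ε) (sym (seq-∑ n s m))
      (subst (ℚ._≤ ½ ℚ.* ε) (∣∣-swap (S m) (S n)) (ℚ.≤-trans (S-tail n m 1≤n n≤m) small)))

-- At index m the two sides are `Q n β` and `Q m β` with the same β = `seq b m`, so the diagonal
-- form of C_φ makes `Q-tail` directly applicable.
Π⟶C-φ : Π ⟶ C-φ
Π⟶C-φ ε 0<ε = eventually-map close (tailQ-vanishing (½ ℚ.* ε) (0<½ 0<ε))
  where
  close : ∀ n → tailQ n ℚ.≤ ½ ℚ.* ε → ∣ Π n - C-φ ∣ < fromℚ ε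
  close n small = ∣∣<-intro {Π n - C-φ} (½ε<ε 0<ε) (eventually-map₂
    (λ m n≤m h → subst (λ z → ℚ.∣ z ℚ.- Q m (seq b m) ∣ ℚ.≤ ½ ℚ.* ε) (sym (seq-Π n m))
      (subst (ℚ._≤ ½ ℚ.* ε) (∣∣-swap (Q m (seq b m)) (Q n (seq b m)))
        (ℚ.≤-trans (Q-tail (near⇒small {seq b m} h) n m n≤m) small)))
    (eventually-≥ n) b-eventually-near)

Q-eventually-near : Eventually λ n → ℚ.∣ Q n (seq b n) ℚ.- q̂ ∣ ℚ.≤ nano
Q-eventually-near = eventually-map₂ (λ n h 26≤n → Q-bound {seq b n} (near⇒small {seq b n} h) h n 26≤n) b-eventually-near (eventually-≥ 26)

C-φ≈ : C-φ ≈ + 1226742 ℚ./ 1000000 ± (+ 1 ℚ./ 2000000)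
C-φ≈ = ∣∣<-intro {C-φ - fromℚ t} (from-yes (nano ℚ.+ ℚ.∣ q̂ ℚ.- t ∣ ℚ.<? + 1 ℚ./ 2000000)) (eventually-map
  (λ n h → ∣∣-triangle (Q n (seq b n)) q̂ t h ℚ.≤-refl) Q-eventually-near)
  where t = + 1226742 ℚ./ 1000000

C*C-φ≈ : C * C-φ ≈ (ℤ.- + 7921376) ℚ./ 10000000 ± (+ 1 ℚ./ 20000000)
C*C-φ≈ = ∣∣<-intro {C * C-φ - fromℚ t} (from-yes (e ℚ.<? + 1 ℚ./ 20000000))
  (eventually-map₂ (λ n s (h , small) → bound (S n) (Q n (seq b n)) s h small)
    (50 , S-bound)
    (eventually-map₂ (λ n h h′ → h , ∣Q∣≤3 (near⇒small {seq b n} h′) n) Q-eventually-near b-eventually-near))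
  where
  t = (ℤ.- + 7921376) ℚ./ 10000000
  -- `ŝ ℚ.* q̂` is -0.7921376392..., about 3.9 ⋅ 10⁻⁸ from the printed value. Of the tolerance 5 ⋅
  -- 10⁻⁸ only about 10⁻⁸ is left for the errors of both factors, which calls for bounds as fine as
  -- `nano`.
  e = nano ℚ.* ιₙ 3 ℚ.+ ℚ.∣ ŝ ∣ ℚ.* nano ℚ.+ ℚ.∣ ŝ ℚ.* q̂ ℚ.- t ∣
  lem : ∀ s q s′ q′ t → (s ℚ.- s′) ℚ.* q ℚ.+ s′ ℚ.* (q ℚ.- q′) ℚ.+ (s′ ℚ.* q′ ℚ.- t) ≡ s ℚ.* q ℚ.- t
  lem = RingSolver.solve-∀ ℚ-ring
  bound : ∀ s q → ℚ.∣ s ℚ.- ŝ ∣ ℚ.≤ nano → ℚ.∣ q ℚ.- q̂ ∣ ℚ.≤ nano → ℚ.∣ q ∣ ℚ.≤ ιₙ 3 →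
    ℚ.∣ s ℚ.* q ℚ.- t ∣ ℚ.≤ e
  bound s q hs hq q≤3 = subst (λ z → ℚ.∣ z ∣ ℚ.≤ e) (lem s q ŝ q̂ t)
    (∣∣-+ {(s ℚ.- ŝ) ℚ.* q ℚ.+ ŝ ℚ.* (q ℚ.- q̂)} {ŝ ℚ.* q̂ ℚ.- t}
      (∣∣-+ {(s ℚ.- ŝ) ℚ.* q} {ŝ ℚ.* (q ℚ.- q̂)} (∣∣-* {s ℚ.- ŝ} {q} hs q≤3) (∣∣-* {ŝ} {q ℚ.- q̂} ℚ.≤-refl hq)) ℚ.≤-refl)

-- The quotient by the determinant

½≤∣S∣ : ∀ n → 50 ℕ.≤ n → ½ ℚ.≤ ℚ.∣ S n ∣
½≤∣S∣ n 50≤n = ∣∣-lower {S n} {ŝ} (S-bound n 50≤n) (ℚ.≤ᵇ⇒≤ _)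

∣S∣≤1 : ∀ n → 50 ℕ.≤ n → ℚ.∣ S n ∣ ℚ.≤ 1ℚ
∣S∣≤1 n 50≤n = ℚ.≤-trans
  (subst (λ z → ℚ.∣ z ∣ ℚ.≤ nano ℚ.+ ℚ.∣ ŝ ∣) (lem (S n) ŝ) (∣∣-+ {S n ℚ.- ŝ} {ŝ} (S-bound n 50≤n) ℚ.≤-refl)) (ℚ.≤ᵇ⇒≤ _)
  where
  lem : ∀ a b → a ℚ.- b ℚ.+ b ≡ a
  lem = RingSolver.solve-∀ ℚ-ring

1≤Fprod : ∀ n → 1ℚ ℚ.≤ ιₙ (Fprod n)
1≤Fprod n = ιₙ-mono-≤ {1} {Fprod n} (Fprod-pos n)

-- The formula fails at n = 0, where the determinant is 1 and the sum is empty.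
ι-det-FR-large : ∀ n → 50 ℕ.≤ n → ι (det (FR n)) ≡ ιₙ (Fprod n) ℚ.* S n
ι-det-FR-large (suc n) _ = ι-det-FR n

½≤∣ι-det-FR∣ : ∀ n → 50 ℕ.≤ n → ½ ℚ.≤ ℚ.∣ ι (det (FR n)) ∣
½≤∣ι-det-FR∣ n 50≤n = begin
  ½                                 ≤⟨ ½≤∣S∣ n 50≤n ⟩
  ℚ.∣ S n ∣                         ≡⟨ ℚ.*-identityˡ ℚ.∣ S n ∣ ⟨
  1ℚ ℚ.* ℚ.∣ S n ∣                  ≤⟨ ≤-*ʳ (ℚ.0≤∣p∣ (S n)) (1≤Fprod n) ⟩
  ιₙ (Fprod n) ℚ.* ℚ.∣ S n ∣        ≡⟨ cong (ℚ._* ℚ.∣ S n ∣) (ℚ.0≤p⇒∣p∣≡p (0≤ιₙ (Fprod n))) ⟨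
  ℚ.∣ ιₙ (Fprod n) ∣ ℚ.* ℚ.∣ S n ∣  ≡⟨ ℚ.∣p*q∣≡∣p∣*∣q∣ (ιₙ (Fprod n)) (S n) ⟨
  ℚ.∣ ιₙ (Fprod n) ℚ.* S n ∣        ≡⟨ cong ℚ.∣_∣ (ι-det-FR-large n 50≤n) ⟨
  ℚ.∣ ι (det (FR n)) ∣              ∎
  where open ℚ.≤-Reasoning

det-FR#0 : ∀ n → 50 ℕ.≤ n → fromℤ (det (FR n)) #0
det-FR#0 n 50≤n = ½ , ℚ.positive⁻¹ ½ , 0 , λ _ _ →
  subst (ℚ._≤ ℚ.∣ ι (det (FR n)) ∣) (sym (ℚ.+-identityˡ ½)) (½≤∣ι-det-FR∣ n 50≤n)

inverseℚ-inverseʳ : ∀ q (d : Dec (q ≡ 0ℚ)) → ½ ℚ.≤ ℚ.∣ q ∣ → q ℚ.* inverseℚ q d ≡ 1ℚ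
inverseℚ-inverseʳ q (yes refl) h = contradiction (ℚ.<-≤-trans (ℚ.positive⁻¹ ½) h) (ℚ.<-irrefl refl)
inverseℚ-inverseʳ q (no q≢0)   h = ℚ.*-inverseʳ q {{ℚ.≢-nonZero q≢0}}

-- With P S J = 1 and P ≈ X Q, the factor S J (Q X - P) measures the error in Binet's formula.
quotient-bound : ∀ {c q x P S Q J η κ} → 1ℚ ℚ.≤ P → ½ ℚ.≤ ℚ.∣ S ∣ → ½ ℚ.≤ ℚ.∣ Q ∣ → P ℚ.* S ℚ.* J ≡ 1ℚ →
  ℚ.∣ P ℚ.- x ℚ.* Q ∣ ℚ.≤ 1ℚ → ℚ.∣ P ℚ.- x ℚ.* Q ∣ ℚ.≤ η → ℚ.∣ c ℚ.* q ℚ.- S ℚ.* Q ∣ ℚ.≤ κ →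
  ℚ.∣ c ℚ.* q ℚ.* x ℚ.* J ℚ.- 1ℚ ∣ ℚ.≤ κ ℚ.* ιₙ 8 ℚ.+ η
quotient-bound {c} {q} {x} {P} {S} {Q} {J} {η} {κ} 1≤P ½≤S ½≤Q PSJ near₁ near κ-bound = begin
  ℚ.∣ c ℚ.* q ℚ.* x ℚ.* J ℚ.- 1ℚ ∣
    ≡⟨ cong (λ z → ℚ.∣ c ℚ.* q ℚ.* x ℚ.* J ℚ.- z ∣) PSJ ⟨
  ℚ.∣ c ℚ.* q ℚ.* x ℚ.* J ℚ.- P ℚ.* S ℚ.* J ∣
    ≡⟨ cong ℚ.∣_∣ (split c q x P S Q J) ⟩
  ℚ.∣ (c ℚ.* q ℚ.- S ℚ.* Q) ℚ.* (x ℚ.* J) ℚ.+ S ℚ.* J ℚ.* (x ℚ.* Q ℚ.- P) ∣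
    ≤⟨ ∣∣-+ {(c ℚ.* q ℚ.- S ℚ.* Q) ℚ.* (x ℚ.* J)} {S ℚ.* J ℚ.* (x ℚ.* Q ℚ.- P)}
         (∣∣-* {c ℚ.* q ℚ.- S ℚ.* Q} {x ℚ.* J} κ-bound ∣xJ∣≤8)
         (∣∣-* {S ℚ.* J} {x ℚ.* Q ℚ.- P} ∣SJ∣≤1 (subst (ℚ._≤ η) (∣∣-swap P (x ℚ.* Q)) near)) ⟩
  κ ℚ.* ιₙ 8 ℚ.+ 1ℚ ℚ.* η
    ≡⟨ cong (κ ℚ.* ιₙ 8 ℚ.+_) (ℚ.*-identityˡ η) ⟩
  κ ℚ.* ιₙ 8 ℚ.+ η ∎
  where
  open ℚ.≤-Reasoning
  split : ∀ c q x P S Q J → c ℚ.* q ℚ.* x ℚ.* J ℚ.- P ℚ.* S ℚ.* J ≡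
    (c ℚ.* q ℚ.- S ℚ.* Q) ℚ.* (x ℚ.* J) ℚ.+ S ℚ.* J ℚ.* (x ℚ.* Q ℚ.- P)
  split = RingSolver.solve-∀ ℚ-ring
  0<P : 0ℚ ℚ.< P
  0<P = ℚ.<-≤-trans (ℚ.positive⁻¹ 1ℚ) 1≤P
  0≤P : 0ℚ ℚ.≤ P
  0≤P = ℚ.<⇒≤ 0<P
  ∣P∣ : ℚ.∣ P ∣ ≡ P
  ∣P∣ = ℚ.0≤p⇒∣p∣≡p 0≤P
  P∣SJ∣ : P ℚ.* ℚ.∣ S ℚ.* J ∣ ≡ 1ℚ
  P∣SJ∣ = begin-equality
    P ℚ.* ℚ.∣ S ℚ.* J ∣           ≡⟨ cong (ℚ._* ℚ.∣ S ℚ.* J ∣) ∣P∣ ⟨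
    ℚ.∣ P ∣ ℚ.* ℚ.∣ S ℚ.* J ∣     ≡⟨ ℚ.∣p*q∣≡∣p∣*∣q∣ P (S ℚ.* J) ⟨
    ℚ.∣ P ℚ.* (S ℚ.* J) ∣         ≡⟨ cong ℚ.∣_∣ (trans (sym (ℚ.*-assoc P S J)) PSJ) ⟩
    1ℚ                            ∎
  ∣SJ∣≤1 : ℚ.∣ S ℚ.* J ∣ ℚ.≤ 1ℚ
  ∣SJ∣≤1 = begin
    ℚ.∣ S ℚ.* J ∣                 ≡⟨ ℚ.*-identityˡ _ ⟨
    1ℚ ℚ.* ℚ.∣ S ℚ.* J ∣          ≤⟨ ≤-*ʳ (ℚ.0≤∣p∣ (S ℚ.* J)) 1≤P ⟩
    P ℚ.* ℚ.∣ S ℚ.* J ∣           ≡⟨ P∣SJ∣ ⟩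
    1ℚ                            ∎
  P∣J∣≤2 : P ℚ.* ℚ.∣ J ∣ ℚ.≤ ιₙ 2
  P∣J∣≤2 = *-cancelʳ-≤ {c = ½} (ℚ.positive⁻¹ ½) (begin
    P ℚ.* ℚ.∣ J ∣ ℚ.* ½           ≤⟨ ≤-*ˡ (0≤* 0≤P (ℚ.0≤∣p∣ J)) ½≤S ⟩
    P ℚ.* ℚ.∣ J ∣ ℚ.* ℚ.∣ S ∣     ≡⟨ rearrange P ℚ.∣ J ∣ ℚ.∣ S ∣ ⟩
    P ℚ.* (ℚ.∣ S ∣ ℚ.* ℚ.∣ J ∣)   ≡⟨ cong (P ℚ.*_) (ℚ.∣p*q∣≡∣p∣*∣q∣ S J) ⟨
    P ℚ.* ℚ.∣ S ℚ.* J ∣           ≡⟨ P∣SJ∣ ⟩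
    1ℚ                            ∎)
    where
    rearrange : ∀ p j s → p ℚ.* j ℚ.* s ≡ p ℚ.* (s ℚ.* j)
    rearrange = RingSolver.solve-∀ ℚ-ring
  ∣x∣≤4P : ℚ.∣ x ∣ ℚ.≤ ιₙ 4 ℚ.* P
  ∣x∣≤4P = *-cancelʳ-≤ {c = ½} (ℚ.positive⁻¹ ½) (begin
    ℚ.∣ x ∣ ℚ.* ½                      ≤⟨ ≤-*ˡ (ℚ.0≤∣p∣ x) ½≤Q ⟩
    ℚ.∣ x ∣ ℚ.* ℚ.∣ Q ∣                ≡⟨ ℚ.∣p*q∣≡∣p∣*∣q∣ x Q ⟨
    ℚ.∣ x ℚ.* Q ∣                      ≡⟨ cong ℚ.∣_∣ (shift P (x ℚ.* Q)) ⟩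
    ℚ.∣ P ℚ.+ (x ℚ.* Q ℚ.- P) ∣        ≤⟨ ∣∣-+ {P} {x ℚ.* Q ℚ.- P} (ℚ.≤-reflexive ∣P∣) (subst (ℚ._≤ 1ℚ) (∣∣-swap P (x ℚ.* Q)) near₁) ⟩
    P ℚ.+ 1ℚ                           ≤⟨ ℚ.+-monoʳ-≤ P 1≤P ⟩
    P ℚ.+ P                            ≡⟨ double P ⟩
    ιₙ 4 ℚ.* P ℚ.* ½                   ∎)
    where
    shift : ∀ p y → y ≡ p ℚ.+ (y ℚ.- p)
    shift = RingSolver.solve-∀ ℚ-ring
    double : ∀ p → p ℚ.+ p ≡ ιₙ 4 ℚ.* p ℚ.* ½
    double = RingSolver.solve-∀ ℚ-ring
  -- x grows like P and J decays like 1 / P, so only their product has a bound independent of n,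
  -- namely 4 P times 2 / P.
  ∣xJ∣≤8 : ℚ.∣ x ℚ.* J ∣ ℚ.≤ ιₙ 8
  ∣xJ∣≤8 = begin
    ℚ.∣ x ℚ.* J ∣                      ≤⟨ ∣∣-* {x} {J} ∣x∣≤4P ℚ.≤-refl ⟩
    ιₙ 4 ℚ.* P ℚ.* ℚ.∣ J ∣             ≡⟨ ℚ.*-assoc (ιₙ 4) P ℚ.∣ J ∣ ⟩
    ιₙ 4 ℚ.* (P ℚ.* ℚ.∣ J ∣)           ≤⟨ ≤-*ˡ (0≤ιₙ 4) P∣J∣≤2 ⟩
    ιₙ 4 ℚ.* ιₙ 2                      ≡⟨⟩
    ιₙ 8                               ∎

product-close : ∀ {s q S Q α} → ℚ.∣ s ℚ.- S ∣ ℚ.≤ α → ℚ.∣ q ℚ.- Q ∣ ℚ.≤ α → ℚ.∣ q ∣ ℚ.≤ ιₙ 3 → ℚ.∣ S ∣ ℚ.≤ 1ℚ →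
  ℚ.∣ s ℚ.* q ℚ.- S ℚ.* Q ∣ ℚ.≤ α ℚ.* ιₙ 3 ℚ.+ 1ℚ ℚ.* α
product-close {s} {q} {S} {Q} {α} hs hq q≤3 S≤1 = subst (λ z → ℚ.∣ z ∣ ℚ.≤ α ℚ.* ιₙ 3 ℚ.+ 1ℚ ℚ.* α) (lem s q S Q)
  (∣∣-+ {(s ℚ.- S) ℚ.* q} {S ℚ.* (q ℚ.- Q)} (∣∣-* {s ℚ.- S} {q} hs q≤3) (∣∣-* {S} {q ℚ.- Q} S≤1 hq))
  where
  lem : ∀ s q S Q → (s ℚ.- S) ℚ.* q ℚ.+ S ℚ.* (q ℚ.- Q) ≡ s ℚ.* q ℚ.- S ℚ.* Q
  lem = RingSolver.solve-∀ ℚ-ring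

-- n is the index of the ratio and m that of the rational approximations. C and C_φ contribute `S m`
-- and `Q m β`, the determinant and Binet's formula `S n` and `Q n β` with the same β, so the tails
-- at n bound the discrepancy for all m ≥ n alike. The constant is 33 = (3 + 1) 8 + 1.
ratio-at : ∀ {α J β x₁ x₂} n m → 50 ℕ.≤ n → n ℕ.≤ m → tailS n ℚ.≤ α → tailQ n ℚ.≤ α →
  ιₙ (Fprod n) ℚ.* S n ℚ.* J ≡ 1ℚ → ℚ.∣ β ℚ.- ι b̂ ℚ.* u ∣ ℚ.≤ ιₙ 3 ℚ.* u →
  ℚ.∣ ιₙ (Fprod n) ℚ.- x₁ ℚ.* x₂ ℚ.* Q n β ∣ ℚ.≤ 1ℚ → ℚ.∣ ιₙ (Fprod n) ℚ.- x₁ ℚ.* x₂ ℚ.* Q n β ∣ ℚ.≤ α →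
  ℚ.∣ S m ℚ.* Q m β ℚ.* x₁ ℚ.* x₂ ℚ.* J ℚ.- 1ℚ ∣ ℚ.≤ ιₙ 33 ℚ.* α
ratio-at {α} {J} {β} {x₁} {x₂} n m 50≤n n≤m S-small Q-small PSJ b-good near₁ near = subst₂ ℚ._≤_
  (cong (λ z → ℚ.∣ z ℚ.* J ℚ.- 1ℚ ∣) (sym (ℚ.*-assoc (S m ℚ.* Q m β) x₁ x₂))) (sum-up α)
  (quotient-bound {S m} {Q m β} {x₁ ℚ.* x₂} {ιₙ (Fprod n)} {S n} {Q n β} {J}
    (1≤Fprod n) (½≤∣S∣ n 50≤n)
    (∣∣-lower {Q n β} {q̂} (Q-bound {β} small b-good n (ℕ.≤-trans (ℕ.m≤m+n 26 24) 50≤n)) (ℚ.≤ᵇ⇒≤ _))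
    PSJ near₁ near
    (product-close {S m} {Q m β} {S n} {Q n β}
      (ℚ.≤-trans (S-tail n m (ℕ.≤-trans (ℕ.m≤m+n 1 49) 50≤n) n≤m) S-small)
      (ℚ.≤-trans (Q-tail small n m n≤m) Q-small) (∣Q∣≤3 small m) (∣S∣≤1 n 50≤n)))
  where
  small : ℚ.∣ β ∣ ℚ.≤ ⅖
  small = near⇒small {β} b-good
  sum-up : ∀ α → (α ℚ.* ιₙ 3 ℚ.+ 1ℚ ℚ.* α) ℚ.* ιₙ 8 ℚ.+ α ≡ ιₙ 33 ℚ.* α
  sum-up = RingSolver.solve-∀ ℚ-ring

det-FR-inverse : ∀ n → 50 ℕ.≤ n →
  ιₙ (Fprod n) ℚ.* S n ℚ.* inverseℚ (ι (det (FR n))) (ι (det (FR n)) ℚ.≟ 0ℚ) ≡ 1ℚ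
det-FR-inverse n 50≤n = trans (cong (ℚ._* J) (sym (ι-det-FR-large n 50≤n)))
  (inverseℚ-inverseʳ (ι (det (FR n))) (ι (det (FR n)) ℚ.≟ 0ℚ) ½≤∣det∣)
  where
  J = inverseℚ (ι (det (FR n))) (ι (det (FR n)) ℚ.≟ 0ℚ)
  ½≤∣det∣ : ½ ℚ.≤ ℚ.∣ ι (det (FR n)) ∣
  ½≤∣det∣ = ½≤∣ι-det-FR∣ n 50≤n

ratio : ∀ n → 50 ℕ.≤ n → ℝ
ratio n 50≤n = C * C-φ * φ ^ ((n ℕ.* suc n) ℕ./ 2) * √5⁻¹ ^ n * fromℤ (det (FR n)) ⁻¹⟨ det-FR#0 n 50≤n ⟩

seq-ratio : ∀ n 50≤n m → seq (ratio n 50≤n) m ≡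
  S m ℚ.* Q m (seq b m) ℚ.* seq (φ ^ ((n ℕ.* suc n) ℕ./ 2)) m ℚ.* seq (√5⁻¹ ^ n) m ℚ.* inverseℚ (ι (det (FR n))) (ι (det (FR n)) ℚ.≟ 0ℚ)
seq-ratio n 50≤n m = refl

Fprod-near : ∀ n ε → 0ℚ ℚ.< ε → Eventually λ m →
  ℚ.∣ ιₙ (Fprod n) ℚ.- seq (φ ^ ((n ℕ.* suc n) ℕ./ 2)) m ℚ.* seq (√5⁻¹ ^ n) m ℚ.* Q n (seq b m) ∣ ℚ.≤ ε
Fprod-near n ε 0<ε = eventually-map
  (λ m → subst (λ z → ℚ.∣ ιₙ (Fprod n) ℚ.- seq (φ ^ ((n ℕ.* suc n) ℕ./ 2)) m ℚ.* seq (√5⁻¹ ^ n) m ℚ.* z ∣ ℚ.≤ ε) (seq-Π n m))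
  (difference-null (Fprod≃ n) ε 0<ε)

ratio-near : ∀ {α} → 0ℚ ℚ.< α → ∀ n 50≤n → tailS n ℚ.≤ α → tailQ n ℚ.≤ α →
  Eventually λ m → ℚ.∣ seq (ratio n 50≤n) m ℚ.- 1ℚ ∣ ℚ.≤ ιₙ 33 ℚ.* α
ratio-near {α} 0<α n 50≤n S-small Q-small = eventually-map₂
  (λ m (near₁ , near) (b-good , n≤m) → subst (λ z → ℚ.∣ z ℚ.- 1ℚ ∣ ℚ.≤ ιₙ 33 ℚ.* α) (sym (seq-ratio n 50≤n m))
    (ratio-at {α} {inverseℚ (ι (det (FR n))) (ι (det (FR n)) ℚ.≟ 0ℚ)} {seq b m} {seq (φ ^ ((n ℕ.* suc n) ℕ./ 2)) m} {seq (√5⁻¹ ^ n) m}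
      n m 50≤n n≤m S-small Q-small (det-FR-inverse n 50≤n) b-good near₁ near))
  -- Binet's formula is used at two accuracies: within 1 to compare the power of φ over that of √5
  -- with P, and within α for the error itself, as α need not be at most 1.
  (eventually-map₂ (λ _ → _,_) (Fprod-near n 1ℚ (ℚ.positive⁻¹ 1ℚ)) (Fprod-near n α 0<α))
  (eventually-map₂ (λ _ → _,_) b-eventually-near (eventually-≥ n))

ratio⟶1 : ∀ ε → 0ℚ ℚ.< ε → Eventually λ n → ∀ 50≤n → ∣ ratio n 50≤n - 1ℝ ∣ < fromℚ ε
ratio⟶1 ε 0<ε = eventually-map₂
  (λ n S-small Q-small 50≤n → ∣∣<-intro {ratio n 50≤n - 1ℝ} (½ε<ε 0<ε)
    (eventually-map (λ m → subst (ℚ.∣ seq (ratio n 50≤n) m ℚ.- 1ℚ ∣ ℚ.≤_) (lem ε)) (ratio-near 0<α n 50≤n S-small Q-small)))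
  (tailS-vanishing α 0<α) (tailQ-vanishing α 0<α)
  where
  α = + 1 ℚ./ 66 ℚ.* ε
  0<α : 0ℚ ℚ.< α
  0<α = 0<* (ℚ.positive⁻¹ (+ 1 ℚ./ 66)) 0<ε
  lem : ∀ ε → ιₙ 33 ℚ.* (+ 1 ℚ./ 66 ℚ.* ε) ≡ ½ ℚ.* ε
  lem = RingSolver.solve-∀ ℚ-ring

theorem3 : ∃[ C ] ∃[ C-φ ]
    ((λ n → ∑ n (λ k → fromℚ (ℚ._/_ (μ (suc k)) (F (suc k)) {{F-nonZero k}}))) ⟶ C)
    × ((λ n → ∏ n (λ k → 1ℝ - b ^ suc k)) ⟶ C-φ)
    × (C-φ ≈ + 1226742 ℚ./ 1000000 ± (+ 1 ℚ./ 2000000))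
    × (C * C-φ ≈ (ℤ.- + 7921376) ℚ./ 10000000 ± (+ 1 ℚ./ 20000000))
    × ((λ n → fromℤ (det (FR n)))
    ∼ (λ n → C * C-φ * φ ^ ((n ℕ.* suc n) ℕ./ 2) * √5⁻¹ ^ n))
theorem3 = C , C-φ , ∑⟶C , Π⟶C-φ , C-φ≈ , C*C-φ≈ ,
  50 , (λ k → det-FR#0 (50 ℕ.+ k) (ℕ.m≤m+n 50 k)) , λ ε 0<ε →
    let (N , close) = ratio⟶1 ε 0<ε in
    N , λ k N≤k → close (50 ℕ.+ k) (ℕ.m≤n⇒m≤o+n 50 N≤k) (ℕ.m≤m+n 50 k)
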